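{- Let $d,e>1$ and $w\ge 0$ be integers. The number of $d$-balanced $e$-regular partitions in a block (any block) of $e$-weight $w$ is $$\binom{w+\left\lfloor\frac{e-1}{d}\right\rfloor-1}{w}.$$
   Context: A partition $\lambda=(\lambda_1\ge\lambda_2\ge\dots\ge\lambda_\ell>0)$ has Young diagram $[\lambda]=\{(r,c):1\le r\le \ell,\ 1\le c\le\lambda_r\}$ and size $|\lambda|=\sum\lambda_j$; $\lambda'$ denotes the conjugate partition. It is $e$-regular if no part is repeated $e$ or more times. For $(r,c)\in[\lambda]$ the arm length of the hook at $(r,c)$ is $a_{rc}(\lambda)=\lambda_r-c$ and its hook length is $h_{rc}(\lambda)=a_{rc}(\lambda)+(\lambda'_c-r)+1$. The partition $\lambda$ is $d$-balanced (with respect to $e$) if $d\mid a_{rc}(\lambda)$ for every node $(r,c)\in[\lambda]$ with $e\mid h_{rc}(\lambda)$. The $\beta$-set of $\lambda$ is $B_0(\lambda)=\{\lambda_j-j: j\ge 1\}$ (with $\lambda_j=0$ for $j>\ell$). The $e$-core of $\lambda$ is the partition whose $\beta$-set is obtained from $B_0(\lambda)$ by repeatedly replacing an element $b$ by $b-e$ whenever $b-e$ is not in the set, until this is no longer possible (equivalently, by removing rim hooks of length $e$ until none remain). The $e$-weight of $\lambda$ is $(|\lambda|-|\gamma|)/e$, where $\gamma$ is the $e$-core of $\lambda$. A block is the set of all partitions with a given $e$-core $\gamma$ (a partition equal to its own $e$-core) and a given $e$-weight $w\geq 0$. The binomial coefficient follows the usual (stars-and-bars) convention when $\lfloor (e-1)/d\rfloor=0$: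 $\binom{ -1}{0}=1$ and $\binom{w-1}{w}=0$ for $w\ge1$. -}

module Defs where

open import Data.Nat using (ℕ; zero; suc; _+_; _∸_; _*_; _≤_; _<_; _≥_; _≟_; _≤?_)
open import Data.Nat.Properties using (≤-irrelevant)
open import Data.Nat.Divisibility using (_∣_)
open import Data.Integer as ℤ using (ℤ; +_)
open import Data.List using (List; []; _∷_; length; filter; sum)
open import Data.List.Membership.Propositional using () renaming (_∈_ to _∈ₗ_)
open import Data.List.Relation.Unary.All as All using (All)
open import Data.List.Relation.Unary.Linked as Linked using (Linked)
open import Data.List.Relation.Unary.Unique.Propositional using (Unique)
open import Data.Product using (∃-syntax; _×_)
open import Function.Bundles using (_⇔_)
open import Relation.Binary.Construct.Closure.ReflexiveTransitive using (Star)
open import Relation.Binary.PropositionalEquality using (_≡_; refl; cong₂)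
open import Relation.Unary using (_∈_; _∉_; _∪_; _∖_; ｛_｝; _≐_)

record Partition : Set where
  constructor mkPartition
  field
    parts      : List ℕ
    decreasing : Linked _≥_ parts
    positive   : All (1 ≤_) parts

open Partition public

-- Both proof fields are propositions, so equality of partitions (used for
-- counting below) is equality of their lists of parts.
parts-injective : ∀ {μ ν} → parts μ ≡ parts ν → μ ≡ ν
parts-injective {mkPartition xs p q} {mkPartition .xs p′ q′} refl =
  cong₂ (mkPartition xs) (Linked.irrelevant ≤-irrelevant p p′)
                         (All.irrelevant ≤-irrelevant q q′)

size : Partition → ℕ
size ν = sum (parts ν)

-- Entries are numbered from 1 and extended by 0 past the end of the list;
-- index 0 is never used.
entry : List ℕ → ℕ → ℕ
entry []       _             = 0
entry (_ ∷ _)  zero          = 0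
entry (x ∷ _)  (suc zero)    = x
entry (_ ∷ xs) (suc (suc j)) = entry xs (suc j)

part : Partition → ℕ → ℕ
part ν j = entry (parts ν) j

-- The c-th part of the conjugate partition (c ≥ 1): the length of column c.
conjPart : Partition → ℕ → ℕ
conjPart ν c = length (filter (c ≤?_) (parts ν))

Node : Partition → ℕ → ℕ → Set
Node ν r c = (1 ≤ r × r ≤ length (parts ν)) × (1 ≤ c × c ≤ part ν r)

-- For a node (r , c) of ν we have c ≤ part ν r and r ≤ conjPart ν c, so the
-- truncated subtractions below are exact; they are only applied to nodes.
arm : Partition → ℕ → ℕ → ℕ
arm ν r c = part ν r ∸ c

hook : Partition → ℕ → ℕ → ℕ
hook ν r c = arm ν r c + (conjPart ν c ∸ r) + 1

Regular : ℕ → Partition → Set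
Regular e ν = ∀ p → p ∈ₗ parts ν → length (filter (_≟ p) (parts ν)) < e

Balanced : (d e : ℕ) → Partition → Set
Balanced d e ν = ∀ r c → Node ν r c → e ∣ hook ν r c → d ∣ arm ν r c

β-set : Partition → ℤ → Set
β-set ν b = ∃[ j ] (1 ≤ j × b ≡ + part ν j ℤ.- + j)

-- One step of the core algorithm: some b in the β-set of μ, with b - e not
-- in it, is replaced by b - e, and the result is the β-set of ν.
Move : ℕ → Partition → Partition → Set
Move e μ ν = ∃[ b ]
  ( b ∈ β-set μ
  × b ℤ.- + e ∉ β-set μ
  × β-set ν ≐ (β-set μ ∖ ｛ b ｝) ∪ ｛ b ℤ.- + e ｝ )

Terminal : ℕ → Partition → Set
Terminal e ν = ∀ b → b ∈ β-set ν → b ℤ.- + e ∈ β-set ν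

HasCore : ℕ → Partition → Partition → Set
HasCore e ν γ = Star (Move e) ν γ × Terminal e γ

IsCore : ℕ → Partition → Set
IsCore e γ = HasCore e γ γ

-- The second component says that the weight (size ν - size γ) / e equals w.
Block : (e : ℕ) (γ : Partition) (w : ℕ) → Partition → Set
Block e γ w ν = HasCore e ν γ × size ν ≡ size γ + w * e

HasCardinality : {A : Set} → (A → Set) → ℕ → Set
HasCardinality {A} P n =
  ∃[ xs ] (Unique xs × ((x : A) → x ∈ₗ xs ⇔ P x) × length xs ≡ n)

{-# OPTIONS --safe #-}

-- Write a partition on an abacus with e runners and label each position by the number
-- of gaps up to it.  For a gap and a later bead of the same runner the arm length of
-- the corresponding hook is the difference of their labels, so a partition is
-- d-balanced if on every runner the gaps have the same label modulo d as the later
-- beads.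
--
-- Fix two adjacent runners and everything else.  Each row of the two runners holds two
-- beads, two gaps, or one of each.  Given the positions of the mixed rows, at most one
-- balanced filling puts a given number of beads on the left runner: two such fillings
-- would fill some two rows in opposite ways, and then one filling forces two labels to
-- be congruent while the other forces them to differ by one, and d > 1.  Moving one bead
-- at a time shows that a balanced filling with the bead numbers of the two runners
-- exchanged exists, and regularity survives.  So the count for given bead numbers
-- depends only on their multiset.  Prepending a bead permutes the runners cyclically
-- and increases one bead number by one; hence in weight w the count is the same for all
-- bead numbers that are at least w.
--
-- If the bead numbers are far apart, the label grows by c plus the number of gaps met
-- on runner c itself during one turn around the abacus.  Then the balanced regular
-- partitions are those with a partition (1ᵛ) on each runner c, empty unless c is a
-- positive multiple of d.  They correspond to the compositions of w into (e − 1) / d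
-- parts, zero allowed.
module Submission where

open import Defs
open import Data.Bool using (Bool; true; false; if_then_else_)
open import Data.Bool.Properties using () renaming (_≟_ to _≟ᵇ_)
open import Data.Empty using (⊥)
open import Data.Integer as ℤ using (ℤ)
open import Data.List using (List; []; _∷_; _++_; _∷ʳ_; length; filter; applyUpTo; replicate)
open import Data.List.Membership.Propositional using () renaming (_∈_ to _∈ₗ_)
open import Data.List.Relation.Binary.Permutation.Propositional as Perm using (_↭_)
open import Data.List.Relation.Unary.All as All using (All; []; _∷_)
open import Data.List.Relation.Unary.AllPairs as AllPairs using (AllPairs; []; _∷_)
open import Data.List.Relation.Unary.Any as Any using (Any; here; there)
open import Data.List.Relation.Unary.Linked as Linked using (Linked; []; [-]; _∷_)
open import Data.Nat
open import Data.Nat.Combinatorics using (_C_)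
open import Data.Nat.Divisibility using (_∣_; divides)
open import Data.Nat.ListAction using (sum)
open import Data.Nat.Properties
open import Data.Product using (Σ; ∃-syntax; _×_; _,_; proj₁; proj₂)
open import Data.Sum using (_⊎_; inj₁; inj₂)
open import Function using (_∘_; id; flip)
open import Function.Bundles using (_⇔_; mk⇔; Equivalence)
open import Relation.Binary using (tri<; tri≈; tri>)
open import Relation.Binary.Construct.Closure.ReflexiveTransitive using (Star; ε; _◅_)
open import Relation.Binary.PropositionalEquality
open import Relation.Nullary using (¬_; Dec; yes; no; contradiction; _×-dec_)
open import Algebra.Properties.CommutativeSemigroup +-commutativeSemigroup using (interchange; xy∙z≈xz∙y)
open import Data.Nat.Tactic.RingSolver using (solve-∀)
import Data.List.Membership.Propositional.Properties as Membership
import Data.List.Properties as List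
import Data.List.Relation.Binary.Permutation.Propositional.Properties as Perm
import Data.List.Relation.Unary.All.Properties as All
import Data.List.Relation.Unary.AllPairs.Properties as AllPairs
import Data.List.Relation.Unary.Any.Properties as Any
import Data.Nat.Combinatorics as Comb
import Data.Nat.Divisibility as Div
import Data.Nat.DivMod as DivMod
import Data.Integer.Properties as ℤ
import Data.Integer.Tactic.RingSolver as ℤ

-- Both halves of the exchange of runners rest on the convention that a label counts its own
-- position: exchanging the contents of columns i and i + 1 in any rows then changes no label
-- outside column i. The labels of column i are recovered from those of column i + 1, which agree
-- with them at a bead of column i + 1 and exceed them by one at a gap.
--
-- A single move may change the weight, so the induction over the moves carries only balance and
-- regularity. The weight returns at the end: the sum of the row indices of all beads in the two
-- columns never changes, and once the two bead numbers are exchanged this sum determines the number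
-- of inversions.
--
-- Prepending a bead can be undone only if the very first position is a bead. In weight w this is
-- certain for a first runner with more than w beads, which is where the bound w on the bead numbers
-- comes from, and the block is displayed with enough beads to meet it. The bead numbers passed
-- through on the way need have nothing to do with the given core.

-- Counting up to an equivalence

Card : {A : Set} → (A → A → Set) → (A → Set) → ℕ → Set
Card {A} _≈_ P n =
  Σ (List A) λ xs → All P xs × AllPairs (λ x y → ¬ x ≈ y) xs × (∀ x → P x → Any (x ≈_) xs) × length xs ≡ n

-- Configurations are functions of which only the columns below `e` matter, so they are counted up
-- to `_≈[ e ]_`, and a bijection becomes a relation that respects the two equivalences. `P` and `Q`
-- are available in `functional` and `injective` because the exchange of runners is single-valued
-- only among balanced configurations.
record Correspondence {A B : Set} (_≈_ : A → A → Set) (_≋_ : B → B → Set)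
                      (P : A → Set) (Q : B → Set) (T : A → B → Set) : Set where
  field
    total      : ∀ x → P x → ∃[ y ] (Q y × T x y)
    surjective : ∀ y → Q y → ∃[ x ] (P x × T x y)
    functional : ∀ {x x′ y y′} → P x → P x′ → Q y → Q y′ → T x y → T x′ y′ → x ≈ x′ → y ≋ y′
    injective  : ∀ {x x′ y y′} → P x → P x′ → Q y → Q y′ → T x y → T x′ y′ → y ≋ y′ → x ≈ x′

Correspondence-sym : ∀ {A B _≈_ _≋_ P Q T} → Correspondence {A} {B} _≈_ _≋_ P Q T →
                     Correspondence _≋_ _≈_ Q P (flip T)
Correspondence-sym c = record
  { total      = surjective
  ; surjective = total
  ; functional = λ q q′ p p′ → injective p p′ q q′
  ; injective  = λ q q′ p p′ → functional p p′ q q′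
  } where open Correspondence c

Card-transfer : ∀ {A B _≈_ _≋_ P Q T n} → Correspondence {A} {B} _≈_ _≋_ P Q T → Card _≈_ P n → Card _≋_ Q n
Card-transfer {A} {B} {_≈_} {_≋_} {P} {Q} {T} {n} c (xs , pxs , dxs , cxs , refl) =
  images pxs , images-Q pxs , images-distinct pxs dxs , complete , images-length pxs
  where
  open Correspondence c

  images : ∀ {xs} → All P xs → List B
  images []                 = []
  images (_∷_ {x = x} p ps) = proj₁ (total x p) ∷ images ps

  images-Q : ∀ {xs} (ps : All P xs) → All Q (images ps)
  images-Q []       = []
  images-Q (p ∷ ps) = proj₁ (proj₂ (total _ p)) ∷ images-Q ps

  images-length : ∀ {xs} (ps : All P xs) → length (images ps) ≡ length xs
  images-length []       = refl
  images-length (p ∷ ps) = cong suc (images-length ps)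

  apart : ∀ {x xs} (p : P x) (ps : All P xs) → All (λ y → ¬ x ≈ y) xs →
          All (λ y → ¬ proj₁ (total x p) ≋ y) (images ps)
  apart p []       []       = []
  apart p (q ∷ ps) (d ∷ ds) = (λ eq → d (injective p q (proj₁ (proj₂ (total _ p))) (proj₁ (proj₂ (total _ q)))
                                            (proj₂ (proj₂ (total _ p))) (proj₂ (proj₂ (total _ q))) eq))
                              ∷ apart p ps ds

  images-distinct : ∀ {xs} (ps : All P xs) → AllPairs (λ x y → ¬ x ≈ y) xs → AllPairs (λ x y → ¬ x ≋ y) (images ps)
  images-distinct []       []       = []
  images-distinct (p ∷ ps) (d ∷ ds) = apart p ps d ∷ images-distinct ps ds

  find : ∀ {x y xs} → P x → Q y → T x y → (ps : All P xs) → Any (x ≈_) xs → Any (y ≋_) (images ps)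
  find px qy t (p ∷ ps) (here x≈)  = here (functional px p qy (proj₁ (proj₂ (total _ p))) t (proj₂ (proj₂ (total _ p))) x≈)
  find px qy t (p ∷ ps) (there x∈) = there (find px qy t ps x∈)

  complete : ∀ y → Q y → Any (y ≋_) (images pxs)
  complete y qy with surjective y qy
  ... | x , px , t = find px qy t pxs (cxs x px)

Card-⊎ : ∀ {A _≈_ P Q m n} → Card {A} _≈_ P m → Card _≈_ Q n → (∀ {x y} → P x → Q y → ¬ x ≈ y) →
         Card _≈_ (λ x → P x ⊎ Q x) (m + n)
Card-⊎ (xs , pxs , dxs , cxs , refl) (ys , qys , dys , cys , refl) apart =
  xs ++ ys ,
  All.++⁺ (All.map inj₁ pxs) (All.map inj₂ qys) ,
  AllPairs.++⁺ dxs dys (All.map (λ p → All.map (apart p) qys) pxs) ,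
  (λ { x (inj₁ p) → Any.++⁺ˡ (cxs x p) ; x (inj₂ q) → Any.++⁺ʳ xs (cys x q) }) ,
  List.length-++ xs

Card-cong : ∀ {A _≈_ P Q n} → (∀ {x} → P x → Q x) → (∀ {x} → Q x → P x) → Card {A} _≈_ P n → Card _≈_ Q n
Card-cong f g (xs , pxs , dxs , cxs , eq) = xs , All.map f pxs , dxs , (λ x q → cxs x (g q)) , eq

Card-≡⇒HasCardinality : ∀ {A : Set} {P : A → Set} {n} → Card _≡_ P n → HasCardinality P n
Card-≡⇒HasCardinality (xs , pxs , dxs , cxs , eq) =
  xs , dxs , (λ x → mk⇔ (All.lookup pxs) (cxs x)) , eq

-- Finite sums

sumTo : (ℕ → ℕ) → ℕ → ℕ
sumTo f zero    = 0
sumTo f (suc n) = sumTo f n + f n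

sumTo-cong : ∀ {f g} n → (∀ k → k < n → f k ≡ g k) → sumTo f n ≡ sumTo g n
sumTo-cong zero    eq = refl
sumTo-cong (suc n) eq = cong₂ _+_ (sumTo-cong n λ k k<n → eq k (m<n⇒m<1+n k<n)) (eq n ≤-refl)

sumTo-mono-≤ : ∀ {f g} n → (∀ k → k < n → f k ≤ g k) → sumTo f n ≤ sumTo g n
sumTo-mono-≤ zero    le = ≤-refl
sumTo-mono-≤ (suc n) le = +-mono-≤ (sumTo-mono-≤ n λ k k<n → le k (m<n⇒m<1+n k<n)) (le n ≤-refl)

sumTo-monoʳ-≤ : ∀ f {m n} → m ≤ n → sumTo f m ≤ sumTo f n
sumTo-monoʳ-≤ f {m} {n} m≤n with m≤n⇒m<n∨m≡n m≤n
... | inj₂ refl = ≤-refl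
sumTo-monoʳ-≤ f {m} {suc n} m≤n | inj₁ (s≤s m≤n′) = ≤-trans (sumTo-monoʳ-≤ f m≤n′) (m≤m+n _ (f n))

sumTo-lookup-≤ : ∀ f {k n} → k < n → f k ≤ sumTo f n
sumTo-lookup-≤ f {k} k<n = ≤-trans (m≤n+m (f k) (sumTo f k)) (sumTo-monoʳ-≤ f k<n)

sumTo-+ : ∀ f g n → sumTo (λ k → f k + g k) n ≡ sumTo f n + sumTo g n
sumTo-+ f g zero    = refl
sumTo-+ f g (suc n) = trans (cong (_+ (f n + g n)) (sumTo-+ f g n)) (interchange (sumTo f n) (sumTo g n) (f n) (g n))

sumTo-const0 : ∀ {f} n → (∀ k → k < n → f k ≡ 0) → sumTo f n ≡ 0
sumTo-const0 zero    eq = refl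
sumTo-const0 (suc n) eq = cong₂ _+_ (sumTo-const0 n λ k k<n → eq k (m<n⇒m<1+n k<n)) (eq n ≤-refl)

sumTo-const1 : ∀ {f} n → (∀ k → k < n → f k ≡ 1) → sumTo f n ≡ n
sumTo-const1 zero    eq = refl
sumTo-const1 (suc n) eq = trans (cong₂ _+_ (sumTo-const1 n λ k k<n → eq k (m<n⇒m<1+n k<n)) (eq n ≤-refl)) (+-comm n 1)

sumTo-++ : ∀ f a n → sumTo f (a + n) ≡ sumTo f a + sumTo (λ k → f (a + k)) n
sumTo-++ f a zero    rewrite +-identityʳ a | +-identityʳ (sumTo f a) = refl
sumTo-++ f a (suc n) rewrite +-suc a n = trans (cong (_+ f (a + n)) (sumTo-++ f a n)) (+-assoc (sumTo f a) _ _)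

sumTo-suc : ∀ f n → sumTo f (suc n) ≡ f 0 + sumTo (f ∘ suc) n
sumTo-suc f n = sumTo-++ f 1 n

sumTo-stable : ∀ f {m n} → m ≤ n → (∀ k → m ≤ k → f k ≡ 0) → sumTo f n ≡ sumTo f m
sumTo-stable f {m} {n} m≤n vanish with m≤n⇒m<n∨m≡n m≤n
... | inj₂ refl = refl
sumTo-stable f {m} {suc n} m≤n vanish | inj₁ (s≤s m≤n′) =
  trans (cong (sumTo f n +_) (vanish n m≤n′)) (trans (+-identityʳ _) (sumTo-stable f m≤n′ vanish))

sumTo-update : ∀ f g {k} n → k < n → (∀ j → j ≢ k → f j ≡ g j) → sumTo f n + g k ≡ sumTo g n + f k
sumTo-update f g {k} (suc n) (s≤s k≤n) eq with m≤n⇒m<n∨m≡n k≤n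
... | inj₂ refl = trans (cong (λ s → s + f k + g k) (sumTo-cong n λ j j<n → eq j (<⇒≢ j<n))) (xy∙z≈xz∙y (sumTo g n) (f k) (g k))
... | inj₁ k<n rewrite eq n (≢-sym (<⇒≢ k<n)) =
  trans (xy∙z≈xz∙y (sumTo f n) (g n) (g k)) (trans (cong (_+ g n) (sumTo-update f g n k<n eq)) (xy∙z≈xz∙y (sumTo g n) (f k) (g n)))

sumTo-exchange : ∀ (h : ℕ → ℕ → ℕ) m n → sumTo (λ i → sumTo (h i) n) m ≡ sumTo (λ j → sumTo (λ i → h i j) m) n
sumTo-exchange h zero    n = sym (sumTo-const0 n λ _ _ → refl)
sumTo-exchange h (suc m) n =
  trans (cong (_+ sumTo (h m) n) (sumTo-exchange h m n)) (sym (sumTo-+ (λ j → sumTo (λ i → h i j) m) (h m) n))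

sumTo-rows : ∀ f e m → sumTo f (m * e) ≡ sumTo (λ r → sumTo (λ c → f (r * e + c)) e) m
sumTo-rows f e zero    = refl
sumTo-rows f e (suc m) =
  trans (cong (sumTo f) (+-comm e (m * e)))
        (trans (sumTo-++ f (m * e) e) (cong (_+ sumTo (λ c → f (m * e + c)) e) (sumTo-rows f e m)))

-- Beads, gaps and inversions of a word

bead gap : Bool → ℕ
bead b = if b then 1 else 0
gap  b = if b then 0 else 1

cnt gaps inv wsum : (ℕ → Bool) → ℕ → ℕ
cnt  f = sumTo (bead ∘ f)
gaps f = sumTo (gap ∘ f)
inv  f = sumTo λ k → if f k then gaps f k else 0
wsum f = sumTo λ k → if f k then k else 0

tri : ℕ → ℕ
tri = sumTo id

gaps+cnt : ∀ f n → gaps f n + cnt f n ≡ n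
gaps+cnt f n = trans (sym (sumTo-+ (gap ∘ f) (bead ∘ f) n)) (sumTo-const1 n λ k _ → one (f k))
  where
  one : ∀ b → gap b + bead b ≡ 1
  one true  = refl
  one false = refl

cnt≤ : ∀ f n → cnt f n ≤ n
cnt≤ f n = subst (cnt f n ≤_) (gaps+cnt f n) (m≤n+m _ _)

-- A bead at position `k` has `k` positions before it. The gaps among them are its term of `inv`;
-- the numbers of beads among them are 0, 1, 2, ... over all beads and add up to `tri (cnt f n)`.
-- Inversions are thus computed from `wsum`, which changes predictably when a bead moves.
wsum≡inv+tri : ∀ f n → wsum f n ≡ inv f n + tri (cnt f n)
wsum≡inv+tri f zero    = refl
wsum≡inv+tri f (suc n) with f n
... | false rewrite +-identityʳ (cnt f n) | +-identityʳ (inv f n) | +-identityʳ (wsum f n) = wsum≡inv+tri f n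
... | true rewrite +-comm (cnt f n) 1 =
  trans (cong₂ _+_ (wsum≡inv+tri f n) (sym (gaps+cnt f n)))
        (interchange (inv f n) (tri (cnt f n)) (gaps f n) (cnt f n))

bead-false : ∀ {b} → b ≡ false → bead b ≡ 0
bead-false refl = refl

cnt-stable : ∀ f {m n} → m ≤ n → (∀ k → m ≤ k → f k ≡ false) → cnt f n ≡ cnt f m
cnt-stable f m≤n vanish = sumTo-stable (bead ∘ f) m≤n λ k m≤k → bead-false (vanish k m≤k)

inv-stable : ∀ f {m n} → m ≤ n → (∀ k → m ≤ k → f k ≡ false) → inv f n ≡ inv f m
inv-stable f m≤n vanish = sumTo-stable _ m≤n λ k m≤k → cong (if_then gaps f k else 0) (vanish k m≤k)

cnt-cong : ∀ {f g} n → (∀ k → k < n → f k ≡ g k) → cnt f n ≡ cnt g n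
cnt-cong n eq = sumTo-cong n λ k k<n → cong bead (eq k k<n)

inv-cong : ∀ {f g} n → (∀ k → k < n → f k ≡ g k) → inv f n ≡ inv g n
inv-cong {f} {g} n eq = sumTo-cong n λ k k<n →
  cong₂ (λ b v → if b then v else 0) (eq k k<n) (sumTo-cong k λ j j<k → cong gap (eq j (<-trans j<k k<n)))

cnt-mono-≤ : ∀ {f g} n → (∀ k → k < n → f k ≡ true → g k ≡ true) → cnt f n ≤ cnt g n
cnt-mono-≤ {f} {g} n imp = sumTo-mono-≤ n λ k k<n → le (f k) (g k) (imp k k<n)
  where
  le : ∀ b b′ → (b ≡ true → b′ ≡ true) → bead b ≤ bead b′
  le false b′ _ = z≤n
  le true  b′ h rewrite h refl = ≤-refl

-- At most `k` beads precede the gap, and every bead after it contributes at least one inversion.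
gap⇒cnt≤ : ∀ f {k n} → k < n → f k ≡ false → cnt f n ≤ k + inv f n
gap⇒cnt≤ f {k} {suc n} (s≤s k≤n) fk with m≤n⇒m<n∨m≡n k≤n
... | inj₂ refl rewrite fk | +-identityʳ (cnt f k) = m≤n⇒m≤n+o _ (cnt≤ f k)
... | inj₁ k<n with f n
...   | false rewrite +-identityʳ (cnt f n) | +-identityʳ (inv f n) = gap⇒cnt≤ f k<n fk
...   | true  = subst (cnt f n + 1 ≤_) (+-assoc k (inv f n) (gaps f n))
                  (+-mono-≤ (gap⇒cnt≤ f k<n fk) (≤-trans (≤-reflexive (sym (cong gap fk))) (sumTo-lookup-≤ (gap ∘ f) k<n)))

-- The `k` positions before the bead consist of gaps, whose number is a term of `inv f n`, and of
-- fewer than `cnt f n` beads.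
bead⇒<cnt+inv : ∀ f {k n} → k < n → f k ≡ true → k < cnt f n + inv f n
bead⇒<cnt+inv f {k} {suc n} (s≤s k≤n) fk with m≤n⇒m<n∨m≡n k≤n
... | inj₂ refl rewrite fk = begin-strict
  k                                     ≡⟨ gaps+cnt f k ⟨
  gaps f k + cnt f k                    <⟨ n<1+n _ ⟩
  suc (gaps f k + cnt f k)              ≤⟨ m≤m+n _ (inv f k) ⟩
  suc (gaps f k + cnt f k) + inv f k    ≡⟨ rearrange (gaps f k) (cnt f k) (inv f k) ⟩
  cnt f k + 1 + (inv f k + gaps f k)    ∎
  where
  open ≤-Reasoning
  rearrange : ∀ a b c → suc (a + b) + c ≡ b + 1 + (c + a)
  rearrange = solve-∀
... | inj₁ k<n = <-≤-trans (bead⇒<cnt+inv f k<n fk) (+-mono-≤ (sumTo-monoʳ-≤ _ (n≤1+n n)) (sumTo-monoʳ-≤ _ (n≤1+n n)))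

-- Bounded search

greatest-below : ∀ {Q : ℕ → Set} → (∀ k → Dec (Q k)) → ∀ n →
                 (∃[ k ] (k < n × Q k × (∀ j → k < j → j < n → ¬ Q j))) ⊎ (∀ j → j < n → ¬ Q j)
greatest-below Q? zero    = inj₂ λ _ ()
greatest-below Q? (suc n) with Q? n
... | yes q = inj₁ (n , ≤-refl , q , λ j n<j j<sn _ → <-irrefl refl (<-≤-trans n<j (≤-pred j<sn)))
... | no ¬q with greatest-below Q? n
...   | inj₁ (k , k<n , q , max) = inj₁ (k , m<n⇒m<1+n k<n , q , max′)
  where
  max′ : ∀ j → k < j → j < suc n → ¬ _
  max′ j k<j (s≤s j≤n) with m≤n⇒m<n∨m≡n j≤n
  ... | inj₁ j<n  = max j k<j j<n
  ... | inj₂ refl = ¬q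
...   | inj₂ none = inj₂ none′
  where
  none′ : ∀ j → j < suc n → ¬ _
  none′ j (s≤s j≤n) with m≤n⇒m<n∨m≡n j≤n
  ... | inj₁ j<n  = none j j<n
  ... | inj₂ refl = ¬q

least-below : ∀ {Q : ℕ → Set} → (∀ k → Dec (Q k)) → ∀ n →
              (∃[ k ] (k < n × Q k × (∀ j → j < k → ¬ Q j))) ⊎ (∀ j → j < n → ¬ Q j)
least-below Q? zero    = inj₂ λ _ ()
least-below Q? (suc n) with least-below Q? n
... | inj₁ (k , k<n , q , min) = inj₁ (k , m<n⇒m<1+n k<n , q , min)
... | inj₂ none with Q? n
...   | yes q = inj₁ (n , ≤-refl , q , none)
...   | no ¬q = inj₂ none′
  where
  none′ : ∀ j → j < suc n → ¬ _
  none′ j (s≤s j≤n) with m≤n⇒m<n∨m≡n j≤n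
  ... | inj₁ j<n  = none j j<n
  ... | inj₂ refl = ¬q

-- Congruence modulo d

-- Multiples of `d` are added on both sides, because chains of congruences compare labels in either
-- order and natural subtraction would truncate.
record Congruent (d a b : ℕ) : Set where
  constructor congruent
  field
    left right : ℕ
    balance    : a + left * d ≡ b + right * d

module _ {d : ℕ} where

  ≈-refl : ∀ {a} → Congruent d a a
  ≈-refl = congruent 0 0 refl

  ≈-sym : ∀ {a b} → Congruent d a b → Congruent d b a
  ≈-sym (congruent u v eq) = congruent v u (sym eq)

  ≈-trans : ∀ {a b c} → Congruent d a b → Congruent d b c → Congruent d a c
  ≈-trans {a} {b} {c} (congruent u v eq) (congruent u′ v′ eq′) = congruent (u + u′) (v′ + v)
    (trans (split a u u′ d) (trans (cong (_+ u′ * d) eq) (trans (xy∙z≈xz∙y b (v * d) (u′ * d))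
           (trans (cong (_+ v * d) eq′) (sym (split c v′ v d))))))
    where
    split : ∀ a u v d → a + (u + v) * d ≡ a + u * d + v * d
    split = solve-∀

  ≈-suc : ∀ {a b} → Congruent d a b → Congruent d (suc a) (suc b)
  ≈-suc (congruent u v eq) = congruent u v (cong suc eq)

  ≈-pred : ∀ {a b} → Congruent d (suc a) (suc b) → Congruent d a b
  ≈-pred (congruent u v eq) = congruent u v (suc-injective eq)

  ≈⇒∣ : ∀ {a k} → Congruent d a (a + k) → d ∣ k
  ≈⇒∣ {a} {k} (congruent u v eq) = Div.∣m+n∣m⇒∣n {m = v * d} {n = k}
    (subst (d ∣_) (+-cancelˡ-≡ a _ _ (trans eq (rearrange a k (v * d)))) (Div.n∣m*n u)) (Div.n∣m*n v)
    where
    rearrange : ∀ a k v → a + k + v ≡ a + (v + k)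
    rearrange = solve-∀

  ∣⇒≈ : ∀ {a k} → d ∣ k → Congruent d a (a + k)
  ∣⇒≈ {a} (divides q refl) = congruent q 0 (sym (+-identityʳ _))

  ≉-suc : 1 < d → ∀ {a} → ¬ Congruent d a (suc a)
  ≉-suc 1<d {a} a≈ = <-irrefl (sym (Div.∣1⇒≡1 (≈⇒∣ (subst (Congruent d a) (sym (+-comm a 1)) a≈)))) 1<d

-- Configurations on the abacus and their labels

-- A value m r c describes row r of runner c of an abacus; true is a bead.
Config : Set
Config = ℕ → ℕ → Bool

col : Config → ℕ → ℕ → Bool
col m c r = m r c

pre : Config → ℕ → ℕ → ℕ
pre m r = gaps (m r)

before : ℕ → Config → ℕ → ℕ
before e m = sumTo λ r → pre m r e

-- Gaps are counted up to and including the position itself. Hence a swap between columns `i` and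
-- `suc i` leaves the label in column `suc i` unchanged, and the label of a gap is the number of the
-- column of the Young diagram for which it stands.
lab : ℕ → Config → ℕ → ℕ → ℕ
lab e m r c = before e m r + pre m r (suc c)

BalancedC : ℕ → ℕ → Config → Set
BalancedC d e m = ∀ {c r s} → c < e → r < s → m r c ≡ false → m s c ≡ true → Congruent d (lab e m r c) (lab e m s c)

-- Equality of the two labels would mean that the gap is followed by e beads.
RegularC : ℕ → Config → Set
RegularC e m = ∀ {r c} → c < e → m r c ≡ false → lab e m r c ≢ lab e m (suc r) c

-- The gap in row `s` counts itself. This settles regularity whenever the next row has a gap, so
-- only a bead in the row after a gap needs attention.
lab-mono-< : ∀ {e m r s c} → c < e → r < s → m s c ≡ false → lab e m r c < lab e m s c
lab-mono-< {e} {m} {r} {s} {c} c<e r<s eq = begin-strict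
  before e m r + pre m r (suc c)            ≤⟨ +-monoʳ-≤ (before e m r) (sumTo-monoʳ-≤ _ c<e) ⟩
  before e m (suc r)                        ≤⟨ sumTo-monoʳ-≤ _ r<s ⟩
  before e m s                              <⟨ n<1+n _ ⟩
  suc (before e m s)                        ≡⟨ +-comm 1 (before e m s) ⟩
  before e m s + 1                          ≤⟨ +-monoʳ-≤ (before e m s) (subst (λ b → 1 ≤ pre m s c + gap b) (sym eq) (m≤n+m 1 _)) ⟩
  before e m s + pre m s (suc c)            ∎
  where open ≤-Reasoning

-- The inversions of a column are the boxes of the partition on that runner, so their
-- total is the e-weight.
record Class (e : ℕ) (ps : List ℕ) (w : ℕ) (m : Config) : Set where
  field
    height  : ℕ
    bounded : ∀ {r c} → height ≤ r → c < e → m r c ≡ false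
    counts  : applyUpTo (λ c → cnt (col m c) height) e ≡ ps
    weight  : sumTo (λ c → inv (col m c) height) e ≡ w

Good : (d e : ℕ) → List ℕ → ℕ → Config → Set
Good d e ps w m = Class e ps w m × BalancedC d e m × RegularC e m

_≈[_]_ : Config → ℕ → Config → Set
m ≈[ e ] m′ = ∀ r c → c < e → m r c ≡ m′ r c

true≢false : ∀ {b} → b ≡ true → ¬ b ≡ false
true≢false refl ()

true-or-false : ∀ b → b ≡ true ⊎ b ≡ false
true-or-false true  = inj₁ refl
true-or-false false = inj₂ refl

-- Exchanges between two adjacent runners

EqualUpToSwap : (a b a′ b′ : Bool) → Set
EqualUpToSwap a b a′ b′ = (a′ ≡ a × b′ ≡ b) ⊎ (a′ ≡ b × b′ ≡ a)

EqualUpToSwap-sym : ∀ {a b a′ b′} → EqualUpToSwap a b a′ b′ → EqualUpToSwap a′ b′ a b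
EqualUpToSwap-sym (inj₁ (p , q)) = inj₁ (sym p , sym q)
EqualUpToSwap-sym (inj₂ (p , q)) = inj₂ (sym q , sym p)

EqualUpToSwap-trans : ∀ {a b a′ b′ a″ b″} → EqualUpToSwap a b a′ b′ → EqualUpToSwap a′ b′ a″ b″ → EqualUpToSwap a b a″ b″
EqualUpToSwap-trans (inj₁ (refl , refl)) t                    = t
EqualUpToSwap-trans (inj₂ (refl , refl)) (inj₁ (refl , refl)) = inj₂ (refl , refl)
EqualUpToSwap-trans (inj₂ (refl , refl)) (inj₂ (refl , refl)) = inj₁ (refl , refl)

-- Swapping a row of two beads or of two gaps does nothing. The relation therefore fixes the other
-- columns and the positions of the mixed rows, and leaves only the filling of the mixed rows free.
record SameUpToSwap (e i : ℕ) (m m′ : Config) : Set where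
  field
    off : ∀ r {c} → c < e → c ≢ i → c ≢ suc i → m′ r c ≡ m r c
    row : ∀ r → EqualUpToSwap (m r i) (m r (suc i)) (m′ r i) (m′ r (suc i))

  -- A prefix of length other than `suc i` contains both exchanged positions or neither.
  pre≡ : ∀ r c → c ≤ e → c ≢ suc i → pre m′ r c ≡ pre m r c
  pre≡ r zero    _    _    = refl
  pre≡ r (suc c) c<e sc≢ with c ≟ suc i
  ... | no  c≢   = cong₂ _+_ (pre≡ r c (<⇒≤ c<e) c≢) (cong gap (off r c<e (λ c≡ → sc≢ (cong suc c≡)) c≢))
  ... | yes refl with pre≡ r i (≤-trans (n≤1+n i) (<⇒≤ c<e)) (≢-sym 1+n≢n) | row r
  ...   | eq-pre | inj₁ (eq , eq′) = cong₂ _+_ (cong₂ _+_ eq-pre (cong gap eq)) (cong gap eq′)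
  ...   | eq-pre | inj₂ (eq , eq′) = trans (cong₂ _+_ (cong₂ _+_ eq-pre (cong gap eq)) (cong gap eq′))
                                           (xy∙z≈xz∙y (pre m r i) (gap (m r (suc i))) (gap (m r i)))

  module _ (si<e : suc i < e) where

    before≡ : ∀ r → before e m′ r ≡ before e m r
    before≡ r = sumTo-cong r λ s _ → pre≡ s e ≤-refl (≢-sym (<⇒≢ si<e))

    lab≡ : ∀ r {c} → c < e → c ≢ i → lab e m′ r c ≡ lab e m r c
    lab≡ r {c} c<e c≢i = cong₂ _+_ (before≡ r) (pre≡ r (suc c) c<e (λ eq → c≢i (suc-injective eq)))

    lab-fixed : ∀ r → m′ r i ≡ m r i → lab e m′ r i ≡ lab e m r i
    lab-fixed r eq = cong₂ _+_ (before≡ r) (cong₂ _+_ (pre≡ r i (<⇒≤ (<-trans (n<1+n i) si<e)) (≢-sym 1+n≢n)) (cong gap eq))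

open SameUpToSwap

SameUpToSwap-refl : ∀ {e i m} → SameUpToSwap e i m m
SameUpToSwap-refl = record { off = λ r _ _ _ → refl ; row = λ r → inj₁ (refl , refl) }

SameUpToSwap-sym : ∀ {e i m m′} → SameUpToSwap e i m m′ → SameUpToSwap e i m′ m
SameUpToSwap-sym t = record
  { off = λ r c<e c≢ c≢′ → sym (off t r c<e c≢ c≢′) ; row = λ r → EqualUpToSwap-sym (row t r) }

SameUpToSwap-trans : ∀ {e i m m′ m″} → SameUpToSwap e i m m′ → SameUpToSwap e i m′ m″ → SameUpToSwap e i m m″
SameUpToSwap-trans t t′ = record
  { off = λ r c<e c≢ c≢′ → trans (off t′ r c<e c≢ c≢′) (off t r c<e c≢ c≢′)
  ; row = λ r → EqualUpToSwap-trans (row t r) (row t′ r)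
  }

module _ (e : ℕ) (m : Config) where

  -- Together with `lab-gap` this recovers the labels of column `i`, the only ones that a swap can
  -- change, from those of column `suc i`.
  lab-bead : ∀ r {i} → m r (suc i) ≡ true → lab e m r (suc i) ≡ lab e m r i
  lab-bead r {i} eq rewrite eq = cong (before e m r +_) (+-identityʳ _)

  lab-gap : ∀ r {i} → m r (suc i) ≡ false → lab e m r (suc i) ≡ suc (lab e m r i)
  lab-gap r {i} eq rewrite eq = trans (cong (before e m r +_) (+-comm _ 1)) (+-suc (before e m r) _)

module _ {d e i : ℕ} {m m′ : Config} (si<e : suc i < e) (t : SameUpToSwap e i m m′)
         (bal : BalancedC d e m) (reg : RegularC e m) where

  private
    i<e : i < e
    i<e = <-trans (n<1+n i) si<e

    Kept : ℕ → Set
    Kept r = m′ r i ≡ m r i × m′ r (suc i) ≡ m r (suc i)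

    lab≡′ : ∀ r → lab e m′ r (suc i) ≡ lab e m r (suc i)
    lab≡′ r = lab≡ t si<e r si<e 1+n≢n

    kept-lab : ∀ r → Kept r → lab e m′ r i ≡ lab e m r i
    kept-lab r (eq , _) = lab-fixed t si<e r eq

    cong≈ : ∀ {a b a′ b′} → a′ ≡ a → b′ ≡ b → Congruent d a b → Congruent d a′ b′
    cong≈ refl refl a≈b = a≈b

    other-balanced : ∀ {c r s} → c ≢ i → c ≢ suc i → c < e → r < s → m′ r c ≡ false → m′ s c ≡ true →
                     Congruent d (lab e m′ r c) (lab e m′ s c)
    other-balanced {r = r} {s} c≢i c≢si c<e r<s rc sc =
      cong≈ (lab≡ t si<e r c<e c≢i) (lab≡ t si<e s c<e c≢i)
            (bal c<e r<s (trans (sym (off t _ c<e c≢i c≢si)) rc) (trans (sym (off t _ c<e c≢i c≢si)) sc))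

    other-regular : ∀ {r c} → c ≢ i → c ≢ suc i → c < e → m′ r c ≡ false → lab e m′ r c ≢ lab e m′ (suc r) c
    other-regular {r} c≢i c≢si c<e rc =
      subst₂ _≢_ (sym (lab≡ t si<e r c<e c≢i)) (sym (lab≡ t si<e (suc r) c<e c≢i)) (reg c<e (trans (sym (off t _ c<e c≢i c≢si)) rc))

  -- Two flipped rows look alike and form no pair of a gap and a bead. A flipped row and a kept row
  -- with two beads or two gaps inherit their congruence from the column that the bead enters or
  -- leaves, respectively. What remains are the kept rows that could move right as well: `above` and
  -- `below` treat them for balance and `next` for regularity.
  module _ (flipped : ℕ → Set)
           (status : ∀ r → Kept r × ¬ flipped r ⊎
                           flipped r × (m r i ≡ true × m r (suc i) ≡ false × m′ r i ≡ false × m′ r (suc i) ≡ true))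
           (above : ∀ {r s} → r < s → flipped r → ¬ flipped s → m s i ≡ true → m s (suc i) ≡ false →
                    Congruent d (lab e m r (suc i)) (lab e m s i))
           (below : ∀ {r s} → r < s → ¬ flipped r → flipped s → m r i ≡ true → m r (suc i) ≡ false →
                    Congruent d (lab e m r (suc i)) (lab e m s (suc i)))
           (next : ∀ {r} → flipped r → ¬ flipped (suc r) → m (suc r) i ≡ true → m (suc r) (suc i) ≢ false) where

    moveRight-balanced : BalancedC d e m′
    moveRight-balanced {c} {r} {s} c<e r<s rc sc with c ≟ i | c ≟ suc i
    ... | no c≢i   | no c≢si = other-balanced c≢i c≢si c<e r<s rc sc
    ... | yes refl | _ with status r | status s
    ...   | _ | inj₂ (_ , _ , _ , s≡ , _) = contradiction s≡ (true≢false sc)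
    ...   | inj₁ (kr , _) | inj₁ (ks , _) =
            cong≈ (kept-lab r kr) (kept-lab s ks) (bal c<e r<s (trans (sym (proj₁ kr)) rc) (trans (sym (proj₁ ks)) sc))
    ...   | inj₂ (fr , _ , rF , r≡ , r≡′) | inj₁ (ks , ¬fs) with true-or-false (m s (suc i))
    ...     | inj₁ eq = cong≈ r-lab (trans (kept-lab s ks) (sym (lab-bead e m s eq))) (bal si<e r<s rF eq)
      where
      r-lab : lab e m′ r i ≡ lab e m r (suc i)
      r-lab = trans (sym (lab-bead e m′ r r≡′)) (lab≡′ r)
    ...     | inj₂ eq = cong≈ r-lab (kept-lab s ks) (above r<s fr ¬fs (trans (sym (proj₁ ks)) sc) eq)
      where
      r-lab : lab e m′ r i ≡ lab e m r (suc i)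
      r-lab = trans (sym (lab-bead e m′ r r≡′)) (lab≡′ r)
    moveRight-balanced {c} {r} {s} c<e r<s rc sc | no _ | yes refl with status r | status s
    ...   | inj₂ (_ , _ , _ , _ , r≡) | _ = contradiction rc (true≢false r≡)
    ...   | inj₁ (kr , _) | inj₁ (ks , _) =
            cong≈ (lab≡′ r) (lab≡′ s) (bal c<e r<s (trans (sym (proj₂ kr)) rc) (trans (sym (proj₂ ks)) sc))
    ...   | inj₁ (kr , ¬fr) | inj₂ (fs , sT , sF , _) with true-or-false (m r i)
    ...     | inj₁ eq = cong≈ (lab≡′ r) (lab≡′ s) (below r<s ¬fr fs eq (trans (sym (proj₂ kr)) rc))
    ...     | inj₂ eq = cong≈ (trans (lab≡′ r) (lab-gap e m r (trans (sym (proj₂ kr)) rc))) (trans (lab≡′ s) (lab-gap e m s sF))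
                            (≈-suc (bal i<e r<s eq sT))

    moveRight-regular : RegularC e m′
    moveRight-regular {r} {c} c<e rc with c ≟ i | c ≟ suc i
    ... | no c≢i   | no c≢si = other-regular c≢i c≢si c<e rc
    ... | no _     | yes refl with status r
    ...   | inj₁ (kr , _) = subst₂ _≢_ (sym (lab≡′ r)) (sym (lab≡′ (suc r))) (reg c<e (trans (sym (proj₂ kr)) rc))
    ...   | inj₂ (_ , _ , _ , _ , r≡) = contradiction rc (true≢false r≡)
    moveRight-regular {r} {c} c<e rc | yes refl | _ with true-or-false (m′ (suc r) i)
    ... | inj₂ eq = <⇒≢ (lab-mono-< c<e (n<1+n r) eq)
    ... | inj₁ eq with status r | status (suc r)
    ...   | _ | inj₂ (_ , _ , _ , s≡ , _) = contradiction s≡ (true≢false eq)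
    ...   | inj₁ (kr , _) | inj₁ (ks , _) =
            subst₂ _≢_ (sym (kept-lab r kr)) (sym (kept-lab (suc r) ks)) (reg c<e (trans (sym (proj₁ kr)) rc))
    ...   | inj₂ (fr , _ , rF , r≡ , r≡′) | inj₁ (ks , ¬fs) with true-or-false (m (suc r) (suc i))
    ...     | inj₂ eq′ = contradiction eq′ (next fr ¬fs (trans (sym (proj₁ ks)) eq))
    ...     | inj₁ eq′ = subst₂ _≢_ (trans (sym (lab≡′ r)) (lab-bead e m′ r r≡′))
                                 (trans (lab-bead e m (suc r) eq′) (sym (kept-lab (suc r) ks))) (reg si<e rF)

  -- The mirror image of the moves to the right. The `suc` in `below` appears because a flipped row
  -- ends up with a gap in column `suc i`, so that its new label in column `i` is one less than its
  -- label in column `suc i`.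
  module _ (flipped : ℕ → Set)
           (status : ∀ r → Kept r × ¬ flipped r ⊎
                           flipped r × (m r i ≡ false × m r (suc i) ≡ true × m′ r i ≡ true × m′ r (suc i) ≡ false))
           (below : ∀ {r s} → r < s → ¬ flipped r → flipped s → m r i ≡ false → m r (suc i) ≡ true →
                    Congruent d (suc (lab e m r i)) (lab e m s (suc i)))
           (above : ∀ {r s} → r < s → flipped r → ¬ flipped s → m s i ≡ false → m s (suc i) ≡ true →
                    Congruent d (lab e m r (suc i)) (lab e m s (suc i)))
           (previous : ∀ {r} → ¬ flipped r → flipped (suc r) → m r i ≡ false → m r (suc i) ≢ true) where

    private
      flipped-lab : ∀ r → m′ r (suc i) ≡ false → suc (lab e m′ r i) ≡ lab e m r (suc i)
      flipped-lab r eq = trans (sym (lab-gap e m′ r eq)) (lab≡′ r)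

    moveLeft-balanced : BalancedC d e m′
    moveLeft-balanced {c} {r} {s} c<e r<s rc sc with c ≟ i | c ≟ suc i
    ... | no c≢i   | no c≢si = other-balanced c≢i c≢si c<e r<s rc sc
    ... | yes refl | _ with status r | status s
    ...   | inj₂ (_ , _ , _ , r≡ , _) | _ = contradiction rc (true≢false r≡)
    ...   | inj₁ (kr , _) | inj₁ (ks , _) =
            cong≈ (kept-lab r kr) (kept-lab s ks) (bal c<e r<s (trans (sym (proj₁ kr)) rc) (trans (sym (proj₁ ks)) sc))
    ...   | inj₁ (kr , ¬fr) | inj₂ (fs , sF , sT , s≡ , s≡′) with true-or-false (m r (suc i))
    ...     | inj₁ eq = ≈-pred (cong≈ (cong suc (kept-lab r kr)) (flipped-lab s s≡′)
                                    (below r<s ¬fr fs (trans (sym (proj₁ kr)) rc) eq))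
    ...     | inj₂ eq = ≈-pred (cong≈ (trans (cong suc (kept-lab r kr)) (sym (lab-gap e m r eq))) (flipped-lab s s≡′)
                                    (bal si<e r<s eq sT))
    moveLeft-balanced {c} {r} {s} c<e r<s rc sc | no _ | yes refl with status r | status s
    ...   | _ | inj₂ (_ , _ , _ , _ , s≡) = contradiction s≡ (true≢false sc)
    ...   | inj₁ (kr , _) | inj₁ (ks , _) =
            cong≈ (lab≡′ r) (lab≡′ s) (bal c<e r<s (trans (sym (proj₂ kr)) rc) (trans (sym (proj₂ ks)) sc))
    ...   | inj₂ (fr , rF , rT , _) | inj₁ (ks , ¬fs) with true-or-false (m s i)
    ...     | inj₁ eq = cong≈ (trans (lab≡′ r) (lab-bead e m r rT))
                            (trans (lab≡′ s) (lab-bead e m s (trans (sym (proj₂ ks)) sc))) (bal i<e r<s rF eq)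
    ...     | inj₂ eq = cong≈ (lab≡′ r) (lab≡′ s) (above r<s fr ¬fs eq (trans (sym (proj₂ ks)) sc))

    moveLeft-regular : RegularC e m′
    moveLeft-regular {r} {c} c<e rc with c ≟ i | c ≟ suc i
    ... | no c≢i   | no c≢si = other-regular c≢i c≢si c<e rc
    ... | yes refl | _ with status r | status (suc r)
    ...   | inj₂ (_ , _ , _ , r≡ , _) | _ = contradiction rc (true≢false r≡)
    ...   | inj₁ (kr , _) | inj₁ (ks , _) =
            subst₂ _≢_ (sym (kept-lab r kr)) (sym (kept-lab (suc r) ks)) (reg c<e (trans (sym (proj₁ kr)) rc))
    ...   | inj₁ (kr , ¬fr) | inj₂ (fs , sF , sT , s≡ , s≡′) with true-or-false (m r (suc i))
    ...     | inj₁ eq = contradiction eq (previous ¬fr fs (trans (sym (proj₁ kr)) rc))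
    ...     | inj₂ eq = λ lab≡lab → reg si<e eq (trans (lab-gap e m r eq) (trans (cong suc (trans (sym (kept-lab r kr)) lab≡lab))
                                                                             (flipped-lab (suc r) s≡′)))
    moveLeft-regular {r} {c} c<e rc | no _ | yes refl with true-or-false (m′ (suc r) (suc i))
    ... | inj₂ eq = <⇒≢ (lab-mono-< c<e (n<1+n r) eq)
    ... | inj₁ eq with status r | status (suc r)
    ...   | _ | inj₂ (_ , _ , _ , _ , s≡) = contradiction s≡ (true≢false eq)
    ...   | inj₁ (kr , _) | inj₁ (ks , _) = subst₂ _≢_ (sym (lab≡′ r)) (sym (lab≡′ (suc r))) (reg c<e (trans (sym (proj₂ kr)) rc))
    ...   | inj₂ (fr , rF , rT , _) | inj₁ (ks , _) =
            subst₂ _≢_ (sym (trans (lab≡′ r) (lab-bead e m r rT)))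
                       (sym (trans (lab≡′ (suc r)) (lab-bead e m (suc r) (trans (sym (proj₂ ks)) eq)))) (reg i<e rF)

applyUpTo-pair : ∀ (f : ℕ → ℕ) n xs {x y zs} → applyUpTo f n ≡ xs ++ x ∷ y ∷ zs →
                 f (length xs) ≡ x × f (suc (length xs)) ≡ y × suc (length xs) < n
applyUpTo-pair f (suc (suc n)) []       refl = refl , refl , s≤s (s≤s z≤n)
applyUpTo-pair f (suc n)       (v ∷ xs) eq   with applyUpTo-pair (f ∘ suc) n xs (List.∷-injectiveʳ eq)
... | fx , fy , lt = fx , fy , s≤s lt

applyUpTo-cong : ∀ {f g : ℕ → ℕ} n → (∀ c → c < n → f c ≡ g c) → applyUpTo f n ≡ applyUpTo g n
applyUpTo-cong zero    eq = refl
applyUpTo-cong (suc n) eq = cong₂ _∷_ (eq 0 z<s) (applyUpTo-cong n λ c c<n → eq (suc c) (s≤s c<n))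

applyUpTo-swap : ∀ (f g : ℕ → ℕ) n xs {x y zs} → applyUpTo f n ≡ xs ++ x ∷ y ∷ zs →
                 (∀ c → c < n → c ≢ length xs → c ≢ suc (length xs) → g c ≡ f c) →
                 g (length xs) ≡ y → g (suc (length xs)) ≡ x → applyUpTo g n ≡ xs ++ y ∷ x ∷ zs
applyUpTo-swap f g (suc (suc n)) [] refl off gx gy =
  cong₂ _∷_ gx (cong₂ _∷_ gy (applyUpTo-cong n λ c c<n → off (suc (suc c)) (s≤s (s≤s c<n)) (λ ()) (λ ())))
applyUpTo-swap f g (suc n) (v ∷ xs) eq off gx gy =
  cong₂ _∷_ (trans (off 0 z<s (λ ()) (λ ())) (List.∷-injectiveˡ eq))
            (applyUpTo-swap (f ∘ suc) (g ∘ suc) n xs (List.∷-injectiveʳ eq)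
               (λ c c<n c≢ c≢′ → off (suc c) (s≤s c<n) (c≢ ∘ suc-injective) (c≢′ ∘ suc-injective)) gx gy)

sumTo-pair : ∀ f g i n → suc i < n → (∀ c → c < n → c ≢ i → c ≢ suc i → f c ≡ g c) →
             f i + f (suc i) ≡ g i + g (suc i) → sumTo f n ≡ sumTo g n
sumTo-pair f g i (suc n) (s≤s i<n) off eq with m≤n⇒m<n∨m≡n i<n
... | inj₁ si<n = cong₂ _+_ (sumTo-pair f g i n si<n (λ c c<n → off c (m<n⇒m<1+n c<n)) eq) (off n ≤-refl (>⇒≢ i<n) (>⇒≢ si<n))
... | inj₂ refl = trans (+-assoc (sumTo f i) _ _) (trans (cong₂ _+_ initial eq) (sym (+-assoc (sumTo g i) _ _)))
  where
  initial : sumTo f i ≡ sumTo g i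
  initial = sumTo-cong i λ c c<i → off c (m<n⇒m<1+n (m<n⇒m<1+n c<i)) (<⇒≢ c<i) (<⇒≢ (m<n⇒m<1+n c<i))

cnt-mono-< : ∀ {f g r} n → (∀ k → k < n → f k ≡ true → g k ≡ true) → r < n → f r ≡ false → g r ≡ true →
             cnt f n < cnt g n
cnt-mono-< {f} {g} {r} (suc n) imp (s≤s r≤n) fr gr with m≤n⇒m<n∨m≡n r≤n
... | inj₁ r<n = +-mono-<-≤ (cnt-mono-< n (λ k k<n → imp k (m<n⇒m<1+n k<n)) r<n fr gr) (le (f n) (g n) (imp n ≤-refl))
  where
  le : ∀ b b′ → (b ≡ true → b′ ≡ true) → bead b ≤ bead b′
  le false b′ _ = z≤n
  le true  b′ h rewrite h refl = ≤-refl
... | inj₂ refl rewrite fr | gr =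
  +-mono-≤-< (cnt-mono-≤ {f} {g} n λ k k<n → imp k (m<n⇒m<1+n k<n)) (s≤s z≤n)

-- Single moves between adjacent runners

swapIndex : ℕ → ℕ → ℕ
swapIndex i c with c ≟ i | c ≟ suc i
... | yes _ | _     = suc i
... | no _  | yes _ = i
... | no _  | no _  = c

swapIndex-left : ∀ i → swapIndex i i ≡ suc i
swapIndex-left i with i ≟ i
... | yes _  = refl
... | no i≢i = contradiction refl i≢i

swapIndex-right : ∀ i → swapIndex i (suc i) ≡ i
swapIndex-right i with suc i ≟ i | suc i ≟ suc i
... | yes eq | _     = contradiction eq 1+n≢n
... | no _   | yes _ = refl
... | no _   | no ne = contradiction refl ne

swapIndex-off : ∀ i {c} → c ≢ i → c ≢ suc i → swapIndex i c ≡ c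
swapIndex-off i {c} c≢i c≢si with c ≟ i | c ≟ suc i
... | yes eq | _      = contradiction eq c≢i
... | no _   | yes eq = contradiction eq c≢si
... | no _   | no _   = refl

swapRows : ℕ → (ℕ → Bool) → Config → Config
swapRows i F m r c = if F r then m r (swapIndex i c) else m r c

swapRows-sameUpToSwap : ∀ {e} i F m → SameUpToSwap e i m (swapRows i F m)
swapRows-sameUpToSwap i F m = record { off = λ r _ → off′ r ; row = row′ }
  where
  off′ : ∀ r {c} → c ≢ i → c ≢ suc i → swapRows i F m r c ≡ m r c
  off′ r c≢i c≢si with F r
  ... | true  = cong (m r) (swapIndex-off i c≢i c≢si)
  ... | false = refl
  row′ : ∀ r → EqualUpToSwap (m r i) (m r (suc i)) (swapRows i F m r i) (swapRows i F m r (suc i))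
  row′ r with F r
  ... | true  = inj₂ (cong (m r) (swapIndex-left i) , cong (m r) (swapIndex-right i))
  ... | false = inj₁ (refl , refl)

_≡?_ : ℕ → ℕ → Bool
a ≡? b with a ≟ b
... | yes _ = true
... | no _  = false

swapRow : ℕ → ℕ → Config → Config
swapRow i r = swapRows i (_≡? r)

swapRow-at : ∀ i r m → swapRow i r m r i ≡ m r (suc i) × swapRow i r m r (suc i) ≡ m r i
swapRow-at i r m with r ≟ r
... | yes _  = cong (m r) (swapIndex-left i) , cong (m r) (swapIndex-right i)
... | no r≢r = contradiction refl r≢r

swapRow-off : ∀ i r m {s c} → s ≢ r → swapRow i r m s c ≡ m s c
swapRow-off i r m {s} s≢r with s ≟ r
... | yes s≡r = contradiction s≡r s≢r
... | no _    = refl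

module _ (i : ℕ) (m : Config) where

  RightAddable LeftAddable : ℕ → Set
  RightAddable r = m r i ≡ true × m r (suc i) ≡ false
  LeftAddable  r = m r i ≡ false × m r (suc i) ≡ true

  rightAddable? : ∀ r → Dec (RightAddable r)
  rightAddable? r = (m r i ≟ᵇ true) ×-dec (m r (suc i) ≟ᵇ false)

  leftAddable? : ∀ r → Dec (LeftAddable r)
  leftAddable? r = (m r i ≟ᵇ false) ×-dec (m r (suc i) ≟ᵇ true)

BoundedAt : ℕ → ℕ → Config → Set
BoundedAt h c m = ∀ {r} → h ≤ r → m r c ≡ false

bead⇒<height : ∀ {h c r m} → BoundedAt h c m → m r c ≡ true → r < h
bead⇒<height {h} {c} {r} b eq with r <? h
... | yes r<h = r<h
... | no r≮h  = contradiction (b (≮⇒≥ r≮h)) (true≢false eq)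

module _ {d e i : ℕ} (si<e : suc i < e) where

  private
    i<e : i < e
    i<e = <-trans (n<1+n i) si<e

    lab≈ : ∀ {a b a′ b′} → a′ ≡ a → b′ ≡ b → Congruent d a b → Congruent d a′ b′
    lab≈ refl refl a≈b = a≈b

  module _ {m : Config} (bal : BalancedC d e m) (reg : RegularC e m) where

    private
      clash : ∀ {r} → RightAddable i m r → ¬ LeftAddable i m r
      clash (eq , _) (eq′ , _) = true≢false eq eq′

    swapRow-right : ∀ {r} → RightAddable i m r →
      (∀ {s} → r < s → RightAddable i m s → Congruent d (lab e m r (suc i)) (lab e m s i)) →
      (∀ {s} → s < r → RightAddable i m s → Congruent d (lab e m s (suc i)) (lab e m r (suc i))) →
      ¬ RightAddable i m (suc r) →
      BalancedC d e (swapRow i r m) × RegularC e (swapRow i r m)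
    swapRow-right {r} (ri , rsi) above below next =
      moveRight-balanced si<e t bal reg (_≡ r) status above′ below′ next′ ,
      moveRight-regular si<e t bal reg (_≡ r) status above′ below′ next′
      where
      t : SameUpToSwap e i m _
      t = swapRows-sameUpToSwap i (_≡? r) m
      status : ∀ s → (swapRow i r m s i ≡ m s i × swapRow i r m s (suc i) ≡ m s (suc i)) × ¬ s ≡ r ⊎
                     s ≡ r × (m s i ≡ true × m s (suc i) ≡ false ×
                              swapRow i r m s i ≡ false × swapRow i r m s (suc i) ≡ true)
      status s with s ≟ r
      ... | yes refl = inj₂ (refl , ri , rsi , trans (cong (m r) (swapIndex-left i)) rsi ,
                                               trans (cong (m r) (swapIndex-right i)) ri)
      ... | no s≢r   = inj₁ ((refl , refl) , s≢r)
      above′ : ∀ {s s′} → s < s′ → s ≡ r → ¬ s′ ≡ r → m s′ i ≡ true → m s′ (suc i) ≡ false →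
               Congruent d (lab e m s (suc i)) (lab e m s′ i)
      above′ s<s′ refl _ eq eq′ = above s<s′ (eq , eq′)
      below′ : ∀ {s s′} → s < s′ → ¬ s ≡ r → s′ ≡ r → m s i ≡ true → m s (suc i) ≡ false →
               Congruent d (lab e m s (suc i)) (lab e m s′ (suc i))
      below′ s<s′ _ refl eq eq′ = below s<s′ (eq , eq′)
      next′ : ∀ {s} → s ≡ r → ¬ suc s ≡ r → m (suc s) i ≡ true → m (suc s) (suc i) ≢ false
      next′ refl _ eq eq′ = next (eq , eq′)

    swapRow-left : ∀ {r} → LeftAddable i m r →
      (∀ {s} → s < r → LeftAddable i m s → Congruent d (suc (lab e m s i)) (lab e m r (suc i))) →
      (∀ {s} → r < s → LeftAddable i m s → Congruent d (lab e m r (suc i)) (lab e m s (suc i))) →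
      (∀ {s} → suc s ≡ r → ¬ LeftAddable i m s) →
      BalancedC d e (swapRow i r m) × RegularC e (swapRow i r m)
    swapRow-left {r} (ri , rsi) below above previous =
      moveLeft-balanced si<e t bal reg (_≡ r) status below′ above′ previous′ ,
      moveLeft-regular si<e t bal reg (_≡ r) status below′ above′ previous′
      where
      t : SameUpToSwap e i m _
      t = swapRows-sameUpToSwap i (_≡? r) m
      status : ∀ s → (swapRow i r m s i ≡ m s i × swapRow i r m s (suc i) ≡ m s (suc i)) × ¬ s ≡ r ⊎
                     s ≡ r × (m s i ≡ false × m s (suc i) ≡ true ×
                              swapRow i r m s i ≡ true × swapRow i r m s (suc i) ≡ false)
      status s with s ≟ r
      ... | yes refl = inj₂ (refl , ri , rsi , trans (cong (m r) (swapIndex-left i)) rsi ,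
                                               trans (cong (m r) (swapIndex-right i)) ri)
      ... | no s≢r   = inj₁ ((refl , refl) , s≢r)
      below′ : ∀ {s s′} → s < s′ → ¬ s ≡ r → s′ ≡ r → m s i ≡ false → m s (suc i) ≡ true →
               Congruent d (suc (lab e m s i)) (lab e m s′ (suc i))
      below′ s<s′ _ refl eq eq′ = below s<s′ (eq , eq′)
      above′ : ∀ {s s′} → s < s′ → s ≡ r → ¬ s′ ≡ r → m s′ i ≡ false → m s′ (suc i) ≡ true →
               Congruent d (lab e m s (suc i)) (lab e m s′ (suc i))
      above′ s<s′ refl _ eq eq′ = above s<s′ (eq , eq′)
      previous′ : ∀ {s} → ¬ s ≡ r → suc s ≡ r → m s i ≡ false → m s (suc i) ≢ true
      previous′ _ s≡ eq eq′ = previous s≡ (eq , eq′)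

    -- The bead moved right is the last one before the first left-movable one,
    -- or, failing that, the last one of all.
    moveRightOnce : ∀ {h q p} → BoundedAt h i m → BoundedAt h (suc i) m →
                    RightAddable i m q → LeftAddable i m p →
                    ∃[ r ] (RightAddable i m r × BalancedC d e (swapRow i r m) × RegularC e (swapRow i r m))
    moveRightOnce {h} {q} {p} bi bsi q-right p-left with least-below (leftAddable? i m) h
    ... | inj₂ none = contradiction p-left (none p (bead⇒<height {m = m} bsi (proj₂ p-left)))
    ... | inj₁ (t , t<h , t-left , t-min) with greatest-below (rightAddable? i m) t
    ...   | inj₁ (r , r<t , r-right , r-max) = r , r-right , swapRow-right r-right above below next
      where
      t≈ : Congruent d (lab e m r (suc i)) (lab e m t (suc i))
      t≈ = bal si<e r<t (proj₂ r-right) (proj₂ t-left)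
      above : ∀ {s} → r < s → RightAddable i m s → Congruent d (lab e m r (suc i)) (lab e m s i)
      above {s} r<s s-right with <-cmp s t
      ... | tri< s<t _ _  = contradiction s-right (r-max s r<s s<t)
      ... | tri≈ _ refl _ = contradiction t-left (clash s-right)
      ... | tri> _ _ t<s  = ≈-trans t≈ (lab≈ (lab-bead e m t (proj₂ t-left)) refl
                                             (bal i<e t<s (proj₁ t-left) (proj₁ s-right)))
      below : ∀ {s} → s < r → RightAddable i m s → Congruent d (lab e m s (suc i)) (lab e m r (suc i))
      below s<r s-right = ≈-trans (bal si<e (<-trans s<r r<t) (proj₂ s-right) (proj₂ t-left)) (≈-sym t≈)
      next : ¬ RightAddable i m (suc r)
      next right with m≤n⇒m<n∨m≡n r<t
      ... | inj₁ sr<t = r-max (suc r) (n<1+n r) sr<t right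
      ... | inj₂ refl = clash right t-left
    ...   | inj₂ none with greatest-below (rightAddable? i m) h
    ...     | inj₂ none′ = contradiction q-right (none′ q (bead⇒<height {m = m} bi (proj₁ q-right)))
    ...     | inj₁ (r , r<h , r-right , r-max) =
      r , r-right , swapRow-right r-right (λ r<s right → contradiction right (last r<s)) below (last (n<1+n r))
      where
      last : ∀ {s} → r < s → ¬ RightAddable i m s
      last {s} r<s right = r-max s r<s (bead⇒<height {m = m} bi (proj₁ right)) right
      t< : ∀ {s} → RightAddable i m s → t < s
      t< {s} s-right with <-cmp s t
      ... | tri< s<t _ _  = contradiction s-right (none s s<t)
      ... | tri≈ _ refl _ = contradiction t-left (clash s-right)
      ... | tri> _ _ t<s  = t<s
      below : ∀ {s} → s < r → RightAddable i m s → Congruent d (lab e m s (suc i)) (lab e m r (suc i))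
      below {s} s<r s-right =
        lab≈ (lab-gap e m s (proj₂ s-right)) (lab-gap e m r (proj₂ r-right))
             (≈-suc (≈-trans (≈-sym (bal i<e (t< s-right) (proj₁ t-left) (proj₁ s-right)))
                             (bal i<e (t< r-right) (proj₁ t-left) (proj₁ r-right))))

    -- Let `t` be the last row that can move right. The row moved left is the first left-movable one
    -- after `t` or, if none follows, the first of all. In the first case the gap of `t` in column
    -- `suc i` makes the labels of all later left-movable rows congruent; in the second case the
    -- bead of `t` in column `i` does so for all left-movable rows, which then precede it.
    moveLeftOnce : ∀ {h q p} → BoundedAt h i m → BoundedAt h (suc i) m →
                   RightAddable i m q → LeftAddable i m p →
                   ∃[ r ] (LeftAddable i m r × BalancedC d e (swapRow i r m) × RegularC e (swapRow i r m))
    moveLeftOnce {h} {q} {p} bi bsi q-right p-left with greatest-below (rightAddable? i m) h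
    ... | inj₂ none = contradiction q-right (none q (bead⇒<height {m = m} bi (proj₁ q-right)))
    ... | inj₁ (t , t<h , t-right , t-max) with least-below (λ s → leftAddable? i m s ×-dec (t <? s)) h
    ...   | inj₁ (r , r<h , (r-left , t<r) , r-min) = r , r-left , swapRow-left r-left below above previous
      where
      t≈ : ∀ {s} → t < s → LeftAddable i m s → Congruent d (lab e m t (suc i)) (lab e m s (suc i))
      t≈ t<s s-left = bal si<e t<s (proj₂ t-right) (proj₂ s-left)
      below : ∀ {s} → s < r → LeftAddable i m s → Congruent d (suc (lab e m s i)) (lab e m r (suc i))
      below {s} s<r s-left with <-cmp s t
      ... | tri> _ _ t<s  = contradiction (s-left , t<s) (r-min s s<r)
      ... | tri≈ _ refl _ = contradiction s-left (clash t-right)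
      ... | tri< s<t _ _  = ≈-trans (≈-suc (bal i<e s<t (proj₁ s-left) (proj₁ t-right)))
                                    (lab≈ (sym (lab-gap e m t (proj₂ t-right))) refl (t≈ t<r r-left))
      above : ∀ {s} → r < s → LeftAddable i m s → Congruent d (lab e m r (suc i)) (lab e m s (suc i))
      above r<s s-left = ≈-trans (≈-sym (t≈ t<r r-left)) (t≈ (<-trans t<r r<s) s-left)
      previous : ∀ {s} → suc s ≡ r → ¬ LeftAddable i m s
      previous {s} refl s-left with m≤n⇒m<n∨m≡n (≤-pred t<r)
      ... | inj₁ t<s  = r-min s (n<1+n s) (s-left , t<s)
      ... | inj₂ refl = clash t-right s-left
    ...   | inj₂ none with least-below (leftAddable? i m) h
    ...     | inj₂ none′ = contradiction p-left (none′ p (bead⇒<height {m = m} bsi (proj₂ p-left)))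
    ...     | inj₁ (r , r<h , r-left , r-min) =
      r , r-left , swapRow-left r-left (λ s<r left → contradiction left (r-min _ s<r)) above
                                (λ { refl → r-min _ (n<1+n _) })
      where
      <t : ∀ {s} → LeftAddable i m s → s < t
      <t {s} s-left with <-cmp s t
      ... | tri< s<t _ _  = s<t
      ... | tri≈ _ refl _ = contradiction s-left (clash t-right)
      ... | tri> _ _ t<s  = contradiction (s-left , t<s) (none s (bead⇒<height {m = m} bsi (proj₂ s-left)))
      above : ∀ {s} → r < s → LeftAddable i m s → Congruent d (lab e m r (suc i)) (lab e m s (suc i))
      above {s} r<s s-left =
        lab≈ (lab-bead e m r (proj₂ r-left)) (lab-bead e m s (proj₂ s-left))
             (≈-trans (bal i<e (<t r-left) (proj₁ r-left) (proj₁ t-right))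
                      (≈-sym (bal i<e (<t s-left) (proj₁ s-left) (proj₁ t-right))))

    -- If all mixed rows have their bead in the same column, exchanging the whole columns flips
    -- every one of them. No mixed row is kept, so the hypotheses on pairs of a flipped and a kept
    -- mixed row hold vacuously.
    swapColumns-right : (∀ r → ¬ LeftAddable i m r) →
                        BalancedC d e (swapRows i (λ _ → true) m) × RegularC e (swapRows i (λ _ → true) m)
    swapColumns-right none =
      moveRight-balanced si<e t bal reg (RightAddable i m) status
        (λ _ _ ¬r eq eq′ → contradiction (eq , eq′) ¬r) (λ _ ¬r _ eq eq′ → contradiction (eq , eq′) ¬r)
        (λ _ ¬r eq eq′ → contradiction (eq , eq′) ¬r) ,
      moveRight-regular si<e t bal reg (RightAddable i m) status
        (λ _ _ ¬r eq eq′ → contradiction (eq , eq′) ¬r) (λ _ ¬r _ eq eq′ → contradiction (eq , eq′) ¬r)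
        (λ _ ¬r eq eq′ → contradiction (eq , eq′) ¬r)
      where
      m′ = swapRows i (λ _ → true) m
      t : SameUpToSwap e i m _
      t  = swapRows-sameUpToSwap i (λ _ → true) m
      status : ∀ r → (m′ r i ≡ m r i × m′ r (suc i) ≡ m r (suc i)) × ¬ RightAddable i m r ⊎
                     RightAddable i m r × (m r i ≡ true × m r (suc i) ≡ false × m′ r i ≡ false × m′ r (suc i) ≡ true)
      status r rewrite swapIndex-left i | swapIndex-right i with m r i in eq | m r (suc i) in eq′
      ... | true  | true  = inj₁ ((refl , refl) , λ ())
      ... | true  | false = inj₂ ((refl , refl) , refl , refl , refl , refl)
      ... | false | true  = contradiction (eq , eq′) (none r)
      ... | false | false = inj₁ ((refl , refl) , λ ())

    swapColumns-left : (∀ r → ¬ RightAddable i m r) →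
                       BalancedC d e (swapRows i (λ _ → true) m) × RegularC e (swapRows i (λ _ → true) m)
    swapColumns-left none =
      moveLeft-balanced si<e t bal reg (LeftAddable i m) status
        (λ _ ¬l _ eq eq′ → contradiction (eq , eq′) ¬l) (λ _ _ ¬l eq eq′ → contradiction (eq , eq′) ¬l)
        (λ ¬l _ eq eq′ → contradiction (eq , eq′) ¬l) ,
      moveLeft-regular si<e t bal reg (LeftAddable i m) status
        (λ _ ¬l _ eq eq′ → contradiction (eq , eq′) ¬l) (λ _ _ ¬l eq eq′ → contradiction (eq , eq′) ¬l)
        (λ ¬l _ eq eq′ → contradiction (eq , eq′) ¬l)
      where
      m′ = swapRows i (λ _ → true) m
      t : SameUpToSwap e i m _
      t  = swapRows-sameUpToSwap i (λ _ → true) m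
      status : ∀ r → (m′ r i ≡ m r i × m′ r (suc i) ≡ m r (suc i)) × ¬ LeftAddable i m r ⊎
                     LeftAddable i m r × (m r i ≡ false × m r (suc i) ≡ true × m′ r i ≡ true × m′ r (suc i) ≡ false)
      status r rewrite swapIndex-left i | swapIndex-right i with m r i in eq | m r (suc i) in eq′
      ... | true  | true  = inj₁ ((refl , refl) , λ ())
      ... | true  | false = contradiction (eq , eq′) (none r)
      ... | false | true  = inj₂ ((refl , refl) , refl , refl , refl , refl)
      ... | false | false = inj₁ ((refl , refl) , λ ())

-- Uniqueness of the balanced filling

module _ {d e i : ℕ} (1<d : 1 < d) (si<e : suc i < e) where

  -- The labels of rows r and s in column i + 1 are congruent because of m, and
  -- congruent after adding one to the first because of m′.
  exchanged-rows-conflict : ∀ {m m′ r s} → SameUpToSwap e i m m′ → BalancedC d e m → BalancedC d e m′ → r < s →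
    RightAddable i m r → LeftAddable i m s → LeftAddable i m′ r → RightAddable i m′ s → ⊥
  exchanged-rows-conflict {m} {m′} {r} {s} t bal bal′ r<s (_ , mr) (_ , ms) (m′r , m′r′) (m′s , m′s′) =
    ≉-suc 1<d (≈-trans m≈ (≈-sym m′≈))
    where
    lab≡′ : ∀ q → lab e m′ q (suc i) ≡ lab e m q (suc i)
    lab≡′ q = lab≡ t si<e q si<e 1+n≢n
    m≈ : Congruent d (lab e m r (suc i)) (lab e m s (suc i))
    m≈ = bal si<e r<s mr ms
    m′≈ : Congruent d (suc (lab e m r (suc i))) (lab e m s (suc i))
    m′≈ = subst₂ (Congruent d) (cong suc (trans (sym (lab-bead e m′ r m′r′)) (lab≡′ r)))
                               (trans (sym (lab-gap e m′ s m′s′)) (lab≡′ s))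
                 (≈-suc (bal′ (<-trans (n<1+n i) si<e) r<s m′r m′s))

  moved-right : ∀ {m m′ r} → SameUpToSwap e i m m′ → m r i ≡ true → m′ r i ≡ false →
                RightAddable i m r × LeftAddable i m′ r
  moved-right {r = r} t mr m′r with row t r
  ... | inj₁ (eq , _)   = contradiction (trans (sym eq) m′r) (true≢false mr)
  ... | inj₂ (eq , eq′) = (mr , trans (sym eq) m′r) , (m′r , trans eq′ mr)

  -- As the bead numbers of column `i` agree, a row that loses its bead there is matched by a row
  -- that gains one. These two rows are filled in opposite ways and conflict, whichever of them
  -- comes first.
  not-moved-right : ∀ {h m m′} → SameUpToSwap e i m m′ → BalancedC d e m → BalancedC d e m′ →
                    BoundedAt h i m → BoundedAt h i m′ → cnt (col m i) h ≡ cnt (col m′ i) h →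
                    ∀ {r} → m r i ≡ true → m′ r i ≢ false
  not-moved-right {h} {m} {m′} t bal bal′ b b′ eq {r} mr m′r
    with greatest-below (λ s → (m s i ≟ᵇ false) ×-dec (m′ s i ≟ᵇ true)) h
  ... | inj₂ none = <-irrefl (sym eq) (cnt-mono-< h imp (bead⇒<height {m = m} b mr) m′r mr)
    where
    imp : ∀ k → k < h → m′ k i ≡ true → m k i ≡ true
    imp k k<h m′k with true-or-false (m k i)
    ... | inj₁ mk = mk
    ... | inj₂ mk = contradiction (mk , m′k) (none k k<h)
  ... | inj₁ (s , _ , (ms , m′s) , _) with moved-right t mr m′r | moved-right (SameUpToSwap-sym t) m′s ms
  ...   | mrA , m′rB | m′sA , msB with <-cmp r s
  ...     | tri< r<s _ _  = exchanged-rows-conflict t bal bal′ r<s mrA msB m′rB m′sA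
  ...     | tri≈ _ refl _ = true≢false mr ms
  ...     | tri> _ _ s<r  = exchanged-rows-conflict (SameUpToSwap-sym t) bal′ bal s<r m′sA m′rB msB mrA

  balanced-unique : ∀ {h m m′} → SameUpToSwap e i m m′ → BalancedC d e m → BalancedC d e m′ →
                    BoundedAt h i m → BoundedAt h i m′ → cnt (col m i) h ≡ cnt (col m′ i) h →
                    m ≈[ e ] m′
  balanced-unique {h} {m} {m′} t bal bal′ b b′ eq r c c<e with c ≟ i | c ≟ suc i
  ... | no c≢i | no c≢si = sym (off t r c<e c≢i c≢si)
  ... | yes refl | _ with true-or-false (m r c) | true-or-false (m′ r c)
  ...   | inj₁ p | inj₁ q = trans p (sym q)
  ...   | inj₂ p | inj₂ q = trans p (sym q)
  ...   | inj₁ p | inj₂ q = contradiction q (not-moved-right t bal bal′ b b′ eq p)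
  ...   | inj₂ p | inj₁ q = contradiction p (not-moved-right (SameUpToSwap-sym t) bal′ bal b′ b (sym eq) q)
  balanced-unique {h} {m} {m′} t bal bal′ b b′ eq r c c<e | no _ | yes refl
    with row t r | balanced-unique t bal bal′ b b′ eq r i (<-trans (n<1+n i) si<e)
  ... | inj₁ (_ , p) | _ = sym p
  ... | inj₂ (p , q) | r≡ = trans (trans (sym p) (sym r≡)) (sym q)

-- Bead numbers and weight under the exchange

cnt-pair : ∀ {e i m m′} h → SameUpToSwap e i m m′ →
           cnt (col m′ i) h + cnt (col m′ (suc i)) h ≡ cnt (col m i) h + cnt (col m (suc i)) h
cnt-pair {_} {i} {m} {m′} h t =
  trans (sym (sumTo-+ (bead ∘ col m′ i) (bead ∘ col m′ (suc i)) h))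
        (trans (sumTo-cong h λ r _ → row-sum (row t r)) (sumTo-+ (bead ∘ col m i) (bead ∘ col m (suc i)) h))
  where
  row-sum : ∀ {a b a′ b′} → EqualUpToSwap a b a′ b′ → bead a′ + bead b′ ≡ bead a + bead b
  row-sum (inj₁ (refl , refl)) = refl
  row-sum {a} {b} (inj₂ (refl , refl)) = +-comm (bead b) (bead a)

wsum-pair : ∀ {e i m m′} h → SameUpToSwap e i m m′ →
            wsum (col m′ i) h + wsum (col m′ (suc i)) h ≡ wsum (col m i) h + wsum (col m (suc i)) h
wsum-pair {_} {i} {m} {m′} h t =
  trans (sym (sumTo-+ (term (col m′ i)) (term (col m′ (suc i))) h))
        (trans (sumTo-cong h λ r _ → row-sum r (row t r)) (sumTo-+ (term (col m i)) (term (col m (suc i))) h))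
  where
  term : (ℕ → Bool) → ℕ → ℕ
  term f r = if f r then r else 0
  row-sum : ∀ r {a b a′ b′} → EqualUpToSwap a b a′ b′ →
            (if a′ then r else 0) + (if b′ then r else 0) ≡ (if a then r else 0) + (if b then r else 0)
  row-sum r (inj₁ (refl , refl)) = refl
  row-sum r {a} {b} (inj₂ (refl , refl)) = +-comm (if b then r else 0) (if a then r else 0)

-- Every row keeps its number of beads, so the sum of the two values of `wsum` is unchanged. The two
-- triangular numbers are merely interchanged, and the rest of `wsum` is `inv`.
inv-pair : ∀ {e i m m′} h → SameUpToSwap e i m m′ →
           cnt (col m′ i) h ≡ cnt (col m (suc i)) h → cnt (col m′ (suc i)) h ≡ cnt (col m i) h →
           inv (col m′ i) h + inv (col m′ (suc i)) h ≡ inv (col m i) h + inv (col m (suc i)) h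
inv-pair {_} {i} {m} {m′} h t eq eq′ = +-cancelʳ-≡ (tri p + tri p′) _ _ (begin
  inv (col m′ i) h + inv (col m′ (suc i)) h + (tri p + tri p′)
    ≡⟨ cong (inv (col m′ i) h + inv (col m′ (suc i)) h +_)
            (trans (+-comm (tri p) (tri p′)) (sym (cong₂ (λ a b → tri a + tri b) eq eq′))) ⟩
  inv (col m′ i) h + inv (col m′ (suc i)) h + (tri (cnt (col m′ i) h) + tri (cnt (col m′ (suc i)) h))
    ≡⟨ collect m′ ⟩
  wsum (col m′ i) h + wsum (col m′ (suc i)) h
    ≡⟨ wsum-pair h t ⟩
  wsum (col m i) h + wsum (col m (suc i)) h
    ≡⟨ collect m ⟨
  inv (col m i) h + inv (col m (suc i)) h + (tri p + tri p′) ∎)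
  where
  open ≡-Reasoning
  p p′ : ℕ
  p  = cnt (col m i) h
  p′ = cnt (col m (suc i)) h
  collect : ∀ n → inv (col n i) h + inv (col n (suc i)) h + (tri (cnt (col n i) h) + tri (cnt (col n (suc i)) h)) ≡
                  wsum (col n i) h + wsum (col n (suc i)) h
  collect n = trans (interchange (inv (col n i) h) (inv (col n (suc i)) h) (tri (cnt (col n i) h)) _)
                    (sym (cong₂ _+_ (wsum≡inv+tri (col n i) h) (wsum≡inv+tri (col n (suc i)) h)))

SameUpToSwap-bounded : ∀ {e i h m m′} → suc i < e → SameUpToSwap e i m m′ →
                       (∀ {r c} → h ≤ r → c < e → m r c ≡ false) → ∀ {r c} → h ≤ r → c < e → m′ r c ≡ false
SameUpToSwap-bounded {e} {i} si<e t bounded {r} {c} h≤r c<e with c ≟ i | c ≟ suc i | row t r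
... | no c≢i   | no c≢si  | _             = trans (off t r c<e c≢i c≢si) (bounded h≤r c<e)
... | yes refl | _        | inj₁ (eq , _) = trans eq (bounded h≤r c<e)
... | yes refl | _        | inj₂ (eq , _) = trans eq (bounded h≤r si<e)
... | no _     | yes refl | inj₁ (_ , eq) = trans eq (bounded h≤r c<e)
... | no _     | yes refl | inj₂ (_ , eq) = trans eq (bounded h≤r (<-trans (n<1+n i) si<e))

Class-swap : ∀ {e w m m′} xs {x y zs} (k : Class e (xs ++ x ∷ y ∷ zs) w m) → SameUpToSwap e (length xs) m m′ →
             cnt (col m′ (length xs)) (Class.height k) ≡ y → Class e (xs ++ y ∷ x ∷ zs) w m′
Class-swap {e} {w} {m} {m′} xs {x} {y} k t cnt≡y with applyUpTo-pair _ e xs (Class.counts k)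
... | cnt-x , cnt-y , si<e = record
  { height  = h
  ; bounded = SameUpToSwap-bounded si<e t (Class.bounded k)
  ; counts  = applyUpTo-swap _ _ e xs (Class.counts k)
                (λ c c<e c≢ c≢′ → sumTo-cong h λ r _ → cong bead (off t r c<e c≢ c≢′)) cnt≡y cnt′≡x
  ; weight  = trans (sumTo-pair _ _ i e si<e (λ c c<e c≢ c≢′ → inv-cong h λ r _ → off t r c<e c≢ c≢′)
                       (inv-pair h t (trans cnt≡y (sym cnt-y)) (trans cnt′≡x (sym cnt-x))))
                    (Class.weight k)
  }
  where
  h = Class.height k
  i = length xs
  cnt′≡x : cnt (col m′ (suc i)) h ≡ x
  cnt′≡x = +-cancelˡ-≡ y _ _ (trans (cong (_+ cnt (col m′ (suc i)) h) (sym cnt≡y))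
             (trans (cnt-pair h t) (trans (cong₂ _+_ cnt-x cnt-y) (+-comm x y))))

module _ {d e i h : ℕ} (si<e : suc i < e) {m : Config} (bounded : ∀ {r c} → h ≤ r → c < e → m r c ≡ false) where

  private
    i<e : i < e
    i<e = <-trans (n<1+n i) si<e

    at-i : ∀ {m′} → SameUpToSwap e i m m′ → BoundedAt h i m′
    at-i t h≤r = SameUpToSwap-bounded si<e t bounded h≤r i<e

    at-si : ∀ {m′} → SameUpToSwap e i m m′ → BoundedAt h (suc i) m′
    at-si t h≤r = SameUpToSwap-bounded si<e t bounded h≤r si<e

    Target : (ℕ → ℕ) → ℕ → Set
    Target f y = ∃[ m′ ] (SameUpToSwap e i m m′ × BalancedC d e m′ × RegularC e m′ × cnt (col m′ (f i)) h ≡ y)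

    swapRow-step : ∀ {m′ r} → SameUpToSwap e i m m′ → SameUpToSwap e i m (swapRow i r m′)
    swapRow-step {m′} {r} t = SameUpToSwap-trans t (swapRows-sameUpToSwap i (_≡? r) m′)

    swapRow-cnt : ∀ {m′ r c} → m′ r c ≡ true → swapRow i r m′ r c ≡ false → r < h →
                  cnt (col m′ c) h ≡ suc (cnt (col (swapRow i r m′) c) h)
    swapRow-cnt {m′} {r} {c} mr mr′ r<h = trans (sym (+-identityʳ _)) (trans
      (subst₂ (λ a b → cnt (col m′ c) h + bead a ≡ cnt (col (swapRow i r m′) c) h + bead b) mr′ mr
        (sumTo-update (bead ∘ col m′ c) (bead ∘ col (swapRow i r m′) c) h r<h λ s s≢r →
           cong bead (sym (swapRow-off i r m′ s≢r))))
      (+-comm _ 1))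

  -- `j` is the number of moves still to be made. A row that can move right exists: otherwise every
  -- bead of column `i` of `m′` would lie in a row of two beads, and column `i` of `m′` would have
  -- at most as many beads as column `suc i` of `m`. The row just moved is the left-movable row
  -- required for the next move.
  moveRight-times : ∀ j {m′ p} → SameUpToSwap e i m m′ → BalancedC d e m′ → RegularC e m′ → LeftAddable i m′ p →
                    cnt (col m′ i) h ≡ j + cnt (col m (suc i)) h → Target id (cnt (col m (suc i)) h)
  moveRight-times zero    {m′} t bal reg _ eq = m′ , t , bal , reg , eq
  moveRight-times (suc j) {m′} {p} t bal reg p-left eq with greatest-below (rightAddable? i m′) h
  ... | inj₂ none = contradiction (subst (_≤ cnt (col m (suc i)) h) eq (cnt-mono-≤ h imp)) (<⇒≱ (s≤s (m≤n+m _ j)))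
    where
    imp : ∀ r → r < h → m′ r i ≡ true → m r (suc i) ≡ true
    imp r r<h m′r with true-or-false (m′ r (suc i))
    ... | inj₂ m′r′ = contradiction (m′r , m′r′) (none r r<h)
    ... | inj₁ m′r′ with row t r
    ...   | inj₁ (_ , p) = trans (sym p) m′r′
    ...   | inj₂ (p , _) = trans (sym p) m′r
  ... | inj₁ (q , _ , q-right , _) with moveRightOnce si<e bal reg (at-i t) (at-si t) q-right p-left
  ...   | r , r-right , bal′ , reg′ =
    moveRight-times j (swapRow-step t) bal′ reg′ (trans at-r (proj₂ r-right) , trans at-r′ (proj₁ r-right))
      (suc-injective (trans (sym (swapRow-cnt {m′} (proj₁ r-right) (trans at-r (proj₂ r-right)) r<h)) eq))
    where
    at-r  = proj₁ (swapRow-at i r m′)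
    at-r′ = proj₂ (swapRow-at i r m′)
    r<h : r < h
    r<h = bead⇒<height {m = m′} (at-i t) (proj₁ r-right)

  moveLeft-times : ∀ j {m′ p} → SameUpToSwap e i m m′ → BalancedC d e m′ → RegularC e m′ → RightAddable i m′ p →
                   cnt (col m′ (suc i)) h ≡ j + cnt (col m i) h → Target suc (cnt (col m i) h)
  moveLeft-times zero    {m′} t bal reg _ eq = m′ , t , bal , reg , eq
  moveLeft-times (suc j) {m′} {p} t bal reg p-right eq with greatest-below (leftAddable? i m′) h
  ... | inj₂ none = contradiction (subst (_≤ cnt (col m i) h) eq (cnt-mono-≤ h imp)) (<⇒≱ (s≤s (m≤n+m _ j)))
    where
    imp : ∀ r → r < h → m′ r (suc i) ≡ true → m r i ≡ true
    imp r r<h m′r with true-or-false (m′ r i)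
    ... | inj₂ m′r′ = contradiction (m′r′ , m′r) (none r r<h)
    ... | inj₁ m′r′ with row t r
    ...   | inj₁ (p , _) = trans (sym p) m′r′
    ...   | inj₂ (_ , p) = trans (sym p) m′r
  ... | inj₁ (q , _ , q-left , _) with moveLeftOnce si<e bal reg (at-i t) (at-si t) p-right q-left
  ...   | r , r-left , bal′ , reg′ =
    moveLeft-times j (swapRow-step t) bal′ reg′ (trans at-r (proj₂ r-left) , trans at-r′ (proj₁ r-left))
      (suc-injective (trans (sym (swapRow-cnt {m′} (proj₂ r-left) (trans at-r′ (proj₁ r-left)) r<h)) eq))
    where
    at-r  = proj₁ (swapRow-at i r m′)
    at-r′ = proj₂ (swapRow-at i r m′)
    r<h : r < h
    r<h = bead⇒<height {m = m′} (at-si t) (proj₂ r-left)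

  swapped-exists : BalancedC d e m → RegularC e m → Target id (cnt (col m (suc i)) h)
  swapped-exists bal reg with greatest-below (leftAddable? i m) h | greatest-below (rightAddable? i m) h
  ... | inj₂ none | _ =
    m′ , swapRows-sameUpToSwap i (λ _ → true) m , proj₁ good , proj₂ good ,
    cnt-cong h (λ r _ → cong (m r) (swapIndex-left i))
    where
    m′   = swapRows i (λ _ → true) m
    good = swapColumns-right si<e bal reg λ r left →
             none r (bead⇒<height {m = m} (at-si SameUpToSwap-refl) (proj₂ left)) left
  ... | inj₁ _ | inj₂ none =
    m′ , swapRows-sameUpToSwap i (λ _ → true) m , proj₁ good , proj₂ good ,
    cnt-cong h (λ r _ → cong (m r) (swapIndex-left i))
    where
    m′   = swapRows i (λ _ → true) m
    good = swapColumns-left si<e bal reg λ r right →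
             none r (bead⇒<height {m = m} (at-i SameUpToSwap-refl) (proj₁ right)) right
  ... | inj₁ (p , _ , p-left , _) | inj₁ (q , _ , q-right , _)
    -- Beads leave the column that has more of them, so that the difference is the number of moves.
    with ≤-total (cnt (col m (suc i)) h) (cnt (col m i) h)
  ...   | inj₁ le = moveRight-times _ SameUpToSwap-refl bal reg p-left (sym (m∸n+n≡m le))
  ...   | inj₂ le with moveLeft-times _ SameUpToSwap-refl bal reg q-right (sym (m∸n+n≡m le))
  ...     | m′ , t , bal′ , reg′ , eq = m′ , t , bal′ , reg′ ,
    +-cancelʳ-≡ (cnt (col m i) h) _ _
      (trans (cong (cnt (col m′ i) h +_) (sym eq)) (trans (cnt-pair h t) (+-comm (cnt (col m i) h) _)))

Class-count : ∀ {e ps w m} (k : Class e ps w m) {h c} → Class.height k ≤ h → c < e →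
              cnt (col m c) h ≡ cnt (col m c) (Class.height k)
Class-count {m = m} k {c = c} le c<e = cnt-stable (col m c) le λ r h≤r → Class.bounded k h≤r c<e

-- Images of equal configurations are again related by `SameUpToSwap`, so `balanced-unique` makes
-- them equal. The same argument, read backwards, gives injectivity.
swap-correspondence : ∀ {d e w} → 1 < d → ∀ xs {x y zs} →
  Correspondence (_≈[ e ]_) (_≈[ e ]_) (Good d e (xs ++ x ∷ y ∷ zs) w) (Good d e (xs ++ y ∷ x ∷ zs) w)
                 (SameUpToSwap e (length xs))
swap-correspondence {d} {e} {w} 1<d xs {x} {y} {zs} = record
  { total      = exists
  ; surjective = λ m good → let (m′ , good′ , t) = exists m good in m′ , good′ , SameUpToSwap-sym t
  ; functional = λ good good′ good₁ good₁′ t t′ eq → unique good₁ good₁′ (related t t′ eq)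
  ; injective  = λ good good′ good₁ good₁′ t t′ eq →
                   unique good good′ (related (SameUpToSwap-sym t) (SameUpToSwap-sym t′) eq)
  }
  where
  exists : ∀ {x y} m → Good d e (xs ++ x ∷ y ∷ zs) w m →
           ∃[ m′ ] (Good d e (xs ++ y ∷ x ∷ zs) w m′ × SameUpToSwap e (length xs) m m′)
  exists m (k , bal , reg) with applyUpTo-pair _ e xs (Class.counts k)
  ... | _ , cnt-y , si<e with swapped-exists si<e (Class.bounded k) bal reg
  ...   | m′ , t , bal′ , reg′ , eq = m′ , (Class-swap xs k t (trans eq cnt-y) , bal′ , reg′) , t

  related : ∀ {m m′ m₁ m₁′} → SameUpToSwap e (length xs) m m₁ → SameUpToSwap e (length xs) m′ m₁′ → m ≈[ e ] m′ →
            suc (length xs) < e → SameUpToSwap e (length xs) m₁ m₁′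
  related t t′ eq si<e = SameUpToSwap-trans (SameUpToSwap-sym t) (SameUpToSwap-trans
    (record { off = λ r c<e _ _ → sym (eq r _ c<e)
            ; row = λ r → inj₁ (sym (eq r _ (<-trans (n<1+n _) si<e)) , sym (eq r _ si<e)) }) t′)

  unique : ∀ {x y m m′} → Good d e (xs ++ x ∷ y ∷ zs) w m → Good d e (xs ++ x ∷ y ∷ zs) w m′ →
           (suc (length xs) < e → SameUpToSwap e (length xs) m m′) → m ≈[ e ] m′
  unique {m = m} {m′} (k , bal , _) (k′ , bal′ , _) t
    with applyUpTo-pair _ e xs (Class.counts k) | applyUpTo-pair _ e xs (Class.counts k′)
  ... | cnt-x , _ , si<e | cnt-x′ , _ , _ =
    balanced-unique 1<d si<e (t si<e) bal bal′
      (λ le → Class.bounded k (≤-trans (m≤m⊔n h h′) le) i<e) (λ le → Class.bounded k′ (≤-trans (m≤n⊔m h h′) le) i<e)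
      (trans (trans (Class-count k (m≤m⊔n h h′) i<e) cnt-x)
             (sym (trans (Class-count k′ (m≤n⊔m h h′) i<e) cnt-x′)))
    where
    h  = Class.height k
    h′ = Class.height k′
    i<e = <-trans (n<1+n _) si<e

-- Prepending a bead

-- The configuration obtained by prepending a bead: every position is shifted by one.
record Rotated (k : ℕ) (m m′ : Config) : Set where
  field
    first : m′ 0 0 ≡ true
    wrap  : ∀ r → m′ (suc r) 0 ≡ m r k
    shift : ∀ r {c} → c < k → m′ r (suc c) ≡ m r c

  pre-rotated : ∀ r c → c ≤ k → pre m′ r (suc c) ≡ gap (m′ r 0) + pre m r c
  pre-rotated r c c≤k = trans (sumTo-suc (gap ∘ m′ r) c)
    (cong (gap (m′ r 0) +_) (sumTo-cong c λ c′ c′<c → cong gap (shift r (<-≤-trans c′<c c≤k))))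

  -- The positions of `m` before row `r` become the positions of `m′` up to and including `(r , 0)`,
  -- apart from the prepended bead, which is no gap.
  before-rotated : ∀ r → before (suc k) m′ r + gap (m′ r 0) ≡ before (suc k) m r
  before-rotated zero    = cong gap first
  before-rotated (suc r) = begin
    before (suc k) m′ r + pre m′ r (suc k) + gap (m′ (suc r) 0)
      ≡⟨ cong₂ (λ a b → before (suc k) m′ r + a + gap b) (pre-rotated r k ≤-refl) (wrap r) ⟩
    before (suc k) m′ r + (gap (m′ r 0) + pre m r k) + gap (m r k)
      ≡⟨ rearrange (before (suc k) m′ r) (gap (m′ r 0)) (pre m r k) (gap (m r k)) ⟩
    before (suc k) m′ r + gap (m′ r 0) + (pre m r k + gap (m r k))
      ≡⟨ cong (_+ (pre m r k + gap (m r k))) (before-rotated r) ⟩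
    before (suc k) m r + (pre m r k + gap (m r k)) ∎
    where
    open ≡-Reasoning
    rearrange : ∀ a b c d → a + (b + c) + d ≡ a + b + (c + d)
    rearrange = solve-∀

  lab-shift : ∀ r {c} → c < k → lab (suc k) m′ r (suc c) ≡ lab (suc k) m r c
  lab-shift r {c} c<k = trans (cong (before (suc k) m′ r +_) (pre-rotated r (suc c) c<k))
    (trans (sym (+-assoc (before (suc k) m′ r) _ _)) (cong (_+ pre m r (suc c)) (before-rotated r)))

  lab-wrap : ∀ r → lab (suc k) m′ (suc r) 0 ≡ lab (suc k) m r k
  -- Column `k` is the last one, so the label on the right is a count over complete rows.
  lab-wrap r = before-rotated (suc r)

  rotate-balanced : ∀ {d} → BalancedC d (suc k) m → BalancedC d (suc k) m′
  rotate-balanced bal {suc c} {r} {s} (s≤s c<k) r<s mr ms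
    rewrite lab-shift r c<k | lab-shift s c<k =
    bal (m<n⇒m<1+n c<k) r<s (trans (sym (shift r c<k)) mr) (trans (sym (shift s c<k)) ms)
  rotate-balanced bal {zero} {zero}          _ _         mr _  = contradiction mr (true≢false first)
  rotate-balanced bal {zero} {suc r} {suc s} _ (s≤s r<s) mr ms
    rewrite lab-wrap r | lab-wrap s = bal ≤-refl r<s (trans (sym (wrap r)) mr) (trans (sym (wrap s)) ms)

  unrotate-balanced : ∀ {d} → BalancedC d (suc k) m′ → BalancedC d (suc k) m
  unrotate-balanced {d} bal {c} {r} {s} (s≤s c≤k) r<s mr ms with m≤n⇒m<n∨m≡n c≤k
  ... | inj₁ c<k  = subst₂ (Congruent d) (lab-shift r c<k) (lab-shift s c<k)
                      (bal (s≤s c<k) r<s (trans (shift r c<k) mr) (trans (shift s c<k) ms))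
  ... | inj₂ refl = subst₂ (Congruent d) (lab-wrap r) (lab-wrap s)
                      (bal z<s (s≤s r<s) (trans (wrap r) mr) (trans (wrap s) ms))

  rotate-regular : RegularC (suc k) m → RegularC (suc k) m′
  rotate-regular reg {r} {suc c} (s≤s c<k) mr
    rewrite lab-shift r c<k | lab-shift (suc r) c<k = reg (m<n⇒m<1+n c<k) (trans (sym (shift r c<k)) mr)
  rotate-regular reg {zero}  {zero} _ mr = contradiction mr (true≢false first)
  rotate-regular reg {suc r} {zero} _ mr rewrite lab-wrap r | lab-wrap (suc r) = reg ≤-refl (trans (sym (wrap r)) mr)

  unrotate-regular : RegularC (suc k) m′ → RegularC (suc k) m
  unrotate-regular reg {r} {c} (s≤s c≤k) mr with m≤n⇒m<n∨m≡n c≤k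
  ... | inj₁ c<k  = subst₂ _≢_ (lab-shift r c<k) (lab-shift (suc r) c<k) (reg (s≤s c<k) (trans (shift r c<k) mr))
  ... | inj₂ refl = subst₂ _≢_ (lab-wrap r) (lab-wrap (suc r)) (reg z<s (trans (wrap r) mr))

  module _ {h : ℕ} (bounded : ∀ {r c} → h ≤ r → c < suc k → m r c ≡ false) where

    cnt-wrap : cnt (col m′ 0) (suc h) ≡ suc (cnt (col m k) h)
    cnt-wrap = trans (sumTo-suc (bead ∘ col m′ 0) h)
                     (cong₂ _+_ (cong bead first) (cnt-cong {col m′ 0 ∘ suc} h λ r _ → wrap r))

    -- The prepended bead has no gap before it and is not a gap before any other bead.
    inv-wrap : inv (col m′ 0) (suc h) ≡ inv (col m k) h
    inv-wrap = trans (sumTo-suc _ h) (cong₂ _+_ (cong (if_then 0 else 0) first) (sumTo-cong h λ r _ →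
      cong₂ (λ b v → if b then v else 0) (wrap r)
        (trans (sumTo-suc (gap ∘ col m′ 0) r)
               (cong₂ _+_ (cong gap first) (sumTo-cong r λ s _ → cong gap (wrap s))))))

    cnt-shift : ∀ c → c < k → cnt (col m′ (suc c)) (suc h) ≡ cnt (col m c) h
    cnt-shift c c<k = trans (cnt-cong (suc h) λ r _ → shift r c<k)
                            (cnt-stable (col m c) (n≤1+n h) λ r h≤r → bounded h≤r (m<n⇒m<1+n c<k))

    inv-shift : ∀ c → c < k → inv (col m′ (suc c)) (suc h) ≡ inv (col m c) h
    inv-shift c c<k = trans (inv-cong (suc h) λ r _ → shift r c<k)
                            (inv-stable (col m c) (n≤1+n h) λ r h≤r → bounded h≤r (m<n⇒m<1+n c<k))

    counts-rotated : applyUpTo (λ c → cnt (col m′ c) (suc h)) (suc k) ≡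
                     suc (cnt (col m k) h) ∷ applyUpTo (λ c → cnt (col m c) h) k
    counts-rotated = cong₂ _∷_ cnt-wrap (applyUpTo-cong k cnt-shift)

    weight-rotated : sumTo (λ c → inv (col m′ c) (suc h)) (suc k) ≡ sumTo (λ c → inv (col m c) h) (suc k)
    weight-rotated = trans (sumTo-suc (λ c → inv (col m′ c) (suc h)) k)
      (trans (cong₂ _+_ inv-wrap (sumTo-cong k inv-shift)) (+-comm (inv (col m k) h) _))

  Class-rotate : ∀ {xs p w} → Class (suc k) (xs ∷ʳ p) w m → Class (suc k) (suc p ∷ xs) w m′
  Class-rotate {xs} {p} cl = record
    { height  = suc h
    ; bounded = bounded′
    ; counts  = trans (counts-rotated bounded) (cong₂ _∷_ (cong suc (proj₂ split)) (proj₁ split))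
    ; weight  = trans (weight-rotated bounded) (Class.weight cl)
    }
    where
    h = Class.height cl
    bounded : ∀ {r c} → h ≤ r → c < suc k → m r c ≡ false
    bounded = Class.bounded cl
    split = List.∷ʳ-injective _ xs (trans (List.applyUpTo-∷ʳ (λ c → cnt (col m c) h) k) (Class.counts cl))
    bounded′ : ∀ {r c} → suc h ≤ r → c < suc k → m′ r c ≡ false
    bounded′ {r} {suc c} h<r (s≤s c<k) = trans (shift r c<k) (bounded (<⇒≤ h<r) (m<n⇒m<1+n c<k))
    bounded′ {suc r} {zero} (s≤s h≤r) _ = trans (wrap r) (bounded h≤r ≤-refl)

  Class-unrotate : ∀ {xs p w} → Class (suc k) (suc p ∷ xs) w m′ → Class (suc k) (xs ∷ʳ p) w m
  Class-unrotate {xs} {p} {w} cl = record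
    { height  = h
    ; bounded = bounded
    ; counts  = trans (sym (List.applyUpTo-∷ʳ (λ c → cnt (col m c) h) k))
                      (cong₂ _∷ʳ_ (List.∷-injectiveʳ counts) (suc-injective (List.∷-injectiveˡ counts)))
    ; weight  = trans (sym (weight-rotated bounded))
                      (trans (sumTo-cong (suc k) λ c c<k → inv-stable (col m′ c) (n≤1+n h) λ r h≤r → bounded′ h≤r c<k)
                             (Class.weight cl))
    }
    where
    h = Class.height cl
    bounded′ : ∀ {r c} → h ≤ r → c < suc k → m′ r c ≡ false
    bounded′ = Class.bounded cl
    bounded : ∀ {r c} → h ≤ r → c < suc k → m r c ≡ false
    bounded {r} {c} h≤r (s≤s c≤k) with m≤n⇒m<n∨m≡n c≤k
    ... | inj₁ c<k  = trans (sym (shift r c<k)) (bounded′ h≤r (s≤s c<k))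
    ... | inj₂ refl = trans (sym (wrap r)) (bounded′ (m≤n⇒m≤1+n h≤r) z<s)
    counts : suc (cnt (col m k) h) ∷ applyUpTo (λ c → cnt (col m c) h) k ≡ suc p ∷ xs
    counts = trans (sym (counts-rotated bounded))
      (trans (applyUpTo-cong (suc k) λ c c<k → cnt-stable (col m′ c) (n≤1+n h) λ r h≤r → bounded′ h≤r c<k)
             (Class.counts cl))

rotate : ℕ → Config → Config
rotate k m zero    zero    = true
rotate k m (suc r) zero    = m r k
rotate k m r       (suc c) = m r c

unrotate : ℕ → Config → Config
unrotate k m r c with c ≟ k
... | yes _ = m (suc r) 0
... | no _  = m r (suc c)

unrotate-rotated : ∀ k m → m 0 0 ≡ true → Rotated k (unrotate k m) m
unrotate-rotated k m m00 = record { first = m00 ; wrap = wrap ; shift = shift }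
  where
  wrap : ∀ r → m (suc r) 0 ≡ unrotate k m r k
  wrap r with k ≟ k
  ... | yes _  = refl
  ... | no k≢k = contradiction refl k≢k
  shift : ∀ r {c} → c < k → m r (suc c) ≡ unrotate k m r c
  shift r {c} c<k with c ≟ k
  ... | yes refl = contradiction c<k (<-irrefl refl)
  ... | no _     = refl

-- If the first position were a gap, all `suc p` beads of column 0 would come after it and
-- contribute at least `suc p` inversions, more than the weight allows.
first-bead : ∀ {k p xs w m} → Class (suc k) (suc p ∷ xs) w m → w ≤ p → m 0 0 ≡ true
first-bead {p = p} {w = w} {m} cl w≤p with m 0 0 in eq
... | true  = refl
... | false = contradiction (≤-trans (gap⇒cnt≤ (col m 0) 0<h eq) (sumTo-lookup-≤ (λ c → inv (col m c) h) z<s))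
                (<⇒≱ (subst₂ _<_ (sym (Class.weight cl)) (sym cnt≡) (s≤s w≤p)))
  where
  h = Class.height cl
  cnt≡ : cnt (col m 0) h ≡ suc p
  cnt≡ = List.∷-injectiveˡ (Class.counts cl)
  0<h : 0 < h
  0<h = <-≤-trans (subst (0 <_) (sym cnt≡) z<s) (cnt≤ (col m 0) h)

rotate-correspondence : ∀ {d k w p xs} → w ≤ p →
  Correspondence (_≈[ suc k ]_) (_≈[ suc k ]_) (Good d (suc k) (xs ∷ʳ p) w) (Good d (suc k) (suc p ∷ xs) w) (Rotated k)
rotate-correspondence {d} {k} {w} {p} {xs} w≤p = record
  { total      = λ m (cl , bal , reg) → let t = rotated m in
                   rotate k m , (Class-rotate t cl , rotate-balanced t bal , λ {r} → rotate-regular t reg {r}) , t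
  ; surjective = λ m (cl , bal , reg) → let t = unrotate-rotated k m (first-bead cl w≤p) in
                   unrotate k m , (Class-unrotate t cl , unrotate-balanced t bal , unrotate-regular t reg) , t
  ; functional = λ _ _ _ _ → functional
  ; injective  = λ _ _ _ _ → injective
  }
  where
  open Rotated
  rotated : ∀ m → Rotated k m (rotate k m)
  rotated m = record { first = refl ; wrap = λ r → refl ; shift = λ { zero _ → refl ; (suc r) _ → refl } }

  functional : ∀ {x x′ y y′} → Rotated k x y → Rotated k x′ y′ → x ≈[ suc k ] x′ → y ≈[ suc k ] y′
  functional t t′ eq zero    zero    _         = trans (first t) (sym (first t′))
  functional t t′ eq (suc r) zero    _         = trans (wrap t r) (trans (eq r k ≤-refl) (sym (wrap t′ r)))
  functional t t′ eq r       (suc c) (s≤s c<k) =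
    trans (shift t r c<k) (trans (eq r c (m<n⇒m<1+n c<k)) (sym (shift t′ r c<k)))

  injective : ∀ {x x′ y y′} → Rotated k x y → Rotated k x′ y′ → y ≈[ suc k ] y′ → x ≈[ suc k ] x′
  injective t t′ eq r c (s≤s c≤k) with m≤n⇒m<n∨m≡n c≤k
  ... | inj₁ c<k  = trans (sym (shift t r c<k)) (trans (eq r (suc c) (s≤s c<k)) (shift t′ r c<k))
  ... | inj₂ refl = trans (sym (wrap t r)) (trans (eq (suc r) 0 z<s) (wrap t′ r))

-- Independence of the bead numbers

module _ (d k w : ℕ) (1<d : 1 < d) where

  private
    N : List ℕ → ℕ → Set
    N ps n = Card (_≈[ suc k ]_) (Good d (suc k) ps w) n

    ∷ʳ-++ : ∀ xs y (zs : List ℕ) → (xs ∷ʳ y) ++ zs ≡ xs ++ y ∷ zs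
    ∷ʳ-++ xs y zs = List.++-assoc xs (y ∷ []) zs

  -- `xs` collects the entries that the permutation has passed already, so that each transposition
  -- concerns two adjacent runners behind a fixed prefix.
  count-↭ : ∀ xs {ps qs n} → ps ↭ qs → N (xs ++ ps) n → N (xs ++ qs) n
  count-↭ xs Perm.refl                    = id
  count-↭ xs (Perm.prep {ps} {qs} x p)    =
    subst (λ l → N l _) (∷ʳ-++ xs x qs) ∘ count-↭ (xs ∷ʳ x) p ∘ subst (λ l → N l _) (sym (∷ʳ-++ xs x ps))
  count-↭ xs (Perm.swap {ps} {qs} x y p)  =
    subst (λ l → N l _) (shuffle qs) ∘ count-↭ ((xs ∷ʳ y) ∷ʳ x) p ∘ subst (λ l → N l _) (sym (shuffle ps)) ∘
    Card-transfer (swap-correspondence 1<d xs)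
    where
    shuffle : ∀ zs → ((xs ∷ʳ y) ∷ʳ x) ++ zs ≡ xs ++ y ∷ x ∷ zs
    shuffle zs = trans (∷ʳ-++ (xs ∷ʳ y) x zs) (∷ʳ-++ xs y (x ∷ zs))
  count-↭ xs (Perm.trans p q)             = count-↭ xs q ∘ count-↭ xs p

  -- The entry is permuted to the last runner, from where prepending a bead brings it to the first
  -- one, increased by one.
  count-suc : ∀ {p xs n} → w ≤ p → N (p ∷ xs) n → N (suc p ∷ xs) n
  count-suc {p} {xs} w≤p = Card-transfer (rotate-correspondence w≤p) ∘ count-↭ [] (Perm.∷↭∷ʳ p xs)

  count-pred : ∀ {p xs n} → w ≤ p → N (suc p ∷ xs) n → N (p ∷ xs) n
  count-pred {p} {xs} w≤p =
    count-↭ [] (Perm.↭-sym (Perm.∷↭∷ʳ p xs)) ∘ Card-transfer (Correspondence-sym (rotate-correspondence w≤p))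

  count-+ : ∀ j {xs n} → N (w ∷ xs) n → N (j + w ∷ xs) n
  count-+ zero    = id
  count-+ (suc j) = count-suc (m≤n+m w j) ∘ count-+ j

  count-∸ : ∀ j {xs n} → N (j + w ∷ xs) n → N (w ∷ xs) n
  count-∸ zero    = id
  count-∸ (suc j) = count-∸ j ∘ count-pred (m≤n+m w j)

  -- Only the first entry can be lowered. Once it has reached `w` it is permuted behind the
  -- untreated entries and becomes part of `ys`.
  count-replicate : ∀ {xs} ys {n} → All (w ≤_) xs → N (xs ++ ys) n → N (replicate (length xs) w ++ ys) n
  count-replicate {[]}     ys _          = id
  count-replicate {x ∷ xs} ys (w≤x ∷ ws) =
    count-↭ [] (Perm.shift w (replicate (length xs) w) ys) ∘ count-replicate (w ∷ ys) ws ∘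
    count-↭ [] (Perm.↭-sym (Perm.shift w xs ys)) ∘ count-∸ (x ∸ w) ∘ subst (λ y → N (y ∷ xs ++ ys) _) (sym (m∸n+n≡m w≤x))

  replicate-count : ∀ {xs} ys {n} → All (w ≤_) xs → N (replicate (length xs) w ++ ys) n → N (xs ++ ys) n
  replicate-count {[]}     ys _          = id
  replicate-count {x ∷ xs} ys (w≤x ∷ ws) =
    subst (λ y → N (y ∷ xs ++ ys) _) (m∸n+n≡m w≤x) ∘ count-+ (x ∸ w) ∘ count-↭ [] (Perm.shift w xs ys) ∘
    replicate-count (w ∷ ys) ws ∘ count-↭ [] (Perm.↭-sym (Perm.shift w (replicate (length xs) w) ys))

  count-independent : ∀ {ps qs n} → length ps ≡ length qs → All (w ≤_) ps → All (w ≤_) qs → N ps n → N qs n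
  count-independent {ps} {qs} len ps≥ qs≥ =
    subst (λ l → N l _) (List.++-identityʳ qs) ∘ replicate-count [] qs≥ ∘
    subst (λ l → N (replicate l w ++ []) _) len ∘ count-replicate [] ps≥ ∘ subst (λ l → N l _) (sym (List.++-identityʳ ps))

-- Runners with a single gap among their beads

-- The runner carrying the partition (1ᵛ), with b + v beads.
record Hole (b v : ℕ) (f : ℕ → Bool) : Set where
  field
    below  : ∀ {r} → r < b → f r ≡ true
    at     : f b ≡ false
    above  : ∀ {r} → b < r → r ≤ b + v → f r ≡ true
    beyond : ∀ {r} → b + v < r → f r ≡ false

  private
    no-gaps-below : ∀ {r} → r ≤ b → gaps f r ≡ 0
    no-gaps-below {r} r≤b = sumTo-const0 r λ k k<r → cong gap (below (<-≤-trans k<r r≤b))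

    above-at : ∀ {k} → k < v → f (suc b + k) ≡ true
    above-at {k} k<v = above (s≤s (m≤m+n b k)) (subst (_≤ b + v) (+-suc b k) (+-monoʳ-≤ b k<v))

    gaps-above : ∀ {k} → k < v → gaps f (suc b + k) ≡ 1
    gaps-above {k} k<v = trans (sumTo-++ (gap ∘ f) (suc b) k)
      (cong₂ _+_ (cong₂ _+_ (no-gaps-below ≤-refl) (cong gap at))
                 (sumTo-const0 k λ j j<k → cong gap (above-at (<-trans j<k k<v))))

  cnt-hole : ∀ {h} → b + v < h → cnt f h ≡ b + v
  cnt-hole {h} le = begin
    cnt f h                                              ≡⟨ cnt-stable f le (λ r → beyond) ⟩
    cnt f (suc b + v)                                    ≡⟨ sumTo-++ (bead ∘ f) (suc b) v ⟩
    cnt f b + bead (f b) + sumTo (λ k → bead (f (suc b + k))) v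
      ≡⟨ cong₂ _+_ (cong₂ _+_ (sumTo-const1 b λ k k<b → cong bead (below k<b)) (cong bead at))
                   (sumTo-const1 v λ k k<v → cong bead (above-at k<v)) ⟩
    b + 0 + v                                            ≡⟨ cong (_+ v) (+-identityʳ b) ⟩
    b + v                                                ∎
    where open ≡-Reasoning

  inv-hole : ∀ {h} → b + v < h → inv f h ≡ v
  inv-hole {h} le = begin
    inv f h                          ≡⟨ inv-stable f le (λ r → beyond) ⟩
    inv f (suc b + v)                ≡⟨ sumTo-++ _ (suc b) v ⟩
    inv f (suc b) + sumTo (λ k → if f (suc b + k) then gaps f (suc b + k) else 0) v
      ≡⟨ cong₂ _+_ (sumTo-const0 (suc b) λ k k≤b → no-gaps k (≤-pred k≤b))
                   (sumTo-const1 v λ k k<v → cong₂ (λ x y → if x then y else 0) (above-at k<v) (gaps-above k<v)) ⟩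
    v                                ∎
    where
    open ≡-Reasoning
    no-gaps : ∀ k → k ≤ b → (if f k then gaps f k else 0) ≡ 0
    no-gaps k k≤b rewrite no-gaps-below k≤b with f k
    ... | true  = refl
    ... | false = refl

  gap-below-bead : ∀ {r s} → f r ≡ false → f s ≡ true → r < s → r ≡ b × s ≤ b + v
  gap-below-bead {r} {s} fr fs r<s with <-cmp r b | s ≤? b + v
  ... | _           | no s≰     = contradiction (beyond (≰⇒> s≰)) (true≢false fs)
  ... | tri< r<b _ _ | yes _    = contradiction fr (true≢false (below r<b))
  ... | tri≈ _ eq _ | yes s≤    = eq , s≤
  ... | tri> _ _ b<r | yes s≤   = contradiction fr (true≢false (above b<r (≤-trans (<⇒≤ r<s) s≤)))

Hole-unique : ∀ {b v f g} → Hole b v f → Hole b v g → ∀ r → f r ≡ g r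
Hole-unique {b} {v} p q r with <-cmp r b | r ≤? b + v
... | tri< r<b _ _  | _      = trans (Hole.below p r<b) (sym (Hole.below q r<b))
... | tri≈ _ refl _ | _      = trans (Hole.at p) (sym (Hole.at q))
... | tri> _ _ b<r  | yes r≤ = trans (Hole.above p b<r r≤) (sym (Hole.above q b<r r≤))
... | tri> _ _ b<r  | no r≰  = trans (Hole.beyond p (≰⇒> r≰)) (sym (Hole.beyond q (≰⇒> r≰)))

hole : ℕ → ℕ → ℕ → Bool
hole b v r with <-cmp r b | r ≤? b + v
... | tri< _ _ _ | _     = true
... | tri≈ _ _ _ | _     = false
... | tri> _ _ _ | yes _ = true
... | tri> _ _ _ | no _  = false

hole-isHole : ∀ b v → Hole b v (hole b v)
hole-isHole b v = record { below = below ; at = at ; above = above ; beyond = beyond }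
  where
  below : ∀ {r} → r < b → hole b v r ≡ true
  below {r} r<b with <-cmp r b | r ≤? b + v
  ... | tri< _ _ _    | _ = refl
  ... | tri≈ _ refl _ | _ = contradiction r<b (<-irrefl refl)
  ... | tri> _ _ b<r  | _ = contradiction r<b (<-asym b<r)
  at : hole b v b ≡ false
  at with <-cmp b b | b ≤? b + v
  ... | tri< b<b _ _ | _ = contradiction b<b (<-irrefl refl)
  ... | tri≈ _ _ _   | _ = refl
  ... | tri> _ _ b<b | _ = contradiction b<b (<-irrefl refl)
  above : ∀ {r} → b < r → r ≤ b + v → hole b v r ≡ true
  above {r} b<r r≤ with <-cmp r b | r ≤? b + v
  ... | tri< _ _ _    | _     = refl
  ... | tri≈ _ refl _ | _     = contradiction b<r (<-irrefl refl)
  ... | tri> _ _ _    | yes _ = refl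
  ... | tri> _ _ _    | no r≰ = contradiction r≤ r≰
  beyond : ∀ {r} → b + v < r → hole b v r ≡ false
  beyond {r} lt with <-cmp r b | r ≤? b + v
  ... | tri< r<b _ _ | _      = contradiction (<-trans r<b (≤-<-trans (m≤m+n b v) lt)) (<-irrefl refl)
  ... | tri≈ _ _ _   | _      = refl
  ... | tri> _ _ _   | yes r≤ = contradiction r≤ (<⇒≱ lt)
  ... | tri> _ _ _   | no _   = refl

-- Let `b` be the first gap and `t` the second. By hypothesis no gap from `t` on is directly
-- followed by a bead, so everything from `t` on is a gap.
single-gap-hole : ∀ {f} h → (∀ r → h ≤ r → f r ≡ false) →
                  (∀ {q q′} → q < q′ → f q ≡ false → f q′ ≡ false → f (suc q′) ≢ true) → ∃[ b ] ∃[ v ] Hole b v f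
single-gap-hole {f} h bounded single with least-below (λ r → f r ≟ᵇ false) (suc h)
... | inj₂ none = contradiction (bounded h ≤-refl) (none h ≤-refl)
-- As `b` is at most `h`, the gap at `suc h` comes after `b`, so this search must succeed.
... | inj₁ (b , b≤h , b-gap , b-min) with least-below (λ r → (f r ≟ᵇ false) ×-dec (b <? r)) (suc (suc h))
...   | inj₂ none = contradiction (bounded (suc h) (n≤1+n h) , b≤h) (none (suc h) ≤-refl)
...   | inj₁ (t , _ , (t-gap , b<t) , t-min) = b , t ∸ suc b , record
  { below  = λ r<b → bead-of (b-min _ r<b)
  ; at     = b-gap
  ; above  = λ {r} b<r r≤ → bead-of (λ r-gap → t-min r (subst (r <_) end (s≤s r≤)) (r-gap , b<r))
  ; beyond = λ {r} lt → gap-of (no-bead r (subst (_≤ r) end lt))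
  }
  where
  end : suc (b + (t ∸ suc b)) ≡ t
  end = m+[n∸m]≡n b<t
  bead-of : ∀ {r} → f r ≢ false → f r ≡ true
  bead-of {r} ne with f r
  ... | true  = refl
  ... | false = contradiction refl ne
  gap-of : ∀ {r} → f r ≢ true → f r ≡ false
  gap-of {r} ne with f r
  ... | true  = contradiction refl ne
  ... | false = refl
  no-bead : ∀ r → t ≤ r → f r ≢ true
  no-bead r t≤r fr with m≤n⇒m<n∨m≡n t≤r
  ... | inj₂ refl = contradiction t-gap (true≢false fr)
  no-bead (suc r) t≤r fr | inj₁ t<sr =
    single (<-≤-trans b<t (≤-pred t<sr)) b-gap (gap-of (no-bead r (≤-pred t<sr))) fr

-- Widely spaced bead numbers

-- Bead numbers so far apart that in weight w the moved beads of different runners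
-- occupy disjoint ranges of rows.
spread : ℕ → ℕ → ℕ
spread w c = suc (w + w) * suc c

spread-step : ∀ w {c c′} → c′ < c → spread w c′ + suc (w + w) ≤ spread w c
spread-step w {c} {c′} c′<c = begin
  suc (w + w) * suc c′ + suc (w + w)   ≡⟨ +-comm _ (suc (w + w)) ⟩
  suc (w + w) + suc (w + w) * suc c′   ≡⟨ *-suc (suc (w + w)) (suc c′) ⟨
  suc (w + w) * suc (suc c′)           ≤⟨ *-monoʳ-≤ (suc (w + w)) (s≤s c′<c) ⟩
  spread w c                           ∎
  where open ≤-Reasoning

w≤spread : ∀ w c → w ≤ spread w c
w≤spread w c = ≤-trans (m≤n⇒m≤1+n (m≤m+n w w)) (m≤m*n (suc (w + w)) (suc c))

applyUpTo-injective : ∀ {f g : ℕ → ℕ} n → applyUpTo f n ≡ applyUpTo g n → ∀ {c} → c < n → f c ≡ g c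
applyUpTo-injective (suc n) eq {zero}  _         = List.∷-injectiveˡ eq
applyUpTo-injective (suc n) eq {suc c} (s≤s c<n) = applyUpTo-injective n (List.∷-injectiveʳ eq) c<n

-- From just after `(q , c)` up to `(suc q , c)` one meets first only beads in row `q`, then the `c`
-- gaps at the start of row `suc q`, then the position itself.
lab-step : ∀ {e m q c} → c < e → (∀ c′ → c′ < c → m (suc q) c′ ≡ false) →
           (∀ c′ → c < c′ → c′ < e → m q c′ ≡ true) →
           lab e m (suc q) c ≡ lab e m q c + (c + gap (m (suc q) c))
lab-step {e} {m} {q} {c} c<e left right = begin
  before e m q + pre m q e + (pre m (suc q) c + gap (m (suc q) c))
    ≡⟨ cong₂ (λ a b → before e m q + a + (b + gap (m (suc q) c))) row-q
             (sumTo-const1 c λ c′ c′<c → cong gap (left c′ c′<c)) ⟩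
  before e m q + pre m q (suc c) + (c + gap (m (suc q) c)) ∎
  where
  open ≡-Reasoning
  row-q : pre m q e ≡ pre m q (suc c)
  row-q = begin
    pre m q e                              ≡⟨ cong (pre m q) (m+[n∸m]≡n c<e) ⟨
    pre m q (suc c + (e ∸ suc c))          ≡⟨ sumTo-++ (gap ∘ m q) (suc c) (e ∸ suc c) ⟩
    pre m q (suc c) + sumTo (λ j → gap (m q (suc c + j))) (e ∸ suc c)
      ≡⟨ cong (pre m q (suc c) +_) (sumTo-const0 (e ∸ suc c) λ j j< → cong gap (right (suc c + j) (s≤s (m≤m+n c j))
           (subst (suc c + j <_) (m+[n∸m]≡n c<e) (+-monoʳ-< (suc c) j<)))) ⟩
    pre m q (suc c) + 0                    ≡⟨ +-identityʳ _ ⟩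
    pre m q (suc c)                        ∎

module SpreadClass {e w m} (cl : Class e (applyUpTo (spread w) e) w m) where

  private
    h = Class.height cl

  cnt≡spread : ∀ {c} → c < e → cnt (col m c) h ≡ spread w c
  cnt≡spread = applyUpTo-injective e (Class.counts cl)

  inv≤w : ∀ {c} → c < e → inv (col m c) h ≤ w
  inv≤w c<e = subst (_ ≤_) (Class.weight cl) (sumTo-lookup-≤ (λ c → inv (col m c) h) c<e)

  -- With `bead⇒<spread` this confines the rows between a gap and a later bead of column `c` to
  -- within `w` of `spread w c`. Steps of `suc (w + w)` keep these windows of different columns
  -- apart.
  gap⇒spread≤ : ∀ {r c} → c < e → m r c ≡ false → spread w c ≤ r + w
  gap⇒spread≤ {r} {c} c<e mr = subst (_≤ r + w) (cnt≡spread c<e) (≤-trans bound (+-monoʳ-≤ r (inv≤w c<e)))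
    where
    bound : cnt (col m c) h ≤ r + inv (col m c) h
    bound with r <? h
    ... | yes r<h = gap⇒cnt≤ (col m c) r<h mr
    ... | no r≮h  = ≤-trans (cnt≤ (col m c) h) (≤-trans (≮⇒≥ r≮h) (m≤m+n r _))

  bead⇒<spread : ∀ {r c} → c < e → m r c ≡ true → r < spread w c + w
  bead⇒<spread {r} {c} c<e mr =
    <-≤-trans (bead⇒<cnt+inv (col m c) (bead⇒<height {m = m} (λ h≤r → Class.bounded cl h≤r c<e) mr) mr)
              (+-mono-≤ (≤-reflexive (cnt≡spread c<e)) (inv≤w c<e))

  -- Between a gap and a higher bead of one column, the columns to the left
  -- contain only gaps and those to the right only beads.
  lab-step-between : ∀ {p q s c} → c < e → m p c ≡ false → m s c ≡ true → p ≤ q → q < s →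
                     lab e m (suc q) c ≡ lab e m q c + (c + gap (m (suc q) c))
  lab-step-between {p} {q} {s} {c} c<e mp ms p≤q q<s = lab-step {m = m} {q} c<e left right
    where
    open ≤-Reasoning
    left : ∀ c′ → c′ < c → m (suc q) c′ ≡ false
    left c′ c′<c with true-or-false (m (suc q) c′)
    ... | inj₂ eq = eq
    ... | inj₁ eq = contradiction (begin-strict
      q + w                          <⟨ +-monoˡ-< w (<-trans (n<1+n q) (bead⇒<spread (<-trans c′<c c<e) eq)) ⟩
      spread w c′ + w + w            ≡⟨ +-assoc (spread w c′) w w ⟩
      spread w c′ + (w + w)          ≤⟨ +-monoʳ-≤ (spread w c′) (n≤1+n (w + w)) ⟩
      spread w c′ + suc (w + w)      ≤⟨ spread-step w c′<c ⟩
      spread w c                     ≤⟨ gap⇒spread≤ c<e mp ⟩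
      p + w                          ≤⟨ +-monoˡ-≤ w p≤q ⟩
      q + w                          ∎) (<-irrefl refl)
    right : ∀ c′ → c < c′ → c′ < e → m q c′ ≡ true
    right c′ c<c′ c′<e with true-or-false (m q c′)
    ... | inj₁ eq = eq
    ... | inj₂ eq = contradiction (begin-strict
      s + w                          <⟨ +-monoˡ-< w (bead⇒<spread c<e ms) ⟩
      spread w c + w + w             ≡⟨ +-assoc (spread w c) w w ⟩
      spread w c + (w + w)           ≤⟨ +-monoʳ-≤ (spread w c) (n≤1+n (w + w)) ⟩
      spread w c + suc (w + w)       ≤⟨ spread-step w c<c′ ⟩
      spread w c′                    ≤⟨ gap⇒spread≤ c′<e eq ⟩
      q + w                          ≤⟨ +-monoˡ-≤ w (<⇒≤ q<s) ⟩
      s + w                          ∎) (<-irrefl refl)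

  -- Each row that ends in a bead of column `c` adds exactly `c` to the label, and `d ∣ c`.
  lab-along-beads : ∀ {d p s c} → d ∣ c → c < e → m p c ≡ false → m s c ≡ true →
                    ∀ t → p + t ≤ s → (∀ r → p < r → r ≤ p + t → m r c ≡ true) →
                    Congruent d (lab e m p c) (lab e m (p + t) c)
  lab-along-beads {d} {p} {s} {c} d∣c c<e mp ms zero    le beads = subst (λ q → Congruent d (lab e m p c) (lab e m q c)) (sym (+-identityʳ p)) ≈-refl
  lab-along-beads {d} {p} {s} {c} d∣c c<e mp ms (suc t) le beads rewrite +-suc p t =
    ≈-trans (lab-along-beads d∣c c<e mp ms t (<⇒≤ le) (λ r p<r r≤ → beads r p<r (m≤n⇒m≤1+n r≤)))
      (subst (Congruent d (lab e m (p + t) c))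
        (sym (trans (lab-step-between c<e mp ms (m≤m+n p t) le)
                    (cong (λ b → lab e m (p + t) c + (c + gap b)) (beads (suc (p + t)) (s≤s (m≤m+n p t)) ≤-refl))))
        (∣⇒≈ (subst (d ∣_) (sym (+-identityʳ c)) d∣c)))

Admissible : ℕ → ℕ → Set
Admissible d c = d ∣ c × 0 < c

admissible? : ∀ d c → Dec (Admissible d c)
admissible? d c = (d Div.∣? c) ×-dec (0 <? c)

-- The parts are indexed by the runners themselves and vanish away from the positive multiples of
-- `d`; this avoids renumbering those runners.
Composition : ℕ → ℕ → ℕ → (ℕ → ℕ) → Set
Composition d n w f = (∀ {c} → c < n → ¬ Admissible d c → f c ≡ 0) × sumTo f n ≡ w

_≗[_]_ : (ℕ → ℕ) → ℕ → (ℕ → ℕ) → Set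
f ≗[ n ] g = ∀ c → c < n → f c ≡ g c

Holes : ℕ → ℕ → (ℕ → ℕ) → Config → Set
Holes e w f m = ∀ {c} → c < e → Hole (spread w c ∸ f c) (f c) (col m c)

module _ {d e w : ℕ} (1<d : 1 < d) where

  private
    Q : Config → Set
    Q = Good d e (applyUpTo (spread w) e) w

    part≤ : ∀ {f c} → Composition d e w f → c < e → f c ≤ spread w c
    part≤ {f} {c} (_ , sum≡w) c<e = ≤-trans (subst (f c ≤_) sum≡w (sumTo-lookup-≤ f c<e)) (w≤spread w c)

    spread-bound : ∀ {c} → c < e → spread w c < suc (spread w e)
    spread-bound c<e = s≤s (≤-trans (m≤m+n _ _) (spread-step w c<e))

    Holes-class : ∀ {f m} → Composition d e w f → Holes e w f m → Class e (applyUpTo (spread w) e) w m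
    Holes-class {f} {m} comp holes = record
      { height  = suc (spread w e)
      ; bounded = λ {r} {c} le c<e → Hole.beyond (holes c<e) (subst (_< r) (sym (end c<e)) (<-≤-trans (spread-bound c<e) le))
      ; counts  = applyUpTo-cong e λ c c<e →
          trans (Hole.cnt-hole (holes c<e) (subst (_< suc (spread w e)) (sym (end c<e)) (spread-bound c<e))) (end c<e)
      ; weight  = trans (sumTo-cong e λ c c<e →
          Hole.inv-hole (holes c<e) (subst (_< suc (spread w e)) (sym (end c<e)) (spread-bound c<e))) (proj₂ comp)
      }
      where
      end : ∀ {c} → c < e → spread w c ∸ f c + f c ≡ spread w c
      end c<e = m∸n+n≡m (part≤ comp c<e)

    Holes-good : ∀ {f m} → Composition d e w f → Holes e w f m → Q m
    Holes-good {f} {m} comp holes = cl , bal , reg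
      where
      cl = Holes-class comp holes
      open SpreadClass cl
      admissible : ∀ {r s c} → c < e → r < s → m r c ≡ false → m s c ≡ true → Admissible d c
      admissible {r} {s} {c} c<e r<s mr ms with Hole.gap-below-bead (holes c<e) mr ms r<s | admissible? d c
      ... | _         | yes adm = adm
      ... | refl , s≤ | no ¬adm = contradiction
        (subst (s ≤_) (trans (cong (spread w c ∸ f c +_) (proj₁ comp c<e ¬adm)) (+-identityʳ _)) s≤) (<⇒≱ r<s)
      bal : BalancedC d e m
      bal {c} {r} {s} c<e r<s mr ms with Hole.gap-below-bead (holes c<e) mr ms r<s
      ... | refl , s≤ = subst (λ q → Congruent d (lab e m r c) (lab e m q c)) (m+[n∸m]≡n (<⇒≤ r<s))
        (lab-along-beads (proj₁ (admissible c<e r<s mr ms)) c<e mr ms (s ∸ r) (≤-reflexive (m+[n∸m]≡n (<⇒≤ r<s)))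
          λ q r<q q≤ → Hole.above (holes c<e) r<q (≤-trans (subst (q ≤_) (m+[n∸m]≡n (<⇒≤ r<s)) q≤) s≤))
      reg : RegularC e m
      reg {r} {c} c<e mr with true-or-false (m (suc r) c)
      ... | inj₂ eq = <⇒≢ (lab-mono-< c<e (n<1+n r) eq)
      ... | inj₁ eq = λ lab≡lab → <⇒≢ (proj₂ (admissible c<e (n<1+n r) mr eq))
        (sym (m+n≡0⇒m≡0 c (+-cancelˡ-≡ (lab e m r c) _ 0
          (trans (sym (lab-step-between c<e mr eq ≤-refl (n<1+n r))) (trans (sym lab≡lab) (sym (+-identityʳ _)))))))

    -- From the gap to the bead in the next row the label grows by exactly `c`. Balance makes this a
    -- multiple of `d`, and regularity forbids that it be zero.
    good-admissible : ∀ {m q c} → Q m → c < e → m q c ≡ false → m (suc q) c ≡ true → Admissible d c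
    good-admissible {m} {q} {c} (cl , bal , reg) c<e mq msq = d∣c , n≢0⇒n>0 c≢0
      where
      open SpreadClass cl
      step : lab e m (suc q) c ≡ lab e m q c + c
      step = trans (lab-step-between c<e mq msq ≤-refl (n<1+n q))
        (cong (lab e m q c +_) (trans (cong (λ b → c + gap b) msq) (+-identityʳ c)))
      d∣c : d ∣ c
      d∣c = ≈⇒∣ (subst (Congruent d (lab e m q c)) step (bal c<e (n<1+n q) mq msq))
      c≢0 : c ≢ 0
      c≢0 refl = reg c<e mq (sym (trans step (+-identityʳ _)))

    -- Let `p` be the last gap before the gap that a bead follows. Along the beads after `p` the
    -- label is constant modulo `d`; at the next gap it grows by `c + 1`, since the gap counts
    -- itself; at the bead it grows by `c`. As `d ∣ c`, the labels of `p` and of the bead differ by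
    -- one modulo `d`, against balance.
    good-single-gap : ∀ {m c} → Q m → c < e → ∀ {q q′} → q < q′ → m q c ≡ false → m q′ c ≡ false → m (suc q′) c ≢ true
    good-single-gap {m} {c} good@(cl , bal , _) c<e {q} {suc q′} q<q′ mq mq′ msq
      with greatest-below (λ r → m r c ≟ᵇ false) (suc q′)
    ... | inj₂ none = none q q<q′ mq
    ... | inj₁ (p , s≤s p≤q′ , mp , p-max) = ≉-suc 1<d
      (≈-trans (bal c<e (<-trans (s≤s p≤q′) (n<1+n _)) mp msq) (≈-sym (≈-trans (≈-suc along) (≈-trans last next))))
      where
      open SpreadClass cl
      d∣c = proj₁ (good-admissible good c<e mq′ msq)
      p+ : p + (q′ ∸ p) ≡ q′
      p+ = m+[n∸m]≡n p≤q′
      beads : ∀ r → p < r → r ≤ p + (q′ ∸ p) → m r c ≡ true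
      beads r p<r r≤ with true-or-false (m r c)
      ... | inj₁ eq = eq
      ... | inj₂ eq = contradiction eq (p-max r p<r (s≤s (subst (r ≤_) p+ r≤)))
      along : Congruent d (lab e m p c) (lab e m q′ c)
      along = subst (λ r → Congruent d (lab e m p c) (lab e m r c)) p+
        (lab-along-beads d∣c c<e mp msq (q′ ∸ p) (≤-trans (≤-reflexive p+) (≤-trans (n≤1+n q′) (n≤1+n (suc q′)))) beads)
      last : Congruent d (suc (lab e m q′ c)) (lab e m (suc q′) c)
      last = subst (Congruent d (suc (lab e m q′ c)))
        (sym (trans (lab-step-between c<e mp msq p≤q′ (m<n⇒m<1+n (n<1+n q′)))
          (trans (cong (λ b → lab e m q′ c + (c + gap b)) mq′)
                 (trans (cong (lab e m q′ c +_) (+-comm c 1)) (+-suc (lab e m q′ c) c)))))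
        (∣⇒≈ d∣c)
      next : Congruent d (lab e m (suc q′) c) (lab e m (suc (suc q′)) c)
      next = bal c<e (n<1+n (suc q′)) mq′ msq

    -- A column of shape `Hole b v` has `b + v` beads and `v` inversions. Both parameters can thus
    -- be read off from its bead number and its inversions.
    good-holes : ∀ {m} → (good : Q m) → let h = Class.height (proj₁ good) in
                 Composition d e w (λ c → inv (col m c) h) × Holes e w (λ c → inv (col m c) h) m
    good-holes {m} good@(cl , _) = (zero-off , Class.weight cl) , holes
      where
      open SpreadClass cl
      h = Class.height cl
      shape : ∀ {c} → c < e → ∃[ b ] ∃[ v ] Hole b v (col m c)
      shape c<e = single-gap-hole h (λ r h≤r → Class.bounded cl h≤r c<e) (good-single-gap good c<e)

      module _ {c b v} (c<e : c < e) (hl : Hole b v (col m c)) where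
        private
          H : ℕ
          H = suc (b + v) ⊔ h
          bnd : ∀ r → h ≤ r → col m c r ≡ false
          bnd r h≤r = Class.bounded cl h≤r c<e
        inv≡ : inv (col m c) h ≡ v
        inv≡ = trans (sym (inv-stable (col m c) (m≤n⊔m (suc (b + v)) h) bnd)) (Hole.inv-hole hl (m≤m⊔n (suc (b + v)) h))
        cnt≡ : spread w c ≡ b + v
        cnt≡ = trans (sym (cnt≡spread c<e)) (trans (sym (cnt-stable (col m c) (m≤n⊔m (suc (b + v)) h) bnd))
                                                   (Hole.cnt-hole hl (m≤m⊔n (suc (b + v)) h)))

      holes : Holes e w (λ c → inv (col m c) h) m
      holes {c} c<e with shape c<e
      ... | b , v , hl = subst₂ (λ x y → Hole x y (col m c))
        (sym (trans (cong₂ _∸_ (cnt≡ c<e hl) (inv≡ c<e hl)) (m+n∸n≡m b v))) (sym (inv≡ c<e hl)) hl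
      zero-off : ∀ {c} → c < e → ¬ Admissible d c → inv (col m c) h ≡ 0
      zero-off {c} c<e ¬adm with shape c<e
      ... | b , zero  , hl = inv≡ c<e hl
      ... | b , suc v , hl = contradiction
        (good-admissible good c<e (Hole.at hl) (Hole.above hl (n<1+n b) (subst (suc b ≤_) (sym (+-suc b v)) (s≤s (m≤m+n b v))))) ¬adm

  composition-correspondence : Correspondence (_≗[ e ]_) (_≈[ e ]_) (Composition d e w) Q (Holes e w)
  composition-correspondence = record
    { total      = λ f comp → let holes = λ {c} _ → hole-isHole (spread w c ∸ f c) (f c) in
                     (λ r c → hole (spread w c ∸ f c) (f c) r) , Holes-good comp holes , holes
    ; surjective = λ m good → _ , good-holes good
    ; functional = λ {f} {f′} {m} {m′} _ _ _ _ hl hl′ eq r c c<e →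
                     Hole-unique (subst (λ v → Hole (spread w c ∸ v) v (col m c)) (eq c c<e) (hl c<e)) (hl′ c<e) r
    ; injective  = λ {f} {f′} {m} {m′} p p′ _ _ hl hl′ eq c c<e →
                     trans (sym (size-of p hl c<e)) (trans (inv-cong (suc (spread w e)) λ r _ → eq r c c<e) (size-of p′ hl′ c<e))
    }
    where
    size-of : ∀ {f m c} → Composition d e w f → Holes e w f m → c < e → inv (col m c) (suc (spread w e)) ≡ f c
    size-of comp hl c<e = Hole.inv-hole (hl c<e)
      (subst (_< suc (spread w e)) (sym (m∸n+n≡m (part≤ comp c<e))) (spread-bound c<e))

-- Counting compositions

Correspondence-bijection : ∀ {A B _≈_ _≋_ P Q} (f : A → B) (T : A → B → Set) →
  (∀ {x} → P x → Q (f x) × T x (f x)) → (∀ {y} → Q y → ∃[ x ] (P x × T x y)) →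
  (∀ {x x′ y y′} → T x y → T x′ y′ → x ≈ x′ → y ≋ y′) → (∀ {x x′ y y′} → T x y → T x′ y′ → y ≋ y′ → x ≈ x′) →
  Correspondence _≈_ _≋_ P Q T
Correspondence-bijection f T to from functional injective = record
  { total      = λ x p → f x , to p
  ; surjective = λ y q → from q
  ; functional = λ _ _ _ _ → functional
  ; injective  = λ _ _ _ _ → injective
  }

update : ℕ → ℕ → (ℕ → ℕ) → ℕ → ℕ
update n v f c with c ≟ n
... | yes _ = v
... | no _  = f c

update-at : ∀ n v f → update n v f n ≡ v
update-at n v f with n ≟ n
... | yes _  = refl
... | no n≢n = contradiction refl n≢n

update-off : ∀ {n v f c} → c < n → update n v f c ≡ f c
update-off {n} {c = c} c<n with c ≟ n
... | yes refl = contradiction c<n (<-irrefl refl)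
... | no _     = refl

≤-cases : ∀ {P : ℕ → Set} {n} → (∀ {c} → c < n → P c) → P n → ∀ {c} → c < suc n → P c
≤-cases below at (s≤s c≤n) with m≤n⇒m<n∨m≡n c≤n
... | inj₁ c<n  = below c<n
... | inj₂ refl = at

module _ (d : ℕ) where

  admissibleCount : ℕ → ℕ
  admissibleCount zero    = 0
  admissibleCount (suc n) with admissible? d n
  ... | yes _ = suc (admissibleCount n)
  ... | no _  = admissibleCount n

  private
    Extends : ℕ → (ℕ → ℕ) → (ℕ → ℕ) → (ℕ → ℕ) → Set
    Extends n v f g = (∀ {c} → c < n → f c ≡ g c) × g n ≡ v (f n)

    extend : ∀ n v f → Extends n v f (update n (v (f n)) f)
    extend n v f = (λ c<n → sym (update-off c<n)) , update-at n _ f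

    zero-functional : ∀ {n f f′ g g′} → Extends n (λ _ → 0) f g → Extends n (λ _ → 0) f′ g′ →
                      f ≗[ n ] f′ → g ≗[ suc n ] g′
    zero-functional (eq , g0) (eq′ , g′0) f≗ c = ≤-cases {λ c → _ ≡ _}
      (λ c<n → trans (sym (eq c<n)) (trans (f≗ _ c<n) (eq′ c<n))) (trans g0 (sym g′0))

    zero-injective : ∀ {n f f′ g g′} → Extends n (λ _ → 0) f g → Extends n (λ _ → 0) f′ g′ →
                     g ≗[ suc n ] g′ → f ≗[ n ] f′
    zero-injective (eq , _) (eq′ , _) g≗ c c<n = trans (eq c<n) (trans (g≗ c (m<n⇒m<1+n c<n)) (sym (eq′ c<n)))

    zero-correspondence : ∀ n w →
      Correspondence (_≗[ n ]_) (_≗[ suc n ]_) (Composition d n w) (λ g → Composition d (suc n) w g × g n ≡ 0)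
                     (Extends n (λ _ → 0))
    zero-correspondence n w = Correspondence-bijection (λ f → update n 0 f) _
      (λ {f} (off , sum≡) →
         (((λ {c} → ≤-cases {λ c → ¬ Admissible d c → update n 0 f c ≡ 0}
              (λ c<n ¬adm → trans (update-off c<n) (off c<n ¬adm)) (λ _ → update-at n 0 f)) ,
           trans (cong₂ _+_ (sumTo-cong n λ c c<n → update-off c<n) (update-at n 0 f)) (trans (+-identityʳ _) sum≡)) ,
          update-at n 0 f) ,
         extend n (λ _ → 0) f)
      (λ {g} ((off , sum≡) , g0) →
         g , ((λ c<n → off (m<n⇒m<1+n c<n)) , trans (sym (trans (cong (sumTo g n +_) g0) (+-identityʳ _))) sum≡) ,
         (λ _ → refl) , g0)
      zero-functional zero-injective

    suc-correspondence : ∀ n w → Admissible d n →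
      Correspondence (_≗[ suc n ]_) (_≗[ suc n ]_) (Composition d (suc n) w)
                     (λ g → Composition d (suc n) (suc w) g × g n ≢ 0) (Extends n suc)
    suc-correspondence n w adm = Correspondence-bijection (λ f → update n (suc (f n)) f) _
      (λ {f} (off , sum≡) →
         (((λ {c} → ≤-cases {λ c → ¬ Admissible d c → update n (suc (f n)) f c ≡ 0}
              (λ c<n ¬adm → trans (update-off c<n) (off (m<n⇒m<1+n c<n) ¬adm)) (λ ¬adm → contradiction adm ¬adm)) ,
           trans (cong₂ _+_ (sumTo-cong n λ c c<n → update-off c<n) (update-at n (suc (f n)) f))
                 (trans (+-suc (sumTo f n) (f n)) (cong suc sum≡))) ,
          λ eq → 1+n≢0 (trans (sym (update-at n (suc (f n)) f)) eq)) ,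
         extend n suc f)
      (λ {g} ((off , sum≡) , g≢0) → from g off sum≡ g≢0)
      (λ (eq , gn) (eq′ , g′n) f≗ c → ≤-cases {λ c → _ ≡ _}
         (λ c<n → trans (sym (eq c<n)) (trans (f≗ _ (m<n⇒m<1+n c<n)) (eq′ c<n)))
         (trans gn (trans (cong suc (f≗ n ≤-refl)) (sym g′n))))
      (λ (eq , gn) (eq′ , g′n) g≗ c → ≤-cases {λ c → _ ≡ _}
         (λ c<n → trans (eq c<n) (trans (g≗ _ (m<n⇒m<1+n c<n)) (sym (eq′ c<n))))
         (suc-injective (trans (sym gn) (trans (g≗ n ≤-refl) g′n))))
      where
      from : ∀ g → (∀ {c} → c < suc n → ¬ Admissible d c → g c ≡ 0) → sumTo g (suc n) ≡ suc w → g n ≢ 0 →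
             ∃[ f ] (Composition d (suc n) w f × Extends n suc f g)
      from g off sum≡ g≢0 with g n
      ... | zero  = contradiction refl g≢0
      ... | suc v = f ,
        ((λ {c} → ≤-cases {λ c → ¬ Admissible d c → f c ≡ 0}
            (λ c<n ¬adm → trans (update-off c<n) (off (m<n⇒m<1+n c<n) ¬adm)) (λ ¬adm → contradiction adm ¬adm)) ,
         suc-injective (trans (cong suc (cong₂ _+_ (sumTo-cong n λ c c<n → update-off c<n) (update-at n v g)))
                              (trans (sym (+-suc (sumTo g n) v)) sum≡))) ,
        (λ c<n → update-off c<n) , cong suc (sym (update-at n v g))
        where
        f = update n v g

  pascal : ∀ a w → (suc w + a ∸ 1) C suc w + (w + suc a ∸ 1) C w ≡ (suc w + suc a ∸ 1) C suc w
  pascal a w rewrite +-suc w a = trans (+-comm ((w + a) C suc w) _) (Comb.nCk+nC[k+1]≡[n+1]C[k+1] (w + a) w)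

  -- The outer induction removes the last runner; for an admissible runner the inner induction `go`
  -- lowers its part by one. Vanishing and positive last parts supply the two terms of Pascal's
  -- rule.
  composition-count : ∀ n w → Card (_≗[ n ]_) (Composition d n w) ((w + admissibleCount n ∸ 1) C w)
  -- Here `0 ∸ 1` is `0`, and `0 C 0 = 1` agrees with the convention for the binomial coefficient of
  -- -1 over 0.
  composition-count zero zero =
    (λ _ → 0) ∷ [] , ((λ ()) , refl) ∷ [] , [] ∷ [] , (λ f _ → here λ c ()) , refl
  composition-count zero (suc w) =
    [] , [] , [] , (λ { f (_ , ()) }) ,
    sym (Comb.k>n⇒nCk≡0 (s≤s (≤-reflexive (+-identityʳ w))))
  composition-count (suc n) w with admissible? d n
  ... | no ¬adm =
    Card-cong proj₁ (λ comp → comp , proj₁ comp ≤-refl ¬adm) (Card-transfer (zero-correspondence n w) (composition-count n w))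
  ... | yes adm = go w
    where
    go : ∀ w → Card (_≗[ suc n ]_) (Composition d (suc n) w) ((w + suc (admissibleCount n) ∸ 1) C w)
    go zero    = Card-cong proj₁ (λ comp → comp , m+n≡0⇒n≡0 (sumTo _ n) (proj₂ comp))
                   (Card-transfer (zero-correspondence n 0) (composition-count n 0))
    go (suc w) = subst (Card _ _) (pascal (admissibleCount n) w)
      (Card-cong (λ { (inj₁ (comp , _)) → comp ; (inj₂ (comp , _)) → comp }) split
        (Card-⊎ (Card-transfer (zero-correspondence n (suc w)) (composition-count n (suc w)))
                (Card-transfer (suc-correspondence n w adm) (go w))
                λ (_ , f0) (_ , g≢0) f≗g → g≢0 (trans (sym (f≗g n ≤-refl)) f0)))
      where
      split : ∀ {g} → Composition d (suc n) (suc w) g →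
              (Composition d (suc n) (suc w) g × g n ≡ 0) ⊎ (Composition d (suc n) (suc w) g × g n ≢ 0)
      split {g} comp with g n ≟ 0
      ... | yes g0 = inj₁ (comp , g0)
      ... | no g≢0 = inj₂ (comp , g≢0)

  -- Division with remainder, carried along as `k` grows: the count increases exactly when the
  -- remainder would reach `d`.
  admissibleCount-quotient : 1 < d → ∀ k → ∃[ r ] (r < d × k ≡ r + admissibleCount (suc k) * d)
  admissibleCount-quotient 1<d zero with admissible? d 0
  ... | yes (_ , ())
  ... | no _ = 0 , <-trans z<s 1<d , refl
  admissibleCount-quotient 1<d (suc k) with admissibleCount-quotient 1<d k | admissible? d (suc k)
  ... | r , r<d , k≡ | yes (d∣sk , _) = 0 , <-trans z<s 1<d , trans (cong suc k≡) (cong (_+ admissibleCount (suc k) * d) sr≡d)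
    where
    d∣sr : d ∣ suc r
    d∣sr = Div.∣m+n∣m⇒∣n (subst (d ∣_) (trans (cong suc k≡) (+-comm (suc r) _)) d∣sk) (Div.n∣m*n (admissibleCount (suc k)))
    sr≡d : suc r ≡ d
    sr≡d = ≤-antisym r<d (Div.∣⇒≤ d∣sr)
  ... | r , r<d , k≡ | no ¬adm with m≤n⇒m<n∨m≡n r<d
  ...   | inj₁ sr<d = suc r , sr<d , cong suc k≡
  ...   | inj₂ refl = contradiction (divides (suc (admissibleCount (suc k))) (cong suc k≡) , z<s) ¬adm

  admissibleCount≡/ : .{{_ : NonZero d}} → 1 < d → ∀ k → admissibleCount (suc k) ≡ k / d
  admissibleCount≡/ 1<d k with admissibleCount-quotient 1<d k
  ... | r , r<d , k≡ = sym (begin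
    k / d                          ≡⟨ cong (_/ d) k≡ ⟩
    (r + q * d) / d                ≡⟨ DivMod.+-distrib-/-∣ʳ r (Div.n∣m*n q) ⟩
    r / d + q * d / d              ≡⟨ cong₂ _+_ (DivMod.m<n⇒m/n≡0 r<d) (DivMod.m*n/n≡m q d) ⟩
    q                              ∎)
    where
    open ≡-Reasoning
    q = admissibleCount (suc k)

good-count : ∀ d k w .{{_ : NonZero d}} → 1 < d → ∀ {ps} → length ps ≡ suc k → All (w ≤_) ps →
             Card (_≈[ suc k ]_) (Good d (suc k) ps w) ((w + k / d ∸ 1) C w)
good-count d k w 1<d {ps} len ps≥w =
  count-independent d k w 1<d (trans (List.length-applyUpTo (spread w) (suc k)) (sym len))
    (All.applyUpTo⁺₂ (spread w) (suc k) (w≤spread w)) ps≥w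
    (Card-transfer (composition-correspondence 1<d)
      (subst (λ q → Card (_≗[ suc k ]_) (Composition d (suc k) w) ((w + q ∸ 1) C w)) (admissibleCount≡/ d 1<d k)
        (composition-count d (suc k) w)))

-- Partitions as words of beads and gaps

-- The beads of wordOf ps n are the n numbers pⱼ + n − j, where pⱼ = 0 past the end of ps.
wordOf : List ℕ → ℕ → ℕ → Bool
wordOf []       n       x with x <? n
... | yes _ = true
... | no _  = false
wordOf (p ∷ ps) zero    x = false
wordOf (p ∷ ps) (suc n) x with x ≟ p + n
... | yes _ = true
... | no _  = wordOf ps n x

wordOf-[]-bead : ∀ {n x} → x < n → wordOf [] n x ≡ true
wordOf-[]-bead {n} {x} x<n with x <? n
... | yes _  = refl
... | no x≮n = contradiction x<n x≮n

wordOf-[]-gap : ∀ {n x} → n ≤ x → wordOf [] n x ≡ false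
wordOf-[]-gap {n} {x} n≤x with x <? n
... | yes x<n = contradiction n≤x (<⇒≱ x<n)
... | no _    = refl

wordOf-head : ∀ p ps n → wordOf (p ∷ ps) (suc n) (p + n) ≡ true
wordOf-head p ps n with p + n ≟ p + n
... | yes _ = refl
... | no ne = contradiction refl ne

wordOf-tail : ∀ {p ps n x} → x ≢ p + n → wordOf (p ∷ ps) (suc n) x ≡ wordOf ps n x
wordOf-tail {p} {ps} {n} {x} ne with x ≟ p + n
... | yes eq = contradiction eq ne
... | no _   = refl

wordOf-top : ∀ {ps n x p} → Linked _≥_ (p ∷ ps) → length ps ≤ n → wordOf ps n x ≡ true → x < p + n
wordOf-top {[]} {n} {x} {p} _ _ wx with x <? n
... | yes x<n = <-≤-trans x<n (m≤n+m n p)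
wordOf-top {q ∷ ps} {suc n} {x} {p} (p≥q ∷ l) (s≤s len) wx with x ≟ q + n
... | yes refl = subst (q + n <_) (sym (+-suc p n)) (s≤s (+-monoˡ-≤ n p≥q))
... | no _     = <-trans (wordOf-top l len wx) (subst (q + n <_) (sym (+-suc p n)) (s≤s (+-monoˡ-≤ n p≥q)))

Linked-tail : ∀ {p ps} → Linked _≥_ (p ∷ ps) → Linked _≥_ ps
Linked-tail [-]     = []
Linked-tail (_ ∷ l) = l

wordOf-beyond : ∀ {ps n x p} → Linked _≥_ (p ∷ ps) → length ps ≤ n → p + n ≤ x → wordOf ps n x ≡ false
wordOf-beyond {ps} {n} {x} l len le with true-or-false (wordOf ps n x)
... | inj₁ eq = contradiction (wordOf-top l len eq) (≤⇒≯ le)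
... | inj₂ eq = eq

wordOf-low : ∀ {ps n x} → x + length ps < n → wordOf ps n x ≡ true
wordOf-low {[]}     {n}     {x} lt = wordOf-[]-bead (subst (_< n) (+-identityʳ x) lt)
wordOf-low {p ∷ ps} {suc n} {x} lt with x ≟ p + n
... | yes _ = refl
... | no _  = wordOf-low {ps} {n} {x} (≤-pred (subst (_< suc n) (+-suc x (length ps)) lt))

-- The equation says, free of subtraction, that `x` is the β-number pⱼ - j shifted by `n`. Indices
-- `j` past the end of the list account for the beads at the bottom.
wordOf-bead⇔entry : ∀ {ps n x} → length ps ≤ n → wordOf ps n x ≡ true ⇔ (∃[ j ] (1 ≤ j × x + j ≡ entry ps j + n))
wordOf-bead⇔entry {ps} {n} {x} len = mk⇔ (to ps n len) (λ (j , j≥1 , eq) → from ps n j len j≥1 eq)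
  where
  to : ∀ ps n → length ps ≤ n → wordOf ps n x ≡ true → ∃[ j ] (1 ≤ j × x + j ≡ entry ps j + n)
  to [] n _ wx with x <? n
  ... | yes x<n = n ∸ x , m<n⇒0<n∸m x<n , m+[n∸m]≡n (<⇒≤ x<n)
  to (p ∷ ps) (suc n) (s≤s len) wx with x ≟ p + n
  ... | yes refl = 1 , ≤-refl , trans (+-comm (p + n) 1) (sym (+-suc p n))
  ... | no _ with to ps n len wx
  ...   | suc j , j≥1 , eq = suc (suc j) , s≤s z≤n , trans (+-suc x (suc j)) (trans (cong suc eq) (sym (+-suc _ n)))

  from : ∀ ps n j → length ps ≤ n → 1 ≤ j → x + j ≡ entry ps j + n → wordOf ps n x ≡ true
  from []       n       j             _         j≥1 eq = wordOf-[]-bead (subst (x <_) eq (m<m+n x j≥1))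
  from (p ∷ ps) (suc n) (suc zero)    _         _   eq =
    subst (λ y → wordOf (p ∷ ps) (suc n) y ≡ true)
          (suc-injective (trans (sym (+-suc p n)) (trans (sym eq) (+-comm x 1)))) (wordOf-head p ps n)
  from (p ∷ ps) (suc n) (suc (suc j)) (s≤s len) _   eq with x ≟ p + n
  ... | yes _ = refl
  ... | no _  = from ps n (suc j) len (s≤s z≤n)
                  (suc-injective (trans (sym (+-suc x (suc j))) (trans eq (+-suc _ n))))

cnt-+1 : ∀ {f g k} H → k < H → f k ≡ true → g k ≡ false → (∀ j → j ≢ k → f j ≡ g j) → cnt f H ≡ suc (cnt g H)
cnt-+1 {f} {g} {k} H k<H fk gk off = begin
  cnt f H                    ≡⟨ +-identityʳ _ ⟨
  cnt f H + 0                ≡⟨ cong (λ b → cnt f H + bead b) gk ⟨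
  cnt f H + bead (g k)       ≡⟨ sumTo-update (bead ∘ f) (bead ∘ g) H k<H (λ j ne → cong bead (off j ne)) ⟩
  cnt g H + bead (f k)       ≡⟨ cong (λ b → cnt g H + bead b) fk ⟩
  cnt g H + 1                ≡⟨ +-comm _ 1 ⟩
  suc (cnt g H)              ∎
  where open ≡-Reasoning

second≤first : ∀ {p ps} → Linked _≥_ (p ∷ ps) → entry ps 1 ≤ p
second≤first [-]       = z≤n
second≤first (p≥q ∷ _) = p≥q

head-≤-sum : ∀ ps → entry ps 1 ≤ sum ps
head-≤-sum []       = z≤n
head-≤-sum (p ∷ ps) = m≤m+n p (sum ps)

module _ {p ps n} (l : Linked _≥_ (p ∷ ps)) (len : length ps ≤ n) where

  wordOf-head-gap : wordOf ps n (p + n) ≡ false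
  wordOf-head-gap = wordOf-beyond l len ≤-refl

  wordOf-drop : ∀ x → x ≢ p + n → wordOf (p ∷ ps) (suc n) x ≡ wordOf ps n x
  wordOf-drop x = wordOf-tail

cnt-wordOf : ∀ {ps n} H → Linked _≥_ ps → length ps ≤ n → entry ps 1 + n ≤ H → cnt (wordOf ps n) H ≡ n
cnt-wordOf {[]} {n} H _ _ n≤H =
  trans (cnt-stable (wordOf [] n) n≤H (λ k → wordOf-[]-gap)) (sumTo-const1 n λ k k<n → cong bead (wordOf-[]-bead k<n))
cnt-wordOf {p ∷ ps} {suc n} H l (s≤s len) le =
  trans (cnt-+1 H lt (wordOf-head p ps n) (wordOf-head-gap l len) (wordOf-drop l len))
        (cong suc (cnt-wordOf H (Linked-tail l) len (≤-trans (+-monoˡ-≤ n (second≤first l)) (<⇒≤ lt))))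
  where
  lt : p + n < H
  lt = subst (_≤ H) (+-suc p n) le

-- The positions pⱼ + n - j add up to the size plus 0 + 1 + ... + (n - 1). The size of a partition
-- is thereby expressed through `wsum`, on which the effect of a move is plain.
wsum-wordOf : ∀ {ps n} H → Linked _≥_ ps → length ps ≤ n → entry ps 1 + n ≤ H → wsum (wordOf ps n) H ≡ sum ps + tri n
wsum-wordOf {[]} {n} H _ _ n≤H =
  trans (sumTo-stable _ n≤H (λ k n≤k → cong (if_then k else 0) (wordOf-[]-gap {n} n≤k)))
        (sumTo-cong n λ k k<n → cong (if_then k else 0) (wordOf-[]-bead k<n))
wsum-wordOf {p ∷ ps} {suc n} H l (s≤s len) le = begin
  wsum (wordOf (p ∷ ps) (suc n)) H
    ≡⟨ +-identityʳ _ ⟨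
  wsum (wordOf (p ∷ ps) (suc n)) H + 0
    ≡⟨ cong (λ b → wsum (wordOf (p ∷ ps) (suc n)) H + (if b then p + n else 0)) (wordOf-head-gap l len) ⟨
  wsum (wordOf (p ∷ ps) (suc n)) H + (if wordOf ps n (p + n) then p + n else 0)
    ≡⟨ sumTo-update _ _ H lt (λ j ne → cong (if_then j else 0) (wordOf-drop l len j ne)) ⟩
  wsum (wordOf ps n) H + (if wordOf (p ∷ ps) (suc n) (p + n) then p + n else 0)
    ≡⟨ cong₂ (λ a b → a + (if b then p + n else 0)) (wsum-wordOf H (Linked-tail l) len (≤-trans (+-monoˡ-≤ n (second≤first l)) (<⇒≤ lt))) (wordOf-head p ps n) ⟩
  sum ps + tri n + (p + n)
    ≡⟨ rearrange (sum ps) (tri n) p n ⟩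
  p + sum ps + (tri n + n) ∎
  where
  open ≡-Reasoning
  rearrange : ∀ a b c d → a + b + (c + d) ≡ c + a + (b + d)
  rearrange = solve-∀
  lt : p + n < H
  lt = subst (_≤ H) (+-suc p n) le

wordOf-bounded : ∀ {ps n x} → Linked _≥_ ps → length ps ≤ n → entry ps 1 + n ≤ x → wordOf ps n x ≡ false
wordOf-bounded {[]}     {n}     _ _         le = wordOf-[]-gap le
wordOf-bounded {p ∷ ps} {suc n} {x} l (s≤s len) le =
  trans (wordOf-tail (>⇒≢ lt)) (wordOf-beyond l len (<⇒≤ lt))
  where
  lt : p + n < x
  lt = subst (_≤ x) (+-suc p n) le

-- The highest bead determines the first part. Positivity excludes trailing zeros, which would leave
-- the word unchanged.
wordOf-injective : ∀ {ps qs n} → Linked _≥_ ps → Linked _≥_ qs → All (1 ≤_) ps → All (1 ≤_) qs →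
                   length ps ≤ n → length qs ≤ n → (∀ x → wordOf ps n x ≡ wordOf qs n x) → ps ≡ qs
wordOf-injective {[]} {[]} _ _ _ _ _ _ _ = refl
wordOf-injective {[]} {q ∷ qs} {suc n} _ l _ (q≥1 ∷ _) _ _ eq =
  contradiction (trans (eq (q + n)) (wordOf-head q qs n)) (λ t → true≢false t (wordOf-[]-gap (+-monoˡ-≤ n q≥1)))
wordOf-injective {p ∷ ps} {[]} {suc n} l _ (p≥1 ∷ _) _ _ _ eq =
  contradiction (trans (sym (eq (p + n))) (wordOf-head p ps n)) (λ t → true≢false t (wordOf-[]-gap (+-monoˡ-≤ n p≥1)))
wordOf-injective {p ∷ ps} {q ∷ qs} {suc n} l l′ (_ ∷ pos) (_ ∷ pos′) (s≤s len) (s≤s len′) eq =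
  cong₂ _∷_ p≡q (wordOf-injective (Linked-tail l) (Linked-tail l′) pos pos′ len len′ tails)
  where
  top-≤ : ∀ {p ps x} → Linked _≥_ (p ∷ ps) → length ps ≤ n → wordOf (p ∷ ps) (suc n) x ≡ true → x ≤ p + n
  top-≤ {p} {ps} {x} l len wx with x ≟ p + n
  ... | yes refl = ≤-refl
  ... | no _     = <⇒≤ (wordOf-top l len wx)
  p≡q : p ≡ q
  p≡q = ≤-antisym (+-cancelʳ-≤ n p q (top-≤ l′ len′ (trans (sym (eq (p + n))) (wordOf-head p ps n))))
                  (+-cancelʳ-≤ n q p (top-≤ l len (trans (eq (q + n)) (wordOf-head q qs n))))
  tails : ∀ x → wordOf ps n x ≡ wordOf qs n x
  tails x with x ≟ p + n
  ... | yes refl = trans (wordOf-head-gap l len) (sym (wordOf-beyond l′ len′ (≤-reflexive (cong (_+ n) (sym p≡q)))))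
  ... | no ne    = trans (sym (wordOf-tail {p} {ps} ne)) (trans (eq x) (wordOf-tail {q} {qs} (subst (λ p → x ≢ p + n) p≡q ne)))

-- The word is read from the top, each bead giving as its part the number of gaps below it. At the
-- first bead without a gap below, all remaining parts would be zero and the list ends.
partsOf : (ℕ → Bool) → ℕ → List ℕ
partsOf u zero    = []
partsOf u (suc x) with u x | gaps u x
... | false | _     = partsOf u x
... | true  | zero  = []
... | true  | suc g = suc g ∷ partsOf u x

partsOf-Linked : ∀ u x p → gaps u x ≤ p → Linked _≥_ (p ∷ partsOf u x)
partsOf-Linked u zero    p le = [-]
partsOf-Linked u (suc x) p le with u x | gaps u x in eq
... | false | g     = partsOf-Linked u x p (subst (_≤ p) (sym eq) (≤-trans (m≤m+n g 1) le))
... | true  | zero  = [-]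
... | true  | suc g = subst (_≤ p) (+-identityʳ (suc g)) le ∷ partsOf-Linked u x (suc g) (≤-reflexive eq)

partsOf-positive : ∀ u x → All (1 ≤_) (partsOf u x)
partsOf-positive u zero    = []
partsOf-positive u (suc x) with u x | gaps u x
... | false | _     = partsOf-positive u x
... | true  | zero  = []
... | true  | suc g = s≤s z≤n ∷ partsOf-positive u x

partsOf-length : ∀ u x → length (partsOf u x) ≤ cnt u x
partsOf-length u zero    = z≤n
partsOf-length u (suc x) with u x | gaps u x
... | false | _     = ≤-trans (partsOf-length u x) (m≤m+n _ 0)
... | true  | zero  = z≤n
... | true  | suc g = ≤-trans (s≤s (partsOf-length u x)) (≤-reflexive (+-comm 1 (cnt u x)))

wordOf-partsOf-beyond : ∀ u H {x} → H ≤ x → wordOf (partsOf u H) (cnt u H) x ≡ false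
wordOf-partsOf-beyond u zero {x} _   = wordOf-[]-gap {0} {x} z≤n
wordOf-partsOf-beyond u (suc H) {x} H<x with u H | gaps u H in eq
... | false | g     rewrite +-identityʳ (cnt u H) = wordOf-partsOf-beyond u H (<⇒≤ H<x)
... | true  | zero  = wordOf-[]-gap (≤-trans (subst (_≤ suc H) (+-comm 1 (cnt u H)) (s≤s (cnt≤ u H))) H<x)
... | true  | suc g rewrite +-comm (cnt u H) 1 =
  trans (wordOf-tail (>⇒≢ (subst (_< x) (trans (sym (gaps+cnt u H)) (cong (_+ cnt u H) eq)) H<x)))
        (wordOf-partsOf-beyond u H (<⇒≤ H<x))

wordOf-partsOf : ∀ u H → (∀ x → H ≤ x → u x ≡ false) → ∀ x → wordOf (partsOf u H) (cnt u H) x ≡ u x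
wordOf-partsOf u H bounded x with x <? H
... | yes x<H = inside H x<H
  where
  inside : ∀ H {x} → x < H → wordOf (partsOf u H) (cnt u H) x ≡ u x
  inside (suc H) {x} (s≤s x≤H) with m≤n⇒m<n∨m≡n x≤H | u H in uH | gaps u H in eq
  ... | inj₁ x<H  | false | g     rewrite +-identityʳ (cnt u H) = inside H x<H
  ... | inj₂ refl | false | g     rewrite +-identityʳ (cnt u H) = trans (wordOf-partsOf-beyond u H ≤-refl) (sym uH)
  -- No gap precedes this bead, so all positions up to it are beads, as they are in the word of the
  -- empty list returned here.
  ... | inj₂ refl | true  | zero  = trans (wordOf-[]-bead (subst (x <_) full (n<1+n x))) (sym uH)
    where
    full : suc x ≡ cnt u x + 1
    full = trans (cong suc (trans (sym (gaps+cnt u x)) (cong (_+ cnt u x) eq))) (+-comm 1 (cnt u x))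
  ... | inj₁ x<H  | true  | zero  = trans (wordOf-[]-bead (<-trans x<H (subst (H <_) full (n<1+n H)))) (sym (no-gap (u x) refl))
    where
    full : suc H ≡ cnt u H + 1
    full = trans (cong suc (trans (sym (gaps+cnt u H)) (cong (_+ cnt u H) eq))) (+-comm 1 (cnt u H))
    no-gap : ∀ b → u x ≡ b → u x ≡ true
    no-gap true  ux = ux
    no-gap false ux = contradiction (subst₂ _≤_ (cong gap ux) eq (sumTo-lookup-≤ (gap ∘ u) x<H)) (λ ())
  ... | inj₂ refl | true  | suc g rewrite +-comm (cnt u H) 1 =
    trans (subst (λ y → wordOf (suc g ∷ partsOf u H) (suc (cnt u H)) y ≡ true)
                 (trans (cong (_+ cnt u H) (sym eq)) (gaps+cnt u H)) (wordOf-head (suc g) (partsOf u H) (cnt u H))) (sym uH)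
  ... | inj₁ x<H  | true  | suc g rewrite +-comm (cnt u H) 1 =
    trans (wordOf-tail {suc g} {partsOf u H} (<⇒≢ (subst (x <_) (trans (sym (gaps+cnt u H)) (cong (_+ cnt u H) eq)) x<H))) (inside H x<H)
... | no x≮H = trans (wordOf-partsOf-beyond u H (≮⇒≥ x≮H)) (sym (bounded x (≮⇒≥ x≮H)))

-- The number of gaps grows by at most one per position and so takes every value in between. This
-- produces the gap that represents a given column of the Young diagram.
gap-with-count : ∀ u g H → g < gaps u H → ∃[ x ] (x < H × u x ≡ false × gaps u x ≡ g)
gap-with-count u g (suc H) lt with g <? gaps u H
... | yes g< with gap-with-count u g H g<
...   | x , x<H , gx , eq = x , m<n⇒m<1+n x<H , gx , eq
gap-with-count u g (suc H) lt | no g≮ with true-or-false (u H)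
... | inj₁ uH = contradiction (subst (g <_) (trans (cong (λ b → gaps u H + gap b) uH) (+-identityʳ _)) lt) g≮
... | inj₂ uH = H , n<1+n H , uH ,
  ≤-antisym (≮⇒≥ g≮) (≤-pred (subst (g <_) (trans (cong (λ b → gaps u H + gap b) uH) (+-comm _ 1)) lt))

gaps-unbounded : ∀ u H → (∀ x → H ≤ x → u x ≡ false) → ∀ g → g < gaps u (H + suc g)
gaps-unbounded u H bounded g = subst (g <_)
  (sym (trans (sumTo-++ (gap ∘ u) H (suc g))
              (cong (gaps u H +_) (sumTo-const1 (suc g) λ k _ → cong gap (bounded (H + k) (m≤m+n H k))))))
  (m≤n+m (suc g) (gaps u H))

gaps-cong : ∀ {f g} n → (∀ k → k < n → f k ≡ g k) → gaps f n ≡ gaps g n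
gaps-cong n eq = sumTo-cong n λ k k<n → cong gap (eq k k<n)

gaps-suc-gap : ∀ u {x} → u x ≡ false → gaps u (suc x) ≡ suc (gaps u x)
gaps-suc-gap u {x} ux = trans (cong (λ b → gaps u x + gap b) ux) (+-comm _ 1)

gaps-suc-bead : ∀ u {x} → u x ≡ true → gaps u (suc x) ≡ gaps u x
gaps-suc-bead u {x} ux = trans (cong (λ b → gaps u x + gap b) ux) (+-identityʳ _)

gaps-past-head : ∀ {ps n H} → Linked _≥_ ps → length ps ≤ n → entry ps 1 + n ≤ H → gaps (wordOf ps n) H + n ≡ H
gaps-past-head {ps} {n} {H} l len le =
  trans (cong (gaps (wordOf ps n) H +_) (sym (cnt-wordOf H l len le))) (gaps+cnt (wordOf ps n) H)

Linked-≥-All : ∀ {p ps} → Linked _≥_ (p ∷ ps) → All (_≤ p) ps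
Linked-≥-All [-]         = []
Linked-≥-All (p≥q ∷ l)   = p≥q ∷ All.map (λ q′≤q → ≤-trans q′≤q p≥q) (Linked-≥-All l)

-- The bead of row `j` has the `n − j` later beads below it, which leaves pⱼ of the positions below
-- for gaps. The earlier beads lie above `x` and are removed one by one.
gaps-at-entry : ∀ {ps n j x} → Linked _≥_ ps → length ps ≤ n → 1 ≤ j → x + j ≡ entry ps j + n →
                gaps (wordOf ps n) x ≡ entry ps j
gaps-at-entry {[]} {n} {j} {x} l len j≥1 eq =
  sumTo-const0 x λ k k<x → cong gap (wordOf-[]-bead (<-trans k<x (subst (x <_) eq (m<m+n x j≥1))))
gaps-at-entry {p ∷ ps} {suc n} {suc zero} {x} l (s≤s len) _ eq
  with refl ← suc-injective (trans (+-comm 1 x) (trans eq (+-suc p n))) =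
  trans (gaps-cong x λ k k<x → wordOf-tail {p} {ps} (<⇒≢ k<x))
    (+-cancelʳ-≡ n _ _ (gaps-past-head (Linked-tail l) len (+-monoˡ-≤ n (second≤first l))))
gaps-at-entry {p ∷ ps} {suc n} {suc (suc j)} {x} l (s≤s len) _ eq =
  trans (gaps-cong x λ k k<x → wordOf-tail {p} {ps} (<⇒≢ (<-trans k<x x<)))
        (gaps-at-entry (Linked-tail l) len (s≤s z≤n) eq′)
  where
  eq′ : x + suc j ≡ entry ps (suc j) + n
  eq′ = suc-injective (trans (sym (+-suc x (suc j))) (trans eq (+-suc _ n)))
  x< : x < p + n
  x< = wordOf-top l len (Equivalence.from (wordOf-bead⇔entry {ps} len) (suc j , s≤s z≤n , eq′))

-- The beads above the gap are those of the parts that exceed the number of gaps below it. The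
-- positions below the gap are hence these gaps and the remaining beads.
gap-position : ∀ {ps n x} → Linked _≥_ ps → length ps ≤ n → wordOf ps n x ≡ false →
               x + length (filter (suc (gaps (wordOf ps n) x) ≤?_) ps) ≡ gaps (wordOf ps n) x + n
gap-position {[]} {n} {x} l len ux = trans (+-identityʳ x) (sym (gaps-past-head [] z≤n n≤x))
  where
  n≤x : n ≤ x
  n≤x = ≮⇒≥ λ x<n → true≢false (wordOf-[]-bead x<n) ux
gap-position {p ∷ ps} {suc n} {x} l (s≤s len) ux with <-cmp x (p + n)
... | tri≈ _ refl _ = contradiction ux (true≢false (wordOf-head p ps n))
... | tri< x< _ _ = begin
  x + length (filter (suc (gaps u x) ≤?_) (p ∷ ps))
    ≡⟨ cong (λ g → x + length (filter (suc g ≤?_) (p ∷ ps))) same ⟩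
  x + length (filter (suc (gaps u′ x) ≤?_) (p ∷ ps))
    ≡⟨ cong (λ qs → x + length qs) (List.filter-accept (suc (gaps u′ x) ≤?_) g<p) ⟩
  x + suc (length (filter (suc (gaps u′ x) ≤?_) ps))
    ≡⟨ +-suc x _ ⟩
  suc (x + length (filter (suc (gaps u′ x) ≤?_) ps))
    ≡⟨ cong suc (gap-position (Linked-tail l) len u′x) ⟩
  suc (gaps u′ x + n)
    ≡⟨ +-suc (gaps u′ x) n ⟨
  gaps u′ x + suc n
    ≡⟨ cong (_+ suc n) same ⟨
  gaps u x + suc n ∎
  where
  open ≡-Reasoning
  u  = wordOf (p ∷ ps) (suc n)
  u′ = wordOf ps n
  same : gaps u x ≡ gaps u′ x
  same = gaps-cong x λ k k<x → wordOf-tail {p} {ps} (<⇒≢ (<-trans k<x x<))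
  u′x : u′ x ≡ false
  u′x = trans (sym (wordOf-tail {p} {ps} (<⇒≢ x<))) ux
  g<p : gaps u′ x < p
  g<p = subst₂ _≤_ (gaps-suc-gap u′ u′x)
    (+-cancelʳ-≡ n _ _ (gaps-past-head (Linked-tail l) len (+-monoˡ-≤ n (second≤first l)))) (sumTo-monoʳ-≤ (gap ∘ u′) x<)
... | tri> _ _ x> = begin
  x + length (filter (suc (gaps u x) ≤?_) (p ∷ ps))
    ≡⟨ cong (λ qs → x + length qs) (List.filter-none (suc (gaps u x) ≤?_) (All.map too-small (≤-refl ∷ Linked-≥-All l))) ⟩
  x + 0
    ≡⟨ +-identityʳ x ⟩
  x
    ≡⟨ past ⟨
  gaps u x + suc n ∎
  where
  open ≡-Reasoning
  u = wordOf (p ∷ ps) (suc n)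
  past : gaps u x + suc n ≡ x
  past = gaps-past-head l (s≤s len) (subst (_≤ x) (sym (+-suc p n)) x>)
  p≤g : p ≤ gaps u x
  p≤g = +-cancelʳ-≤ (suc n) p (gaps u x) (subst₂ _≤_ (sym (+-suc p n)) (sym past) x>)
  too-small : ∀ {q} → q ≤ p → ¬ suc (gaps u x) ≤ q
  too-small q≤p g<q = <⇒≱ g<q (≤-trans q≤p p≤g)

entry-antitone : ∀ {p ps} j → Linked _≥_ (p ∷ ps) → entry ps j ≤ p
entry-antitone {ps = []}     j             _         = z≤n
entry-antitone {ps = _ ∷ _}  zero          _         = z≤n
entry-antitone {ps = q ∷ ps} (suc zero)    (p≥q ∷ _) = p≥q
entry-antitone {ps = q ∷ ps} (suc (suc j)) (p≥q ∷ l) = ≤-trans (entry-antitone (suc j) l) p≥q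

entry-positive⇒≤length : ∀ ps {j} → 1 ≤ entry ps j → j ≤ length ps
entry-positive⇒≤length (p ∷ ps) {suc zero}    _  = s≤s z≤n
entry-positive⇒≤length (p ∷ ps) {suc (suc j)} lt = s≤s (entry-positive⇒≤length ps lt)

≤length⇒entry-positive : ∀ {ps j} → All (1 ≤_) ps → 1 ≤ j → j ≤ length ps → 1 ≤ entry ps j
≤length⇒entry-positive {p ∷ ps} {suc zero}    (p≥1 ∷ _) _ _        = p≥1
≤length⇒entry-positive {p ∷ ps} {suc (suc j)} (_ ∷ pos) _ (s≤s le) = ≤length⇒entry-positive pos (s≤s z≤n) le

>length⇒entry-zero : ∀ ps {j} → length ps < j → entry ps j ≡ 0
>length⇒entry-zero []       _                   = refl
>length⇒entry-zero (p ∷ ps) {suc (suc j)} (s≤s lt) = >length⇒entry-zero ps lt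

-- This makes the truncated leg length in `hook` exact.
row≡≤column : ∀ {ps c} j → Linked _≥_ ps → 1 ≤ c → c ≤ entry ps j → j ≤ length (filter (c ≤?_) ps)
row≡≤column                   zero          l c≥1 c≤ = z≤n
row≡≤column {[]}              (suc j)       l c≥1 c≤ = contradiction (≤-trans c≥1 c≤) λ ()
row≡≤column {p ∷ ps} {c}      (suc zero)    l c≥1 c≤ rewrite List.filter-accept (c ≤?_) {xs = ps} c≤ = s≤s z≤n
row≡≤column {p ∷ ps} {c}      (suc (suc j)) l c≥1 c≤
  rewrite List.filter-accept (c ≤?_) {xs = ps} (≤-trans c≤ (entry-antitone (suc j) l)) =
  s≤s (row≡≤column (suc j) (Linked-tail l) c≥1 c≤)

multiplicity+ : ∀ p ps → length (filter (p ≤?_) ps) ≡ length (filter (_≟ p) ps) + length (filter (suc p ≤?_) ps)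
multiplicity+ p []       = refl
multiplicity+ p (q ∷ ps) with <-cmp q p
... | tri< q<p q≢p _ rewrite List.filter-reject (p ≤?_) {xs = ps} (<⇒≱ q<p) | List.filter-reject (_≟ p) {xs = ps} q≢p
                           | List.filter-reject (suc p ≤?_) {xs = ps} (<⇒≱ (m<n⇒m<1+n q<p)) = multiplicity+ p ps
... | tri≈ _ refl _ rewrite List.filter-accept (q ≤?_) {xs = ps} ≤-refl | List.filter-accept (_≟ q) {xs = ps} refl
                          | List.filter-reject (suc q ≤?_) {xs = ps} (<-irrefl refl) = cong suc (multiplicity+ q ps)
... | tri> _ q≢p p<q rewrite List.filter-accept (p ≤?_) {xs = ps} (<⇒≤ p<q) | List.filter-reject (_≟ p) {xs = ps} q≢p
                           | List.filter-accept (suc p ≤?_) {xs = ps} p<q =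
                             trans (cong suc (multiplicity+ p ps)) (sym (+-suc _ _))

-- Hooks and multiplicities on the abacus

config : ℕ → (ℕ → Bool) → Config
config e u r c = u (r * e + c)

lab-config : ∀ e u r c → lab e (config e u) r c ≡ gaps u (suc (r * e + c))
lab-config e u r c = trans (cong (_+ pre (config e u) r (suc c)) (sym (sumTo-rows (gap ∘ u) e r)))
  (trans (sym (sumTo-++ (gap ∘ u) (r * e) (suc c))) (cong (gaps u) (+-suc (r * e) c)))

module PartitionWord (ν : Partition) {n : ℕ} (len : length (parts ν) ≤ n) where

  word : ℕ → Bool
  word = wordOf (parts ν) n

  word-bounded : ∀ x → part ν 1 + n ≤ x → word x ≡ false
  word-bounded x = wordOf-bounded (decreasing ν) len

  bead⇒row : ∀ {y g} → word y ≡ true → g < gaps word y → ∃[ j ] (1 ≤ j × j ≤ length (parts ν) × y + j ≡ part ν j + n × gaps word y ≡ part ν j)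
  bead⇒row {y} uy g< with Equivalence.to (wordOf-bead⇔entry {parts ν} len) uy
  ... | j , j≥1 , eq = j , j≥1 , entry-positive⇒≤length (parts ν) (≤-trans (s≤s z≤n) (subst (_ <_) gaps≡ g<)) , eq , gaps≡
    where
    gaps≡ = gaps-at-entry (decreasing ν) len j≥1 eq

  -- Hooks correspond to pairs of a gap and a later bead, with their distance as hook length. The
  -- bead supplies the row, and `gap-position` gives the length of the column that belongs to the
  -- gap.
  hook-between : ∀ {j x y} → y + j ≡ part ν j + n → word x ≡ false → gaps word x < part ν j →
                 hook ν j (suc (gaps word x)) + x ≡ y
  hook-between {j} {x} {y} row≡ ux g< = +-cancelʳ-≡ j _ _ (begin
    a + b + 1 + x + j                ≡⟨ rearrange a b x j ⟩
    suc a + (x + (b + j))            ≡⟨ cong (λ k → suc a + (x + k)) (m∸n+n≡m j≤) ⟩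
    suc a + (x + K)                  ≡⟨ cong (suc a +_) (gap-position (decreasing ν) len ux) ⟩
    suc a + (g + n)                  ≡⟨ rearrange′ a g n ⟩
    a + suc g + n                    ≡⟨ cong (_+ n) (m∸n+n≡m g<) ⟩
    part ν j + n                     ≡⟨ row≡ ⟨
    y + j                            ∎)
    where
    open ≡-Reasoning
    g = gaps word x
    K = conjPart ν (suc g)
    a = part ν j ∸ suc g
    b = K ∸ j
    j≤ : j ≤ K
    j≤ = row≡≤column j (decreasing ν) (s≤s z≤n) g<
    rearrange : ∀ a b x j → a + b + 1 + x + j ≡ suc a + (x + (b + j))
    rearrange = solve-∀
    rearrange′ : ∀ a g n → suc a + (g + n) ≡ a + suc g + n
    rearrange′ = solve-∀

  -- The parts equal to suc (gaps word x) are the beads between the gap x and the next gap.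
  next-gap : ∀ {x x′} → word x ≡ false → word x′ ≡ false → gaps word x′ ≡ suc (gaps word x) →
             x′ ≡ suc (x + length (filter (_≟ suc (gaps word x)) (parts ν)))
  next-gap {x} {x′} ux ux′ eq = +-cancelʳ-≡ k′ _ _ (begin
    x′ + k′              ≡⟨ subst (λ g → x′ + length (filter (suc g ≤?_) (parts ν)) ≡ g + n) eq (gap-position (decreasing ν) len ux′) ⟩
    suc (g + n)          ≡⟨ cong suc (gap-position (decreasing ν) len ux) ⟨
    suc (x + length (filter (suc g ≤?_) (parts ν)))
                         ≡⟨ cong (λ l → suc (x + l)) (multiplicity+ (suc g) (parts ν)) ⟩
    suc (x + (k + k′))   ≡⟨ cong suc (+-assoc x k k′) ⟨
    suc (x + k) + k′     ∎)
    where
    open ≡-Reasoning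
    g  = gaps word x
    k  = length (filter (_≟ suc g) (parts ν))
    k′ = length (filter (suc (suc g) ≤?_) (parts ν))

  row⇒bead : ∀ {j} → 1 ≤ j → j ≤ length (parts ν) →
             ∃[ y ] (word y ≡ true × y + j ≡ part ν j + n × gaps word y ≡ part ν j)
  row⇒bead {j} j≥1 j≤ = part ν j + n ∸ j , Equivalence.from (wordOf-bead⇔entry {parts ν} len) (j , j≥1 , row≡) , row≡ ,
                        gaps-at-entry (decreasing ν) len j≥1 row≡
    where
    row≡ : part ν j + n ∸ j + j ≡ part ν j + n
    row≡ = m∸n+n≡m (≤-trans j≤ (≤-trans len (m≤n+m n (part ν j))))

  gaps-< : ∀ {x y} → word x ≡ false → x < y → gaps word x < gaps word y
  gaps-< {y = y} ux x<y = subst (_≤ gaps word y) (gaps-suc-gap word ux) (sumTo-monoʳ-≤ (gap ∘ word) x<y)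

  -- A gap with `g` gaps below it and a later bead of the same runner give a node in column `suc g`
  -- whose hook length is a multiple of `e`. The label of the gap is `suc g` and that of the bead is
  -- the part, so their difference is exactly the arm.
  Balanced⇒BalancedC : ∀ {d e} → Balanced d e ν → BalancedC d e (config e word)
  Balanced⇒BalancedC {d} {e} bal {c} {r} {s} c<e r<s ux uy =
    let (j , j≥1 , j≤ , row≡ , gaps≡) = bead⇒row uy (gaps-< ux x<y)
        g<    = subst (g <_) gaps≡ (gaps-< ux x<y)
        hook≡ = +-cancelʳ-≡ x _ _ (trans (hook-between row≡ ux g<) y≡)
    in subst₂ (Congruent d)
         (sym (trans (lab-config e word r c) (gaps-suc-gap word ux)))
         (sym (trans (lab-config e word s c) (trans (gaps-suc-bead word uy) (trans gaps≡ (sym (m+[n∸m]≡n g<))))))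
         (∣⇒≈ (bal j (suc g) ((j≥1 , j≤) , (s≤s z≤n , g<)) (divides (s ∸ r) hook≡)))
    where
    x = r * e + c
    g = gaps word x
    x<y : x < s * e + c
    x<y = +-monoˡ-< c (*-monoˡ-< e {{>-nonZero (≤-trans (s≤s z≤n) c<e)}} r<s)
    y≡ : s * e + c ≡ (s ∸ r) * e + x
    y≡ = trans (cong (λ s → s * e + c) (sym (m∸n+n≡m (<⇒≤ r<s))))
           (trans (cong (_+ c) (*-distribʳ-+ e (s ∸ r) r)) (+-assoc ((s ∸ r) * e) (r * e) c))

  -- More than `g` gaps lie below the bead of row `j`, so column `suc g` is represented by a gap
  -- before it. A hook length divisible by `e` places the two on the same runner.
  BalancedC⇒Balanced : ∀ {d e} → .{{NonZero e}} → BalancedC d e (config e word) → Balanced d e ν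
  BalancedC⇒Balanced {d} {e} bal j (suc g) ((j≥1 , j≤) , (_ , g<)) (divides q hook≡) with row⇒bead j≥1 j≤
  ... | y , uy , row≡ , gaps≡ with gap-with-count word g y (subst (g <_) (sym gaps≡) g<)
  ...   | x , x<y , ux , refl = ≈⇒∣ (subst₂ (Congruent d)
    (trans (lab-config e word r c) (trans (cong (gaps word ∘ suc) (sym x≡)) (gaps-suc-gap word ux)))
    (trans (lab-config e word (q + r) c) (trans (cong (gaps word ∘ suc) (sym y≡))
      (trans (gaps-suc-bead word uy) (trans gaps≡ (sym (m+[n∸m]≡n g<))))))
    (bal (DivMod.m%n<n x e) r<s (subst (λ x → word x ≡ false) x≡ ux) (subst (λ y → word y ≡ true) y≡ uy)))
    where
    r = x / e
    c = x % e
    x≡ : x ≡ r * e + c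
    x≡ = trans (DivMod.m≡m%n+[m/n]*n x e) (+-comm c (r * e))
    y≡x : y ≡ q * e + x
    y≡x = trans (sym (hook-between row≡ ux g<)) (cong (_+ x) hook≡)
    y≡ : y ≡ (q + r) * e + c
    y≡ = trans y≡x (trans (cong (q * e +_) x≡)
           (trans (sym (+-assoc (q * e) (r * e) c)) (cong (_+ c) (sym (*-distribʳ-+ e q r)))))
    r<s : r < q + r
    r<s = +-monoˡ-< r (n≢0⇒n>0 λ { refl → <-irrefl (sym y≡x) x<y })

  -- The next gap follows after as many beads as there are parts equal to `suc g`, hence within `e`
  -- positions, and it raises the label.
  Regular⇒RegularC : ∀ {e} → 0 < e → Regular e ν → RegularC e (config e word)
  Regular⇒RegularC {e} 0<e reg {r} {c} c<e ux lab≡lab with gap-with-count word (suc g) (H + suc (suc g)) (gaps-unbounded word H word-bounded (suc g))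
    where
    H = part ν 1 + n
    g = gaps word (r * e + c)
  ... | x′ , _ , ux′ , gx′ = <-irrefl refl (begin-strict
    suc g                                ≡⟨ gx′ ⟨
    gaps word x′                         <⟨ n<1+n _ ⟩
    suc (gaps word x′)                   ≡⟨ gaps-suc-gap word ux′ ⟨
    gaps word (suc x′)                   ≤⟨ sumTo-monoʳ-≤ (gap ∘ word) (s≤s x′≤) ⟩
    gaps word (suc (e + r * e + c))      ≡⟨ lab-config e word (suc r) c ⟨
    lab e (config e word) (suc r) c      ≡⟨ lab≡lab ⟨
    lab e (config e word) r c            ≡⟨ lab-config e word r c ⟩
    gaps word (suc x)                    ≡⟨ gaps-suc-gap word ux ⟩
    suc g                                ∎)
    where
    open ≤-Reasoning
    x = r * e + c
    g = gaps word x
    mult = length (filter (_≟ suc g) (parts ν))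
    mult< : mult < e
    mult< with filter (_≟ suc g) (parts ν) in eq
    -- `Regular` speaks only of values that occur as parts; a value that does not occur has
    -- multiplicity 0.
    ... | []    = 0<e
    ... | q ∷ _ with Membership.∈-filter⁻ (_≟ suc g) {xs = parts ν} (subst (q ∈ₗ_) (sym eq) (here refl))
    ...   | q∈ , refl = subst (λ l → length l < e) eq (reg (suc g) q∈)
    x′≤ : x′ ≤ e + r * e + c
    x′≤ = begin
      x′                ≡⟨ next-gap ux ux′ gx′ ⟩
      suc (x + mult)    ≡⟨ +-suc x mult ⟨
      x + suc mult      ≤⟨ +-monoʳ-≤ x mult< ⟩
      x + e             ≡⟨ +-comm x e ⟩
      e + x             ≡⟨ +-assoc e (r * e) c ⟨
      e + r * e + c     ∎

  -- If the label grows within `e` positions after the gap `x`, the next gap lies among them. The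
  -- beads in between, which are the parts equal to `suc g`, then number fewer than `e`.
  RegularC⇒Regular : ∀ {e} → .{{NonZero e}} → RegularC e (config e word) → Regular e ν
  RegularC⇒Regular {e} reg zero    p∈ = contradiction (All.lookup (positive ν) p∈) λ ()
  RegularC⇒Regular {e} reg (suc g) p∈ with gap-with-count word g (part ν 1 + n + suc g) (gaps-unbounded word (part ν 1 + n) word-bounded g)
  ... | x , _ , ux , refl with gap-with-count word (suc g) (suc (e + x)) more
    where
    r = x / e
    c = x % e
    x≡ : x ≡ r * e + c
    x≡ = trans (DivMod.m≡m%n+[m/n]*n x e) (+-comm c (r * e))
    first : lab e (config e word) r c ≡ suc g
    first = trans (lab-config e word r c) (trans (cong (gaps word ∘ suc) (sym x≡)) (gaps-suc-gap word ux))
    second : lab e (config e word) (suc r) c ≡ gaps word (suc (e + x))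
    second = trans (lab-config e word (suc r) c)
      (cong (gaps word ∘ suc) (trans (+-assoc e (r * e) c) (cong (e +_) (sym x≡))))
    more : suc g < gaps word (suc (e + x))
    more = ≤∧≢⇒< (subst (_≤ gaps word (suc (e + x))) (gaps-suc-gap word ux) (sumTo-monoʳ-≤ (gap ∘ word) (s≤s (m≤n+m x e))))
      λ eq → reg {r} {c} (DivMod.m%n<n x e) (subst (λ x → word x ≡ false) x≡ ux) (trans first (trans eq (sym second)))
  ...   | x′ , x′< , ux′ , gx′ = +-cancelˡ-≤ x _ _
    (≤-trans (≤-reflexive (trans (+-suc x _) (sym (next-gap ux ux′ gx′)))) (≤-trans (≤-pred x′<) (≤-reflexive (+-comm e x))))

-- Moving one bead of a word

record Moved (a b : ℕ) (u v : ℕ → Bool) : Set where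
  field
    source-before : u b ≡ true
    target-before : u a ≡ false
    source-after  : v b ≡ false
    target-after  : v a ≡ true
    elsewhere     : ∀ x → x ≢ a → x ≢ b → v x ≡ u x

remove : ℕ → (ℕ → Bool) → ℕ → Bool
remove b u x with x ≟ b
... | yes _ = false
... | no _  = u x

remove-at : ∀ b u → remove b u b ≡ false
remove-at b u with b ≟ b
... | yes _ = refl
... | no ne = contradiction refl ne

remove-off : ∀ {b u x} → x ≢ b → remove b u x ≡ u x
remove-off {b} {u} {x} x≢b with x ≟ b
... | yes eq = contradiction eq x≢b
... | no _   = refl

add : ℕ → (ℕ → Bool) → ℕ → Bool
add a u x with x ≟ a
... | yes _ = true
... | no _  = u x

add-at : ∀ a u → add a u a ≡ true
add-at a u with a ≟ a
... | yes _ = refl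
... | no ne = contradiction refl ne

add-off : ∀ {a u x} → x ≢ a → add a u x ≡ u x
add-off {a} {u} {x} x≢a with x ≟ a
... | yes eq = contradiction eq x≢a
... | no _   = refl

Moved-add-remove : ∀ {a b u} → a ≢ b → u b ≡ true → u a ≡ false → Moved a b u (add a (remove b u))
Moved-add-remove {a} {b} {u} a≢b ub ua = record
  { source-before = ub
  ; target-before = ua
  ; source-after  = trans (add-off (≢-sym a≢b)) (remove-at b u)
  ; target-after  = add-at a _
  ; elsewhere     = λ x x≢a x≢b → trans (add-off x≢a) (remove-off x≢b)
  }

Moved-cong : ∀ {a b u v v′} → (∀ x → v′ x ≡ v x) → Moved a b u v → Moved a b u v′
Moved-cong eq mv = record
  { source-before = source-before
  ; target-before = target-before
  ; source-after  = trans (eq _) source-after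
  ; target-after  = trans (eq _) target-after
  ; elsewhere     = λ x x≢a x≢b → trans (eq x) (elsewhere x x≢a x≢b)
  } where open Moved mv

-- Both words are compared with the word `t` that lacks the moved bead. A constant `h` gives the
-- number of beads, the identity gives `wsum`.
Moved-sum : ∀ {a b u v} (h : ℕ → ℕ) H → a ≢ b → a < H → b < H → Moved a b u v →
            sumTo (λ x → if u x then h x else 0) H + h a ≡ sumTo (λ x → if v x then h x else 0) H + h b
Moved-sum {a} {b} {u} {v} h H a≢b a<H b<H mv = begin
  S u + h a              ≡⟨ cong (_+ h a) (change u b b<H source-before (remove-at b u) λ x → remove-off) ⟩
  S t + h b + h a        ≡⟨ xy∙z≈xz∙y (S t) (h b) (h a) ⟩
  S t + h a + h b        ≡⟨ cong (_+ h b) (change v a a<H target-after (trans (remove-off a≢b) target-before) unchanged) ⟨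
  S v + h b              ∎
  where
  open Moved mv
  open ≡-Reasoning
  t = remove b u
  S : (ℕ → Bool) → ℕ
  S u = sumTo (λ x → if u x then h x else 0) H
  change : ∀ u k → k < H → u k ≡ true → t k ≡ false → (∀ x → x ≢ k → t x ≡ u x) → S u ≡ S t + h k
  change u k k<H uk tk same = trans (sym (+-identityʳ _))
    (subst₂ (λ p q → S u + (if p then h k else 0) ≡ S t + (if q then h k else 0)) tk uk
      (sumTo-update _ _ H k<H λ x x≢k → cong (if_then h x else 0) (sym (same x x≢k))))
  unchanged : ∀ x → x ≢ a → t x ≡ v x
  unchanged x x≢a with x ≟ b
  ... | yes refl = sym source-after
  ... | no x≢b   = sym (elsewhere x x≢a x≢b)

Moved-cnt : ∀ {a b u v} H → a ≢ b → a < H → b < H → Moved a b u v → cnt u H ≡ cnt v H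
Moved-cnt H a≢b a<H b<H mv = +-cancelʳ-≡ 1 _ _ (Moved-sum (λ _ → 1) H a≢b a<H b<H mv)

Moved-bounded : ∀ {a b u v H} → a < b → (∀ x → H ≤ x → u x ≡ false) → Moved a b u v → ∀ x → H ≤ x → v x ≡ false
Moved-bounded {a} {b} {u} {v} {H} a<b bounded mv x H≤x =
  trans (elsewhere x (>⇒≢ (<-trans a<b (<-≤-trans b<H H≤x))) (>⇒≢ (<-≤-trans b<H H≤x))) (bounded x H≤x)
  where
  open Moved mv
  b<H : b < H
  b<H = ≰⇒> λ H≤b → true≢false source-before (bounded b H≤b)

position-injective : ∀ {e r r′ c c′} → .{{NonZero e}} → c < e → c′ < e → r * e + c ≡ r′ * e + c′ → r ≡ r′ × c ≡ c′
position-injective {e} {r} {r′} {c} {c′} c<e c′<e eq = *-cancelʳ-≡ r r′ e (+-cancelʳ-≡ c (r * e) (r′ * e)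
    (trans eq (cong (r′ * e +_) (sym c≡)))) , c≡
  where
  rem : ∀ r {c} → c < e → (r * e + c) % e ≡ c
  rem r {c} c<e = trans (cong (_% e) (+-comm (r * e) c)) (trans (DivMod.[m+kn]%n≡m%n c r e) (DivMod.m<n⇒m%n≡m c<e))
  c≡ : c ≡ c′
  c≡ = trans (sym (rem r c<e)) (trans (cong (_% e) eq) (rem r′ c′<e))

position : ∀ x e .{{_ : NonZero e}} → x ≡ x / e * e + x % e
position x e = trans (DivMod.m≡m%n+[m/n]*n x e) (+-comm (x % e) _)

Bounded : ℕ → ℕ → (ℕ → Bool) → Set
Bounded e M u = ∀ x → M * e ≤ x → u x ≡ false

columnCnt : ℕ → (ℕ → Bool) → ℕ → ℕ → ℕ
columnCnt e u M c = cnt (col (config e u) c) M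

totalInv : ℕ → (ℕ → Bool) → ℕ → ℕ
totalInv e u M = sumTo (λ c → inv (col (config e u) c) M) e

config-bounded : ∀ {e M u} → Bounded e M u → ∀ {r c} → M ≤ r → config e u r c ≡ false
config-bounded {e} bounded M≤r = bounded _ (≤-trans (*-monoˡ-≤ e M≤r) (m≤m+n _ _))

row<bound : ∀ {e M u r c} → Bounded e M u → config e u r c ≡ true → r < M
row<bound {e} {M} {u} {r} bounded ur = ≰⇒> λ M≤r → true≢false ur (config-bounded {e} {M} {u} bounded M≤r)

module _ {e : ℕ} .{{_ : NonZero e}} {M y u v} (bounded : Bounded e M u) (mv : Moved y (y + e) u v) where

  private
    open Moved mv
    r = y / e
    c = y % e

    c<e : c < e
    c<e = DivMod.m%n<n y e

    y≡ : y ≡ r * e + c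
    y≡ = position y e

    y+e≡ : y + e ≡ suc r * e + c
    y+e≡ = trans (+-comm y e) (trans (cong (e +_) y≡) (sym (+-assoc e (r * e) c)))

    column : Moved r (suc r) (col (config e u) c) (col (config e v) c)
    column = record
      { source-before = trans (cong u (sym y+e≡)) source-before
      ; target-before = trans (cong u (sym y≡)) target-before
      ; source-after  = trans (cong v (sym y+e≡)) source-after
      ; target-after  = trans (cong v (sym y≡)) target-after
      ; elsewhere     = λ r′ r′≢r r′≢sr → elsewhere (r′ * e + c)
          (λ eq → r′≢r (proj₁ (position-injective {r = r′} {r} c<e c<e (trans eq y≡))))
          (λ eq → r′≢sr (proj₁ (position-injective {r = r′} {suc r} c<e c<e (trans eq y+e≡))))
      }

    other-column : ∀ {c′} → c′ < e → c′ ≢ c → ∀ r′ → config e v r′ c′ ≡ config e u r′ c′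
    other-column c′<e c′≢c r′ = elsewhere _
      (λ eq → c′≢c (proj₂ (position-injective {r = r′} {r} c′<e c<e (trans eq y≡))))
      (λ eq → c′≢c (proj₂ (position-injective {r = r′} {suc r} c′<e c<e (trans eq y+e≡))))

    sr<M : suc r < M
    sr<M = row<bound {e} {M} {u} bounded (Moved.source-before column)

    column-cnt : columnCnt e u M c ≡ columnCnt e v M c
    column-cnt = Moved-cnt M (≢-sym 1+n≢n) (<-trans (n<1+n r) sr<M) sr<M column

    -- Within its column the bead moves by one row, which lowers `wsum` by one. The number of beads
    -- is unchanged, so the whole loss falls on `inv`.
    column-inv : inv (col (config e u) c) M ≡ suc (inv (col (config e v) c) M)
    column-inv = +-cancelʳ-≡ (tri (columnCnt e v M c)) _ _ (begin
      inv U M + tri (cnt V M)        ≡⟨ cong (λ n → inv U M + tri n) column-cnt ⟨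
      inv U M + tri (cnt U M)        ≡⟨ wsum≡inv+tri U M ⟨
      wsum U M                       ≡⟨ +-cancelʳ-≡ r _ _ (trans (Moved-sum id M (≢-sym 1+n≢n) (<-trans (n<1+n r) sr<M) sr<M column) (+-suc (wsum V M) r)) ⟩
      suc (wsum V M)                 ≡⟨ cong suc (wsum≡inv+tri V M) ⟩
      suc (inv V M) + tri (cnt V M)  ∎)
      where
      open ≡-Reasoning
      U = col (config e u) c
      V = col (config e v) c

  Moved-columnCnt : ∀ c′ → c′ < e → columnCnt e u M c′ ≡ columnCnt e v M c′
  Moved-columnCnt c′ c′<e with c′ ≟ c
  ... | yes refl = column-cnt
  ... | no c′≢c  = cnt-cong M λ r′ _ → sym (other-column c′<e c′≢c r′)

  Moved-totalInv : totalInv e u M ≡ suc (totalInv e v M)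
  Moved-totalInv = begin
    totalInv e u M                                     ≡⟨ sumTo-cong e split ⟩
    sumTo (λ c′ → inv (col (config e v) c′) M + bead (c′ ≡? c)) e
      ≡⟨ sumTo-+ (λ c′ → inv (col (config e v) c′) M) (λ c′ → bead (c′ ≡? c)) e ⟩
    totalInv e v M + cnt (_≡? c) e                     ≡⟨ cong (totalInv e v M +_) single ⟩
    totalInv e v M + 1                                 ≡⟨ +-comm _ 1 ⟩
    suc (totalInv e v M)                               ∎
    where
    open ≡-Reasoning
    split : ∀ c′ → c′ < e → inv (col (config e u) c′) M ≡ inv (col (config e v) c′) M + bead (c′ ≡? c)
    split c′ c′<e with c′ ≟ c
    ... | yes refl = trans column-inv (+-comm 1 _)
    ... | no c′≢c  = trans (inv-cong M λ r′ _ → sym (other-column c′<e c′≢c r′)) (sym (+-identityʳ _))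
    single : cnt (_≡? c) e ≡ 1
    single = trans (cnt-+1 {g = λ _ → false} e c<e hit refl miss) (cong suc (sumTo-const0 e λ _ _ → refl))
      where
      hit : c ≡? c ≡ true
      hit with c ≟ c
      ... | yes _ = refl
      ... | no ne = contradiction refl ne
      miss : ∀ j → j ≢ c → j ≡? c ≡ false
      miss j j≢c with j ≟ c
      ... | yes eq = contradiction eq j≢c
      ... | no _   = refl

  private
    y+e<H : y + e < M * e
    y+e<H = ≰⇒> λ le → true≢false source-before (bounded (y + e) le)

    y<y+e : y < y + e
    y<y+e = m<m+n y (>-nonZero⁻¹ e)

  Moved-cnt-word : cnt u (M * e) ≡ cnt v (M * e)
  Moved-cnt-word = Moved-cnt (M * e) (<⇒≢ y<y+e) (<-trans y<y+e y+e<H) y+e<H mv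

  Moved-wsum : wsum u (M * e) ≡ wsum v (M * e) + e
  Moved-wsum = +-cancelʳ-≡ y _ _ (trans (Moved-sum id (M * e) (<⇒≢ y<y+e) (<-trans y<y+e y+e<H) y+e<H mv)
    (trans (cong (wsum v (M * e) +_) (+-comm y e)) (sym (+-assoc (wsum v (M * e)) e y))))

  Moved-Bounded : Bounded e M v
  Moved-Bounded = Moved-bounded y<y+e bounded mv

-- From β-sets to words

ℤ-difference-≡ : ∀ a b c d → ℤ.+ a ℤ.- ℤ.+ b ≡ ℤ.+ c ℤ.- ℤ.+ d ⇔ a + d ≡ c + b
ℤ-difference-≡ a b c d = mk⇔ to from
  where
  expand : ∀ a b d → a ℤ.- b ℤ.+ (b ℤ.+ d) ≡ a ℤ.+ d
  expand = ℤ.solve-∀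
  expand′ : ∀ c d b → c ℤ.- d ℤ.+ (b ℤ.+ d) ≡ c ℤ.+ b
  expand′ = ℤ.solve-∀
  contract : ∀ a b d → a ℤ.- b ≡ a ℤ.+ d ℤ.- (b ℤ.+ d)
  contract = ℤ.solve-∀
  contract′ : ∀ c b d → c ℤ.+ b ℤ.- (b ℤ.+ d) ≡ c ℤ.- d
  contract′ = ℤ.solve-∀
  to : ℤ.+ a ℤ.- ℤ.+ b ≡ ℤ.+ c ℤ.- ℤ.+ d → a + d ≡ c + b
  to eq = ℤ.+-injective (trans (sym (expand (ℤ.+ a) (ℤ.+ b) (ℤ.+ d)))
    (trans (cong (ℤ._+ (ℤ.+ b ℤ.+ ℤ.+ d)) eq) (expand′ (ℤ.+ c) (ℤ.+ d) (ℤ.+ b))))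
  from : a + d ≡ c + b → ℤ.+ a ℤ.- ℤ.+ b ≡ ℤ.+ c ℤ.- ℤ.+ d
  from eq = trans (contract (ℤ.+ a) (ℤ.+ b) (ℤ.+ d))
    (trans (cong (λ n → ℤ.+ n ℤ.- (ℤ.+ b ℤ.+ ℤ.+ d)) eq) (contract′ (ℤ.+ c) (ℤ.+ b) (ℤ.+ d)))

-- Integers from -n upwards are positions of the word. Those below -n lie in the β-set of every
-- partition with at most `n` parts and never take part in a move.
ℤ-offset : ∀ n b → (∃[ x ] b ≡ ℤ.+ x ℤ.- ℤ.+ n) ⊎ (∃[ j ] (n < j × b ≡ ℤ.+ 0 ℤ.- ℤ.+ j))
ℤ-offset n b with b ℤ.+ ℤ.+ n in eq
... | ℤ.+ x      = inj₁ (x , trans (undo b (ℤ.+ n)) (cong (ℤ._- ℤ.+ n) eq))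
  where
  undo : ∀ b n → b ≡ b ℤ.+ n ℤ.- n
  undo = ℤ.solve-∀
... | ℤ.-[1+ k ] = inj₂ (suc k + n , s≤s (m≤n+m n k) ,
    trans (undo b (ℤ.+ n)) (trans (cong (ℤ._- ℤ.+ n) eq) (negate (ℤ.+ suc k) (ℤ.+ n))))
  where
  undo : ∀ b n → b ≡ b ℤ.+ n ℤ.- n
  undo = ℤ.solve-∀
  negate : ∀ k n → ℤ.- k ℤ.- n ≡ ℤ.+ 0 ℤ.- (k ℤ.+ n)
  negate = ℤ.solve-∀

ℤ-subtract : ∀ y e n → ℤ.+ (y + e) ℤ.- ℤ.+ n ℤ.- ℤ.+ e ≡ ℤ.+ y ℤ.- ℤ.+ n
ℤ-subtract y e n = cancel (ℤ.+ y) (ℤ.+ e) (ℤ.+ n)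
  where
  cancel : ∀ y e n → y ℤ.+ e ℤ.- n ℤ.- e ≡ y ℤ.- n
  cancel = ℤ.solve-∀

ℤ-add-back : ∀ {y e n b} → b ℤ.- ℤ.+ e ≡ ℤ.+ y ℤ.- ℤ.+ n → b ≡ ℤ.+ (y + e) ℤ.- ℤ.+ n
ℤ-add-back {y} {e} {n} {b} eq = trans (undo b (ℤ.+ e)) (trans (cong (ℤ._+ ℤ.+ e) eq) (shuffle (ℤ.+ y) (ℤ.+ e) (ℤ.+ n)))
  where
  undo : ∀ b e → b ≡ b ℤ.- e ℤ.+ e
  undo = ℤ.solve-∀
  shuffle : ∀ y e n → y ℤ.- n ℤ.+ e ≡ y ℤ.+ e ℤ.- n
  shuffle = ℤ.solve-∀

β-set⇔wordOf : ∀ ν {n} → length (parts ν) ≤ n → ∀ {x} → β-set ν (ℤ.+ x ℤ.- ℤ.+ n) ⇔ wordOf (parts ν) n x ≡ true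
β-set⇔wordOf ν {n} len {x} = mk⇔
  (λ (j , j≥1 , eq) → Equivalence.from (wordOf-bead⇔entry {parts ν} len) (j , j≥1 , Equivalence.to (ℤ-difference-≡ x n (part ν j) j) eq))
  (λ wx → let (j , j≥1 , eq) = Equivalence.to (wordOf-bead⇔entry {parts ν} len) wx in
          j , j≥1 , Equivalence.from (ℤ-difference-≡ x n (part ν j) j) eq)

β-set-low : ∀ ν {j} → length (parts ν) < j → β-set ν (ℤ.+ 0 ℤ.- ℤ.+ j)
β-set-low ν {j} lt = j , ≤-trans (s≤s z≤n) lt , cong (λ p → ℤ.+ p ℤ.- ℤ.+ j) (sym (>length⇒entry-zero (parts ν) lt))

low≢ : ∀ {n j} x → n < j → ℤ.+ x ℤ.- ℤ.+ n ≢ ℤ.+ 0 ℤ.- ℤ.+ j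
low≢ {n} {j} x n<j eq = <⇒≢ (<-≤-trans n<j (m≤n+m j x)) (sym (Equivalence.to (ℤ-difference-≡ x n 0 j) eq))

Moved⇒Move : ∀ {e y n μ κ} → length (parts μ) ≤ n → length (parts κ) ≤ n →
             Moved y (y + e) (wordOf (parts μ) n) (wordOf (parts κ) n) → Move e μ κ
Moved⇒Move {e} {y} {n} {μ} {κ} lenμ lenκ mv =
  b , Equivalence.from (β-set⇔wordOf μ lenμ) source-before ,
  (λ b-e∈ → true≢false (Equivalence.to (β-set⇔wordOf μ lenμ) (subst (β-set μ) (ℤ-subtract y e n) b-e∈)) target-before) ,
  to , from
  where
  open Moved mv
  b = ℤ.+ (y + e) ℤ.- ℤ.+ n
  to : ∀ {z} → β-set κ z → (β-set μ z × ¬ b ≡ z) ⊎ b ℤ.- ℤ.+ e ≡ z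
  to {z} z∈ with ℤ-offset n z
  ... | inj₂ (j , n<j , refl) = inj₁ (β-set-low μ (≤-<-trans lenμ n<j) , low≢ (y + e) n<j)
  ... | inj₁ (x , refl) with x ≟ y | x ≟ y + e
  ...   | yes refl | _       = inj₂ (ℤ-subtract y e n)
  ...   | no _ | yes refl    = contradiction source-after (true≢false (Equivalence.to (β-set⇔wordOf κ lenκ) z∈))
  ...   | no x≢y | no x≢y+e  =
    inj₁ (Equivalence.from (β-set⇔wordOf μ lenμ) (trans (sym (elsewhere x x≢y x≢y+e)) (Equivalence.to (β-set⇔wordOf κ lenκ) z∈)) ,
          λ eq → x≢y+e (sym (+-cancelʳ-≡ n _ _ (Equivalence.to (ℤ-difference-≡ (y + e) n x n) eq))))
  from : ∀ {z} → (β-set μ z × ¬ b ≡ z) ⊎ b ℤ.- ℤ.+ e ≡ z → β-set κ z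
  from (inj₂ refl) = subst (β-set κ) (sym (ℤ-subtract y e n)) (Equivalence.from (β-set⇔wordOf κ lenκ) target-after)
  from {z} (inj₁ (z∈ , b≢z)) with ℤ-offset n z
  ... | inj₂ (j , n<j , refl) = β-set-low κ (≤-<-trans lenκ n<j)
  ... | inj₁ (x , refl) = Equivalence.from (β-set⇔wordOf κ lenκ) (trans (elsewhere x x≢y x≢y+e) ux)
    where
    ux : wordOf (parts μ) n x ≡ true
    ux = Equivalence.to (β-set⇔wordOf μ lenμ) z∈
    x≢y : x ≢ y
    x≢y refl = true≢false ux target-before
    x≢y+e : x ≢ y + e
    x≢y+e refl = b≢z refl

-- The bound on the parts of `κ` needs an argument: if `κ` had ℓ > n parts, then -ℓ would not lie in
-- its β-set, since the values up to row ℓ exceed -ℓ and the later ones are smaller. But -ℓ lies in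
-- the β-set of `μ` and is too low to be the element moved.
Move⇒Moved : ∀ {e n μ κ} → 0 < e → length (parts μ) ≤ n → Move e μ κ →
             length (parts κ) ≤ n × ∃[ y ] Moved y (y + e) (wordOf (parts μ) n) (wordOf (parts κ) n)
Move⇒Moved {e} {n} {μ} {κ} 0<e lenμ (b , b∈ , b-e∉ , κ⊆ , κ⊇) with ℤ-offset n (b ℤ.- ℤ.+ e)
-- A value below -n would lie in the β-set of `μ`, whereas `b ℤ.- ℤ.+ e` does not.
... | inj₂ (j , n<j , eq) = contradiction (subst (β-set μ) (sym eq) (β-set-low μ (≤-<-trans lenμ n<j))) b-e∉
... | inj₁ (y , eq) with refl ← ℤ-add-back {y} {e} {n} {b} eq = lenκ , y , record
  { source-before = Equivalence.to (β-set⇔wordOf μ lenμ) b∈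
  ; target-before = not-bead μ lenμ (λ y∈ → b-e∉ (subst (β-set μ) (sym eq) y∈))
  ; source-after  = not-bead κ lenκ (λ b∈κ → excluded (κ⊆ b∈κ))
  ; target-after  = Equivalence.to (β-set⇔wordOf κ lenκ) (κ⊇ (inj₂ eq))
  ; elsewhere     = elsewhere
  }
  where
  not-bead : ∀ ν (len : length (parts ν) ≤ n) {x} → ¬ β-set ν (ℤ.+ x ℤ.- ℤ.+ n) → wordOf (parts ν) n x ≡ false
  not-bead ν len {x} ∉ with true-or-false (wordOf (parts ν) n x)
  ... | inj₁ wx = contradiction (Equivalence.from (β-set⇔wordOf ν len) wx) ∉
  ... | inj₂ wx = wx
  lenκ : length (parts κ) ≤ n
  lenκ = ≮⇒≥ λ n<ℓ → low-excluded n<ℓ (κ⊇ (inj₁ (β-set-low μ (≤-<-trans lenμ n<ℓ) , low≢ (y + e) n<ℓ)))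
    where
    low-excluded : n < length (parts κ) → ¬ β-set κ (ℤ.+ 0 ℤ.- ℤ.+ length (parts κ))
    low-excluded n<ℓ (j , j≥1 , eq′) with j ≤? length (parts κ)
    ... | yes j≤ = <⇒≢ (<-≤-trans (s≤s j≤) (+-monoˡ-≤ _ (≤length⇒entry-positive (positive κ) j≥1 j≤)))
                       (Equivalence.to (ℤ-difference-≡ 0 (length (parts κ)) (part κ j) j) eq′)
    ... | no j≰  = <⇒≢ (≰⇒> j≰) (sym (trans (Equivalence.to (ℤ-difference-≡ 0 (length (parts κ)) (part κ j) j) eq′)
                       (cong (_+ length (parts κ)) (>length⇒entry-zero (parts κ) (≰⇒> j≰)))))
  excluded : ¬ ((β-set μ (ℤ.+ (y + e) ℤ.- ℤ.+ n) × ¬ ℤ.+ (y + e) ℤ.- ℤ.+ n ≡ ℤ.+ (y + e) ℤ.- ℤ.+ n) ⊎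
                ℤ.+ (y + e) ℤ.- ℤ.+ n ℤ.- ℤ.+ e ≡ ℤ.+ (y + e) ℤ.- ℤ.+ n)
  excluded (inj₁ (_ , ne)) = ne refl
  excluded (inj₂ eq′) = <⇒≢ (m<m+n y 0<e)
    (+-cancelʳ-≡ n _ _ (Equivalence.to (ℤ-difference-≡ y n (y + e) n) (trans (sym eq) eq′)))
  elsewhere : ∀ x → x ≢ y → x ≢ y + e → wordOf (parts κ) n x ≡ wordOf (parts μ) n x
  elsewhere x x≢y x≢y+e with true-or-false (wordOf (parts μ) n x)
  ... | inj₁ ux = trans (Equivalence.to (β-set⇔wordOf κ lenκ) (κ⊇ (inj₁ (Equivalence.from (β-set⇔wordOf μ lenμ) ux ,
                    λ eq′ → x≢y+e (sym (+-cancelʳ-≡ n _ _ (Equivalence.to (ℤ-difference-≡ (y + e) n x n) eq′))))))) (sym ux)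
  ... | inj₂ ux = trans (not-bead κ lenκ λ x∈ → absent (κ⊆ x∈)) (sym ux)
    where
    absent : ¬ ((β-set μ (ℤ.+ x ℤ.- ℤ.+ n) × ¬ ℤ.+ (y + e) ℤ.- ℤ.+ n ≡ ℤ.+ x ℤ.- ℤ.+ n) ⊎
                ℤ.+ (y + e) ℤ.- ℤ.+ n ℤ.- ℤ.+ e ≡ ℤ.+ x ℤ.- ℤ.+ n)
    absent (inj₁ (x∈ , _)) = true≢false (Equivalence.to (β-set⇔wordOf μ lenμ) x∈) ux
    absent (inj₂ eq′) = x≢y (sym (+-cancelʳ-≡ n _ _ (Equivalence.to (ℤ-difference-≡ y n x n) (trans (sym eq) eq′))))

-- The abacus of a partition and of its core

lab-cong : ∀ {e m m′} → m ≈[ e ] m′ → ∀ r {c} → c < e → lab e m r c ≡ lab e m′ r c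
lab-cong {e} eq r c<e = cong₂ _+_
  (sumTo-cong r λ s _ → sumTo-cong e λ c′ c′<e → cong gap (eq s c′ c′<e))
  (sumTo-cong _ λ c′ c′≤c → cong gap (eq r c′ (<-≤-trans c′≤c c<e)))

BalancedC-cong : ∀ {d e m m′} → m ≈[ e ] m′ → BalancedC d e m → BalancedC d e m′
BalancedC-cong {d} eq bal {c} {r} {s} c<e r<s mr ms = subst₂ (Congruent d) (lab-cong eq r c<e) (lab-cong eq s c<e)
  (bal c<e r<s (trans (eq r c c<e) mr) (trans (eq s c c<e) ms))

RegularC-cong : ∀ {e m m′} → m ≈[ e ] m′ → RegularC e m → RegularC e m′
RegularC-cong eq reg {r} {c} c<e mr = subst₂ _≢_ (lab-cong eq r c<e) (lab-cong eq (suc r) c<e)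
  (reg c<e (trans (eq r c c<e) mr))

descent-free⇒inv≡0 : ∀ {f} M → (∀ r → suc r < M → f (suc r) ≡ true → f r ≡ true) → inv f M ≡ 0
descent-free⇒inv≡0 {f} M down = sumTo-const0 M λ r r<M → term r r<M (f r) refl
  where
  none : ∀ r → r < M → f r ≡ true → gaps f r ≡ 0
  none zero    _    _  = refl
  none (suc r) r<M fr =
    trans (cong₂ (λ g b → g + gap b) (none r (<-trans (n<1+n r) r<M) (down r r<M fr)) (down r r<M fr)) refl
  term : ∀ r → r < M → ∀ b → f r ≡ b → (if f r then gaps f r else 0) ≡ 0
  term r r<M true  fr = trans (cong (if_then gaps f r else 0) fr) (none r r<M fr)
  term r r<M false fr = cong (if_then gaps f r else 0) fr

inv≢0⇒descent : ∀ {f} M → inv f M ≢ 0 → ∃[ r ] (f r ≡ false × f (suc r) ≡ true)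
inv≢0⇒descent {f} M inv≢0 with greatest-below (λ r → (f r ≟ᵇ false) ×-dec (f (suc r) ≟ᵇ true)) M
... | inj₁ (r , _ , descent , _) = r , descent
... | inj₂ none = contradiction (descent-free⇒inv≡0 M down) inv≢0
  where
  down : ∀ r → suc r < M → f (suc r) ≡ true → f r ≡ true
  down r r<M fsr with true-or-false (f r)
  ... | inj₁ fr = fr
  ... | inj₂ fr = contradiction (fr , fsr) (none r (<-trans (n<1+n r) r<M))

sumTo≢0 : ∀ f n → sumTo f n ≢ 0 → ∃[ k ] (k < n × f k ≢ 0)
sumTo≢0 f zero    ne = contradiction refl ne
sumTo≢0 f (suc n) ne with f n ≟ 0
... | no fn≢0 = n , n<1+n n , fn≢0
... | yes fn≡0 with sumTo≢0 f n (λ eq → ne (cong₂ _+_ eq fn≡0))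
...   | k , k<n , fk≢0 = k , m<n⇒m<1+n k<n , fk≢0

-- Without inversions the beads are exactly the positions below the bead number, as `bead⇒<cnt+inv`
-- and `gap⇒cnt≤` show.
inv≡0-unique : ∀ {f g} M → inv f M ≡ 0 → inv g M ≡ 0 → cnt f M ≡ cnt g M → ∀ {r} → r < M → f r ≡ true → g r ≡ true
inv≡0-unique {f} {g} M inv-f inv-g cnt≡ {r} r<M fr with true-or-false (g r)
... | inj₁ gr = gr
... | inj₂ gr = contradiction
  (subst (cnt g M ≤_) (trans (cong (r +_) inv-g) (+-identityʳ r)) (gap⇒cnt≤ g r<M gr))
  (<⇒≱ (subst (r <_) (trans (cong (cnt f M +_) inv-f) (trans (+-identityʳ _) cnt≡)) (bead⇒<cnt+inv f r<M fr)))

wordOf-fits : ∀ {ps n H} → (∀ x → H ≤ x → wordOf ps n x ≡ false) → length ps ≤ n → entry ps 1 + n ≤ H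
wordOf-fits {[]}     {n}     {H} bounded _ = ≮⇒≥ λ H<n → true≢false (wordOf-[]-bead H<n) (bounded H ≤-refl)
wordOf-fits {p ∷ ps} {suc n} {H} bounded _ = subst (_≤ H) (sym (+-suc p n))
  (≰⇒> λ H≤ → true≢false (wordOf-head p ps n) (bounded (p + n) H≤))

length≤sum : ∀ {ps} → All (1 ≤_) ps → length ps ≤ sum ps
length≤sum []          = z≤n
length≤sum (p≥1 ∷ pos) = +-mono-≤ p≥1 (length≤sum pos)

wordPartition : (ℕ → Bool) → ℕ → Partition
wordPartition u H = mkPartition (partsOf u H) (Linked-tail (partsOf-Linked u H (gaps u H) ≤-refl)) (partsOf-positive u H)

module Abacus (e : ℕ) .{{_ : NonZero e}} (n : ℕ) where

  Word : Partition → ℕ → Bool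
  Word ν = wordOf (parts ν) n

  wordPartition-spec : ∀ {u H} → (∀ x → H ≤ x → u x ≡ false) → cnt u H ≡ n →
                       length (parts (wordPartition u H)) ≤ n × (∀ x → Word (wordPartition u H) x ≡ u x)
  wordPartition-spec {u} {H} bounded refl = partsOf-length u H , wordOf-partsOf u H bounded

  Word-size : ∀ ν M → length (parts ν) ≤ n → Bounded e M (Word ν) → wsum (Word ν) (M * e) ≡ size ν + tri n
  Word-size ν M len bounded = wsum-wordOf (M * e) (decreasing ν) len (wordOf-fits {parts ν} bounded len)

  Word-cnt : ∀ ν M → length (parts ν) ≤ n → Bounded e M (Word ν) → cnt (Word ν) (M * e) ≡ n
  Word-cnt ν M len bounded = cnt-wordOf (M * e) (decreasing ν) len (wordOf-fits {parts ν} bounded len)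

  Word-Bounded : ∀ ν {M} → length (parts ν) ≤ n → size ν + n ≤ M → Bounded e M (Word ν)
  Word-Bounded ν {M} len le x M*e≤x = wordOf-bounded (decreasing ν) len
    (≤-trans (+-monoˡ-≤ n (head-≤-sum (parts ν))) (≤-trans le (≤-trans (m≤m*n M e) M*e≤x)))

  Word-injective : ∀ {μ ν} → length (parts μ) ≤ n → length (parts ν) ≤ n → (∀ x → Word μ x ≡ Word ν x) → μ ≡ ν
  Word-injective {μ} {ν} lenμ lenν eq = parts-injective
    (wordOf-injective (decreasing μ) (decreasing ν) (positive μ) (positive ν) lenμ lenν eq)

  config-injective : ∀ {u v} → config e u ≈[ e ] config e v → ∀ x → u x ≡ v x
  config-injective {u} {v} eq x =
    trans (cong u (position x e)) (trans (eq (x / e) (x % e) (DivMod.m%n<n x e)) (cong v (sym (position x e))))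

  columnCnt-cong : ∀ {u v} M → (∀ x → u x ≡ v x) → ∀ c → columnCnt e u M c ≡ columnCnt e v M c
  columnCnt-cong M eq c = cnt-cong M λ r _ → eq (r * e + c)

  totalInv≡0-unique : ∀ {u v} M → Bounded e M u → Bounded e M v → totalInv e u M ≡ 0 → totalInv e v M ≡ 0 →
                      (∀ c → c < e → columnCnt e u M c ≡ columnCnt e v M c) → ∀ x → u x ≡ v x
  totalInv≡0-unique {u} {v} M bu bv u≡0 v≡0 cnt≡ = config-injective λ r c c<e → agree r c c<e
    where
    column≡0 : ∀ u → totalInv e u M ≡ 0 → ∀ {c} → c < e → inv (col (config e u) c) M ≡ 0
    column≡0 u eq {c} c<e = n≤0⇒n≡0 (subst (inv (col (config e u) c) M ≤_) eq (sumTo-lookup-≤ (λ c → inv (col (config e u) c) M) c<e))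
    agree : config e u ≈[ e ] config e v
    agree r c c<e with r <? M
    ... | no r≮M  = trans (config-bounded {e} {M} {u} bu (≮⇒≥ r≮M)) (sym (config-bounded {e} {M} {v} bv (≮⇒≥ r≮M)))
    ... | yes r<M with true-or-false (config e u r c) | true-or-false (config e v r c)
    ...   | inj₁ p | _      = trans p (sym (inv≡0-unique {col (config e u) c} {col (config e v) c} M (column≡0 u u≡0 c<e) (column≡0 v v≡0 c<e) (cnt≡ c c<e) r<M p))
    ...   | inj₂ p | inj₂ q = trans p (sym q)
    ...   | inj₂ p | inj₁ q = contradiction p (true≢false
            (inv≡0-unique {col (config e v) c} {col (config e u) c} M (column≡0 v v≡0 c<e) (column≡0 u u≡0 c<e) (sym (cnt≡ c c<e)) r<M q))

  cnt-columns : ∀ u M → cnt u (M * e) ≡ sumTo (columnCnt e u M) e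
  cnt-columns u M = trans (sumTo-rows (bead ∘ u) e M) (sumTo-exchange (λ r c → bead (u (r * e + c))) M e)

  Terminal⇒totalInv≡0 : ∀ {γ} → length (parts γ) ≤ n → Terminal e γ → ∀ M → totalInv e (Word γ) M ≡ 0
  Terminal⇒totalInv≡0 {γ} len terminal M = sumTo-const0 e λ c _ → descent-free⇒inv≡0 {col (config e (Word γ)) c} M λ r _ → down r c
    where
    down : ∀ r c → Word γ (e + r * e + c) ≡ true → Word γ (r * e + c) ≡ true
    down r c wx = Equivalence.to (β-set⇔wordOf γ len)
      (subst (β-set γ) (ℤ-subtract (r * e + c) e n)
        (terminal _ (Equivalence.from (β-set⇔wordOf γ len) (subst (λ x → Word γ x ≡ true)
          (trans (+-assoc e (r * e) c) (+-comm e _)) wx))))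

  -- What `k` moves do. Each lowers the inversions by one and the sum of the bead positions by `e`,
  -- so comparing the two identifies the total number of inversions with the e-weight.
  record Descends (M k : ℕ) (ν γ : Partition) : Set where
    field
      length≤   : length (parts γ) ≤ n
      bounded   : Bounded e M (Word γ)
      columns   : ∀ c → c < e → columnCnt e (Word ν) M c ≡ columnCnt e (Word γ) M c
      inversion : totalInv e (Word ν) M ≡ k + totalInv e (Word γ) M
      weight    : wsum (Word ν) (M * e) ≡ k * e + wsum (Word γ) (M * e)

  moves-descend : ∀ {M ν γ} → length (parts ν) ≤ n → Bounded e M (Word ν) → Star (Move e) ν γ → ∃[ k ] Descends M k ν γ
  moves-descend len bounded ε = 0 , record
    { length≤ = len ; bounded = bounded ; columns = λ _ _ → refl ; inversion = refl ; weight = refl }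
  moves-descend {M} {ν} len bounded (_◅_ {j = κ} move moves) with Move⇒Moved {μ = ν} {κ} (>-nonZero⁻¹ e) len move
  ... | lenκ , y , mv with moves-descend {M} lenκ (Moved-Bounded {e} {M} bounded mv) moves
  ...   | k , desc = suc k , record
    { length≤   = length≤
    ; bounded   = bounded′
    ; columns   = λ c c<e → trans (Moved-columnCnt {e} {M} bounded mv c c<e) (columns c c<e)
    ; inversion = trans (Moved-totalInv {e} {M} bounded mv) (cong suc inversion)
    ; weight    = trans (Moved-wsum {e} {M} bounded mv)
                        (trans (cong (_+ e) weight) (trans (+-comm _ e) (sym (+-assoc e (k * e) _))))
    }
    where open Descends desc renaming (bounded to bounded′)

  -- As long as there are inversions, some column has a gap directly below a bead, and that bead can
  -- move. Without inversions the word is determined by its column counts, hence equals that of `γ`.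
  moves-to-core : ∀ k {M ν γ} → length (parts ν) ≤ n → length (parts γ) ≤ n → Bounded e M (Word ν) → Bounded e M (Word γ) →
                  totalInv e (Word ν) M ≡ k → totalInv e (Word γ) M ≡ 0 →
                  (∀ c → c < e → columnCnt e (Word ν) M c ≡ columnCnt e (Word γ) M c) → Star (Move e) ν γ
  moves-to-core zero {M} {ν} {γ} lenν lenγ bν bγ ν≡0 γ≡0 cnt≡
    with refl ← Word-injective {ν} {γ} lenν lenγ (totalInv≡0-unique M bν bγ ν≡0 γ≡0 cnt≡) = ε
  moves-to-core (suc k) {M} {ν} {γ} lenν lenγ bν bγ ν≡ γ≡0 cnt≡
    with sumTo≢0 _ e (λ eq → 1+n≢0 (trans (sym ν≡) eq))
  ... | c , c<e , inv≢0 with inv≢0⇒descent {col (config e (Word ν)) c} M inv≢0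
  ...   | r , target , source =
    _◅_ {j = κ} (Moved⇒Move {μ = ν} {κ} lenν (proj₁ spec) mv)
    (moves-to-core k {M} {κ} (proj₁ spec) lenγ (Moved-Bounded {e} {M} bν mv) bγ
      (suc-injective (trans (sym (Moved-totalInv {e} {M} bν mv)) ν≡)) γ≡0
      (λ c c<e → trans (sym (Moved-columnCnt {e} {M} bν mv c c<e)) (cnt≡ c c<e)))
    where
    y = r * e + c
    v = add y (remove (y + e) (Word ν))
    mv₀ : Moved y (y + e) (Word ν) v
    mv₀ = Moved-add-remove (<⇒≢ (m<m+n y (>-nonZero⁻¹ e)))
      (subst (λ x → Word ν x ≡ true) (trans (+-assoc e (r * e) c) (+-comm e y)) source) target
    κ = wordPartition v (M * e)
    spec : length (parts κ) ≤ n × (∀ x → Word κ x ≡ v x)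
    spec = wordPartition-spec (Moved-Bounded {e} {M} bν mv₀)
      (trans (sym (Moved-cnt-word {e} {M} bν mv₀)) (Word-cnt ν M lenν bν))
    mv : Moved y (y + e) (Word ν) (Word κ)
    mv = Moved-cong (proj₂ spec) mv₀

-- The partitions of a block as configurations

module _ (d e w : ℕ) .{{_ : NonZero e}} (γ : Partition) (terminal : Terminal e γ) where

  private
    n : ℕ
    -- The first two summands bound the number of parts of every partition in the block. The third
    -- fills the first `w` rows of the core with beads, so that every runner has at least `w` of
    -- them.
    n = size γ + w * e + w * e

    open Abacus e n

    short : ∀ {ν} → size ν ≤ size γ + w * e → length (parts ν) ≤ n
    short {ν} le = ≤-trans (length≤sum (positive ν)) (≤-trans le (m≤m+n _ (w * e)))

    lenγ : length (parts γ) ≤ n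
    lenγ = short {γ} (m≤m+n (size γ) (w * e))

    Mγ : ℕ
    Mγ = size γ + n

    boundedγ : ∀ {M} → Mγ ≤ M → Bounded e M (Word γ)
    boundedγ = Word-Bounded γ lenγ

    columnγ : ∀ {M} → Mγ ≤ M → ∀ c → columnCnt e (Word γ) M c ≡ columnCnt e (Word γ) Mγ c
    columnγ le c = cnt-stable _ le λ r → config-bounded {e} {Mγ} {Word γ} (boundedγ ≤-refl)

  coreCounts : List ℕ
  coreCounts = applyUpTo (columnCnt e (Word γ) Mγ) e

  coreCounts-length : length coreCounts ≡ e
  coreCounts-length = List.length-applyUpTo (columnCnt e (Word γ) Mγ) e

  coreCounts-≥ : All (w ≤_) coreCounts
  coreCounts-≥ = All.applyUpTo⁺₁ (columnCnt e (Word γ) Mγ) e λ {c} c<e →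
    ≤-trans (≤-reflexive (sym (sumTo-const1 w λ r r<w → cong bead (low r c r<w c<e)))) (sumTo-monoʳ-≤ _ w≤Mγ)
    where
    w≤Mγ : w ≤ Mγ
    w≤Mγ = ≤-trans (m≤m*n w e) (≤-trans (m≤n+m (w * e) (size γ + w * e)) (m≤n+m n (size γ)))
    low : ∀ r c → r < w → c < e → Word γ (r * e + c) ≡ true
    low r c r<w c<e = wordOf-low {parts γ} {n} {r * e + c} (begin-strict
      r * e + c + length (parts γ)   <⟨ +-monoˡ-< (length (parts γ)) (+-monoʳ-< (r * e) c<e) ⟩
      r * e + e + length (parts γ)   ≡⟨ cong (_+ length (parts γ)) (+-comm (r * e) e) ⟩
      suc r * e + length (parts γ)   ≤⟨ +-mono-≤ (*-monoˡ-≤ e r<w) (≤-trans (length≤sum (positive γ)) (m≤m+n (size γ) (w * e))) ⟩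
      w * e + (size γ + w * e)       ≡⟨ +-comm (w * e) _ ⟩
      n                              ∎)
      where open ≤-Reasoning

  private
    block-length : ∀ {ν} → Block e γ w ν → length (parts ν) ≤ n
    block-length {ν} (_ , size≡) = short {ν} (≤-reflexive size≡)

    block⇒class : ∀ {ν} → Block e γ w ν → Class e coreCounts w (config e (Word ν))
    block⇒class {ν} block@((moves , _) , size≡) with moves-descend {(size ν + n) ⊔ Mγ} (block-length {ν} block)
                                                 (Word-Bounded ν (block-length {ν} block) (m≤m⊔n (size ν + n) Mγ)) moves
    ... | k , desc = record
      { height  = M
      ; bounded = λ {r} {c} M≤r _ → config-bounded {e} {M} {Word ν} boundedν M≤r
      ; counts  = applyUpTo-cong e λ c c<e → trans (columns c c<e) (columnγ (m≤n⊔m (size ν + n) Mγ) c)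
      ; weight  = trans inversion (trans (cong (k +_) (Terminal⇒totalInv≡0 {γ} lenγ terminal M)) (trans (+-identityʳ k) k≡w))
      }
      where
      open Descends desc
      M = (size ν + n) ⊔ Mγ
      boundedν : Bounded e M (Word ν)
      boundedν = Word-Bounded ν (block-length {ν} block) (m≤m⊔n (size ν + n) Mγ)
      k≡w : k ≡ w
      -- The sum of the bead positions of `ν` exceeds that of `γ` by `k * e` according to the moves,
      -- and by `w * e` according to the sizes.
      k≡w = *-cancelʳ-≡ k w e (+-cancelʳ-≡ (size γ + tri n) _ _ (begin
        k * e + (size γ + tri n)              ≡⟨ cong (k * e +_) (Word-size γ M lenγ bounded) ⟨
        k * e + wsum (Word γ) (M * e)         ≡⟨ weight ⟨
        wsum (Word ν) (M * e)                 ≡⟨ Word-size ν M (block-length {ν} block) boundedν ⟩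
        size ν + tri n                        ≡⟨ cong (_+ tri n) (trans size≡ (+-comm (size γ) (w * e))) ⟩
        w * e + size γ + tri n                ≡⟨ +-assoc (w * e) (size γ) (tri n) ⟩
        w * e + (size γ + tri n)              ∎))
        where open ≡-Reasoning

    -- Reading `m` row by row gives a word `u`. Its columns have as many beads as those of the core,
    -- so it has `n` beads in all and is the word of a partition. The moves down to `γ` then number
    -- `w`, which gives the size.
    class⇒block : ∀ {m} → Class e coreCounts w m → ∃[ ν ] (Block e γ w ν × m ≈[ e ] config e (Word ν))
    class⇒block {m} cl = ν , ((moves , terminal) , size≡) , m≈
      where
      h = Class.height cl
      M = h ⊔ Mγ
      u : ℕ → Bool
      u x = m (x / e) (x % e)
      u≡ : ∀ r c → c < e → u (r * e + c) ≡ m r c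
      u≡ r c c<e = cong₂ m (sym (proj₁ same)) (sym (proj₂ same))
        where
        same : r ≡ (r * e + c) / e × c ≡ (r * e + c) % e
        same = position-injective {e} {r} {(r * e + c) / e} c<e (DivMod.m%n<n (r * e + c) e) (position (r * e + c) e)
      bounded-u : Bounded e M u
      bounded-u x le = Class.bounded cl (≤-trans (m≤m⊔n h Mγ) (subst (_≤ x / e) (DivMod.m*n/n≡m M e) (DivMod./-monoˡ-≤ e le)))
                                        (DivMod.m%n<n x e)
      columns-m : ∀ c → c < e → cnt (col m c) h ≡ columnCnt e (Word γ) Mγ c
      columns-m c c<e = applyUpTo-injective e (Class.counts cl) c<e
      columns-u : ∀ c → c < e → columnCnt e u M c ≡ columnCnt e (Word γ) M c
      columns-u c c<e = begin
        columnCnt e u M c             ≡⟨ cnt-cong M (λ r _ → u≡ r c c<e) ⟩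
        cnt (col m c) M               ≡⟨ cnt-stable _ (m≤m⊔n h Mγ) (λ r h≤r → Class.bounded cl h≤r c<e) ⟩
        cnt (col m c) h               ≡⟨ columns-m c c<e ⟩
        columnCnt e (Word γ) Mγ c     ≡⟨ columnγ (m≤n⊔m h Mγ) c ⟨
        columnCnt e (Word γ) M c      ∎
        where open ≡-Reasoning
      cnt-u : cnt u (M * e) ≡ n
      cnt-u = begin
        cnt u (M * e)                          ≡⟨ cnt-columns u M ⟩
        sumTo (columnCnt e u M) e              ≡⟨ sumTo-cong e columns-u ⟩
        sumTo (columnCnt e (Word γ) M) e       ≡⟨ cnt-columns (Word γ) M ⟨
        cnt (Word γ) (M * e)                   ≡⟨ Word-cnt γ M lenγ (boundedγ (m≤n⊔m h Mγ)) ⟩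
        n                                      ∎
        where open ≡-Reasoning
      ν : Partition
      ν = wordPartition u (M * e)
      spec : length (parts ν) ≤ n × (∀ x → Word ν x ≡ u x)
      spec = wordPartition-spec bounded-u cnt-u
      m≈ : m ≈[ e ] config e (Word ν)
      m≈ r c c<e = trans (sym (u≡ r c c<e)) (sym (proj₂ spec (r * e + c)))
      boundedν : Bounded e M (Word ν)
      boundedν x le = trans (proj₂ spec x) (bounded-u x le)
      inversion : totalInv e (Word ν) M ≡ w
      inversion = trans (sumTo-cong e λ c c<e →
        trans (inv-cong M λ r _ → sym (m≈ r c c<e))
              (inv-stable (col m c) (m≤m⊔n h Mγ) λ r h≤r → Class.bounded cl h≤r c<e)) (Class.weight cl)
      moves : Star (Move e) ν γ
      moves = moves-to-core w {M} (proj₁ spec) lenγ boundedν (boundedγ (m≤n⊔m h Mγ)) inversion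
        (Terminal⇒totalInv≡0 {γ} lenγ terminal M)
        (λ c c<e → trans (columnCnt-cong M (proj₂ spec) c) (columns-u c c<e))
      size≡ : size ν ≡ size γ + w * e
      size≡ = +-cancelʳ-≡ (tri n) (size ν) (size γ + w * e) (begin
        size ν + tri n                        ≡⟨ Word-size ν M (proj₁ spec) boundedν ⟨
        wsum (Word ν) (M * e)                 ≡⟨ weight ⟩
        k * e + wsum (Word γ) (M * e)         ≡⟨ cong₂ (λ k s → k * e + s) k≡w (Word-size γ M lenγ bounded) ⟩
        w * e + (size γ + tri n)              ≡⟨ +-assoc (w * e) (size γ) (tri n) ⟨
        w * e + size γ + tri n                ≡⟨ cong (_+ tri n) (+-comm (w * e) (size γ)) ⟩
        size γ + w * e + tri n                ∎)
        where
        descends : ∃[ k ] Descends M k ν γ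
        descends = moves-descend {M} (proj₁ spec) boundedν moves
        k = proj₁ descends
        open Descends (proj₂ descends) renaming (inversion to descent)
        open ≡-Reasoning
        k≡w : k ≡ w
        k≡w = trans (sym (trans descent (trans (cong (k +_) (Terminal⇒totalInv≡0 {γ} lenγ terminal M)) (+-identityʳ k)))) inversion

  block-correspondence :
    Correspondence (_≈[ e ]_) _≡_ (Good d e coreCounts w) (λ ν → Block e γ w ν × Regular e ν × Balanced d e ν)
                   (λ m ν → m ≈[ e ] config e (Word ν))
  block-correspondence = record
    { total      = λ m (cl , bal , reg) → let (ν , block , m≈) = class⇒block cl
                                              open PartitionWord ν (block-length {ν} block) in
                     ν , (block , RegularC⇒Regular (λ {r} → RegularC-cong m≈ reg {r}) , BalancedC⇒Balanced (BalancedC-cong m≈ bal)) , m≈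
    ; surjective = λ ν (block , reg , bal) → let open PartitionWord ν (block-length {ν} block) in
                     config e (Word ν) ,
                     (block⇒class {ν} block , Balanced⇒BalancedC bal , λ {r} → Regular⇒RegularC (>-nonZero⁻¹ e) reg {r}) ,
                     λ _ _ _ → refl
    ; functional = λ { {y = ν} {ν′} _ _ (block , _) (block′ , _) m≈ m′≈ m≈m′ →
                     Word-injective {ν} {ν′} (block-length {ν} block) (block-length {ν′} block′) (config-injective λ r c c<e →
                       trans (sym (m≈ r c c<e)) (trans (m≈m′ r c c<e) (m′≈ r c c<e))) }
    ; injective  = λ { _ _ _ _ m≈ m′≈ refl r c c<e → trans (m≈ r c c<e) (sym (m′≈ r c c<e)) }
    }

theorem5p1 : (d e w : ℕ) .{{_ : NonZero d}} → 1 < d → 1 < e →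
    (γ : Partition) → IsCore e γ →
    HasCardinality
    (λ ν → Block e γ w ν × Regular e ν × Balanced d e ν)
    ((w + (e ∸ 1) / d ∸ 1) C w)
theorem5p1 d (suc k) w 1<d _ γ (_ , terminal) = Card-≡⇒HasCardinality
  (Card-transfer (block-correspondence d (suc k) w γ terminal)
    (good-count d k w 1<d (coreCounts-length d (suc k) w γ terminal) (coreCounts-≥ d (suc k) w γ terminal)))
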